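{- Tall tame easels are not critical. That is, if $(\mathcal G,z,x,\psi)$ is an easel that is tall and tame, then the canvas $(\mathcal G,z)$ is not $\psi$-critical.
   Context: Graphs are finite, loopless, and may have parallel edges. A $\mathbb{Z}_3$-boundary of a graph $G$ is a map $\beta:V(G)\to\mathbb{Z}_3$ with $\sum_{v\in V(C)}\beta(v)=0$ for every component $C$ of $G$; $\mathcal G=(G,\beta)$ is a $\mathbb{Z}_3$-bordered graph. A nowhere-zero flow in $(G,\beta)$ is an orientation of $G$ with $\deg^+(v)-\deg^-(v)\equiv\beta(v)\pmod 3$ for every $v$. For a vertex $v$, $|\tau(v)|$ equals $0$ if $\deg(v)$ is even and $\beta(v)=0$; $2$ if $\deg(v)$ is even and $\beta(v)\neq 0$; $3$ if $\deg(v)$ is odd and $\beta(v)=0$; $1$ if $\deg(v)$ is odd and $\beta(v)\neq0$. For a partition $\mathcal P$ of $V(G)$, $\mathcal G/\mathcal P$ is obtained by identifying each part into one vertex, deleting loops, and giving each new vertex the sum of $\beta$ over its part; $\mathcal P$ is non-trivial if some part has at least two vertices. A canvas $(\mathcal G,z)$ is a $\mathbb{Z}_3$-bordered graph with a distinguished vertex $z$ (the tip). A tip preflow is an orientation $\psi$ of the edges incident with $z$ with (counting in $\psi$) $\deg^+(z)-\deg^-(z)\equiv\beta(z)\pmod 3$; it extends to a nowhere-zero flow if some nowhere-zero flow agrees with $\psi$ on the edges at $z$. A partition is tip-respecting if $\{z\}$ is a part; then $(\mathcal G/\mathcal P,z)$ is a canvas with the same tip preflows. The canvas is $\psi$-critical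 if $\psi$ does not extend to a nowhere-zero flow in $\mathcal G$ but extends to one in $\mathcal G/\mathcal P$ for every non-trivial tip-respecting partition $\mathcal P$. An easel is a tuple $(\mathcal G,z,x,\psi)$ where $(\mathcal G,z)$ is a canvas, $x\neq z$ is a vertex and $\psi$ is a tip preflow. It is tame if $\deg(v)\ge 4+|\tau(v)|$ for all $v\notin\{x,z\}$; tall if $\deg(z)\le\deg(x)+2$ and, in case $\deg(z)=\deg(x)+2$, there is an edge incident with $z$ but not $x$ that $\psi$ directs towards $z$ and another such edge that $\psi$ directs away from $z$; critical if $(\mathcal G,z)$ is $\psi$-critical. -}

module Defs where

open import Data.Nat using (ℕ; zero; suc; _+_; _≤_)
open import Data.Nat.DivMod using (_%_; _mod_)
open import Data.Integer using (ℤ; +_; _-_)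
open import Data.Integer.DivMod using (_%ℕ_)
open import Data.Fin using (Fin; toℕ; _≟_)
open import Data.Fin.Properties using ()
open import Data.List using (List; []; _∷_; length; filter; lookup; map; foldr)
open import Data.List using (allFin)
open import Data.Bool using (Bool; true; false; if_then_else_)
open import Data.Product using (_×_; _,_; proj₁; proj₂; Σ; ∃; ∃-syntax)
open import Data.Sum using (_⊎_)
open import Relation.Nullary using (¬_; ¬?)
open import Relation.Binary.PropositionalEquality using (_≡_; _≢_)
open import Function.Bundles using (_⇔_)

Z3 : Set
Z3 = Fin 3

_+₃_ : Z3 → Z3 → Z3
a +₃ b = (toℕ a + toℕ b) mod 3

sum₃ : List Z3 → Z3
sum₃ = foldr _+₃_ Fin.zero

record Multigraph : Set where
  field
    nV   : ℕ
    nE   : ℕ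
    ends : Fin nE → Fin nV × Fin nV

  Vtx : Set
  Vtx = Fin nV

  Edge : Set
  Edge = Fin nE

  src : Edge → Vtx
  src e = proj₁ (ends e)

  tgt : Edge → Vtx
  tgt e = proj₂ (ends e)

  Incident : Edge → Vtx → Set
  Incident e v = (src e ≡ v) ⊎ (tgt e ≡ v)

  countEnd : (Edge → Vtx) → Vtx → ℕ
  countEnd f v = length (filter (λ e → f e ≟ v) (allFin nE))

  deg : Vtx → ℕ
  deg v = countEnd src v + countEnd tgt v

  -- Orientations: true means the edge is directed src → tgt
  Orientation : Set
  Orientation = Edge → Bool

  tail : Orientation → Edge → Vtx
  tail o e = if o e then src e else tgt e

  head : Orientation → Edge → Vtx
  head o e = if o e then tgt e else src e

  outdeg : Orientation → Vtx → ℕ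
  outdeg o = countEnd (tail o)

  indeg : Orientation → Vtx → ℕ
  indeg o = countEnd (head o)

  FlowAt : (Vtx → Z3) → Orientation → Vtx → Set
  FlowAt β o v = ((+ outdeg o v) - (+ indeg o v)) %ℕ 3 ≡ toℕ (β v)

  IsNZFlow : (Vtx → Z3) → Orientation → Set
  IsNZFlow β o = ∀ v → FlowAt β o v

  data Connected : Vtx → Vtx → Set where
    here : ∀ {v} → Connected v v
    step : ∀ {u w} (e : Edge) → ((src e ≡ u) × (tgt e ≡ w)) ⊎ ((tgt e ≡ u) × (src e ≡ w))
         → ∀ {v} → Connected w v → Connected u v

  sumOver : (Vtx → Bool) → (Vtx → Z3) → Z3
  sumOver C β = sum₃ (map β (filter (λ v → C v Data.Bool.≟ true) (allFin nV)))

open Multigraph public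

Loopless : Multigraph → Set
Loopless G = ∀ e → src G e ≢ tgt G e

IsZ3Boundary : (G : Multigraph) → (Vtx G → Z3) → Set
IsZ3Boundary G β =
  ∀ (v : Vtx G) (C : Vtx G → Bool)
  → (∀ w → (C w ≡ true) ⇔ Connected G v w)
  → sumOver G C β ≡ Fin.zero

tauAbs : (G : Multigraph) → (Vtx G → Z3) → Vtx G → ℕ
tauAbs G β v = go (deg G v % 2) (β v)
  where
  go : ℕ → Z3 → ℕ
  go zero    Fin.zero    = 0
  go zero    (Fin.suc _) = 2
  go (suc _) Fin.zero    = 3
  go (suc _) (Fin.suc _) = 1

-- A tip preflow at z is recorded as ψ : Edge → Bool; only its values on
-- edges incident with z are meaningful (outdeg/indeg at z only see those).
IsTipPreflow : (G : Multigraph) → (Vtx G → Z3) → Vtx G → Orientation G → Set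
IsTipPreflow G β z ψ = FlowAt G β ψ z

Extends : (G : Multigraph) → (Vtx G → Z3) → Vtx G → Orientation G → Set
Extends G β z ψ =
  ∃[ o ] ((∀ e → Incident G e z → o e ≡ ψ e) × IsNZFlow G β o)

IsPartition : (G : Multigraph) {k : ℕ} → (Vtx G → Fin k) → Set
IsPartition G {k} p = ∀ (i : Fin k) → ∃[ v ] (p v ≡ i)

NonTrivial : (G : Multigraph) {k : ℕ} → (Vtx G → Fin k) → Set
NonTrivial G p = ∃[ u ] ∃[ v ] (u ≢ v × p u ≡ p v)

TipRespecting : (G : Multigraph) {k : ℕ} → (Vtx G → Fin k) → Vtx G → Set
TipRespecting G p z = ∀ v → p v ≡ p z → v ≡ z

module _ (G : Multigraph) {k : ℕ} (p : Vtx G → Fin k) where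

  keptEdges : List (Edge G)
  keptEdges = filter (λ e → ¬? (p (src G e) ≟ p (tgt G e))) (allFin (nE G))

  contract : Multigraph
  contract = record
    { nV   = k
    ; nE   = length keptEdges
    ; ends = λ j → p (src G (lookup keptEdges j)) , p (tgt G (lookup keptEdges j))
    }

  origEdge : Edge contract → Edge G
  origEdge j = lookup keptEdges j

  contractβ : (Vtx G → Z3) → Fin k → Z3
  contractβ β i = sum₃ (map β (filter (λ v → p v ≟ i) (allFin (nV G))))

  contractψ : Orientation G → Orientation contract
  contractψ ψ j = ψ (origEdge j)

IsCritical : (G : Multigraph) → (Vtx G → Z3) → Vtx G → Orientation G → Set
IsCritical G β z ψ =
  ¬ Extends G β z ψ ×
  (∀ (k : ℕ) (p : Vtx G → Fin k)
   → IsPartition G p → NonTrivial G p → TipRespecting G p z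
   → Extends (contract G p) (contractβ G p β) (p z) (contractψ G p ψ))

IsTame : (G : Multigraph) → (Vtx G → Z3) → (z x : Vtx G) → Set
IsTame G β z x = ∀ v → v ≢ x → v ≢ z → 4 + tauAbs G β v ≤ deg G v

IsTall : (G : Multigraph) → (z x : Vtx G) → Orientation G → Set
IsTall G z x ψ =
  deg G z ≤ deg G x + 2 ×
  (deg G z ≡ deg G x + 2 →
     (∃[ e ] (Incident G e z × ¬ Incident G e x × head G ψ e ≡ z)) ×
     (∃[ e ] (Incident G e z × ¬ Incident G e x × tail G ψ e ≡ z)))

{-# OPTIONS --safe #-}
module Submission where

-- Only the edges not at the tip z are kept as edges. A tip edge becomes a pair of its other end and its
-- direction under ψ, and all vertices outside a set W, at first W = V ∖ {x, z}, together act as the root x.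
-- Tameness and tallness are asked of every nonempty S ⊆ W as if S, or its complement, were a single vertex;
-- then a flow exists, by induction on the number of edges, tip edges counting half. Suppose there is none.
-- Contracting S, orienting the rest, and extending into S with a suitable vertex of S as the new root shows
-- that sets S of at least two vertices have degree at least 6 + |τ(S)|. Contracting the complement of S into
-- the root shows that no S other than W has more tip edges than cut edges. So an edge can be deleted with a
-- fixed direction unless its ends forbid it, and a vertex of degree 4 with β = 0 can be split off by lifting
-- pairs of its edges. If the tip edges do not outnumber the edges from W to the root, then such an edge can
-- be deleted; otherwise W is connected, and all tip edges have the same direction. Modulo 3 one tip edge
-- then acts like two tip edges of the opposite direction, and after this exchange an edge can be deleted.
-- For a critical easel, the conditions on all S follow from those on single vertices and on W by the same
-- two contractions, whose flows criticality provides.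

import Defs
open import Defs using
  ( Z3; _+₃_; Multigraph; Vtx; Orientation; nV; nE; src; tgt; tail; head; outdeg; indeg; FlowAt; IsNZFlow
  ; Incident; Connected; sumOver; Loopless; IsZ3Boundary; tauAbs; IsTipPreflow; contract; contractβ
  ; keptEdges; IsCritical; IsTame; IsTall )
import Data.Bool as 𝔹
open import Data.Bool using (Bool; true; false; not; _∧_; _∨_; _xor_; if_then_else_)
open import Data.Bool.Properties using (not-involutive)
open import Data.Empty using (⊥; ⊥-elim)
open import Data.Fin using (Fin; zero; suc; toℕ; fromℕ<; _≟_)
import Data.Fin.Properties
open import Data.Fin.Properties using (all?; any?; toℕ-fromℕ<; toℕ-injective)
import Data.Integer as ℤ
open import Data.Integer using (ℤ)
import Data.Integer.Properties as ℤₚ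
open import Data.Integer.DivMod using (_%ℕ_)
open import Data.List using (List; []; _∷_; _++_; map; length; filter; filterᵇ; lookup; allFin)
open import Data.List.Properties using (length-map; map-tabulate; tabulate-lookup; map-cong-local)
import Data.List.Membership.Propositional as L
open import Data.List.Membership.Propositional.Properties using (∈-allFin; ∈-lookup; ∈-map⁺; ∈-filter⁺)
import Data.List.Relation.Binary.Permutation.Propositional as ↭
open ↭ using (_↭_)
open import Data.List.Relation.Binary.Permutation.Propositional.Properties using (All-resp-↭; ↭-length; ++-comm)
open import Data.List.Relation.Unary.All as All using (All; []; _∷_)
open import Data.List.Relation.Unary.Any as Any using (Any)
open import Data.List.Relation.Unary.Any.Properties using (lookup-index)
open import Data.List.Relation.Unary.Unique.Propositional using (Unique; []; _∷_)
open import Data.List.Relation.Unary.Unique.Propositional.Properties using (allFin⁺; filter⁺)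
import Data.Nat as ℕ
open import Data.Nat hiding (_≟_)
open import Data.Nat.DivMod using (_%_)
open import Data.Nat.Properties hiding (_≟_)
open import Data.Product using (_×_; _,_; proj₁; proj₂; Σ-syntax; ∃; ∃-syntax)
open import Data.Sum using (_⊎_; inj₁; inj₂)
open import Data.Unit using (⊤; tt)
open import Function using (_∘_)
open import Function.Bundles using (mk⇔)
open import Relation.Nullary using (¬_; ¬?; yes; no; Dec; does)
open import Relation.Nullary.Decidable using (from-yes; dec-true; _→-dec_; _×-dec_; _⊎-dec_)
open import Relation.Binary.PropositionalEquality

-- A smaller easel obtained by deletion or lifting need not be critical, so what criticality says
-- about vertex sets would be lost after one step of an induction. The conditions on sets are
-- therefore part of the induction hypothesis, and its conclusion is the existence of a flow. That
-- conclusion is doubly negated, so that every step may assume that there is no flow; this suffices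
-- for a negative theorem. The degree of a set has the parity of τ, hence from 4 + τ the next
-- possible degree is 6 + τ. This slack of two is what makes larger sets harmless: the deletion of
-- an edge costs one in the degree and at most one in τ. Only single vertices can forbid a deletion,
-- and one that forbids both directions has degree 4 and boundary 0, which is why exactly these
-- vertices have to be split off. Tip edges weigh half because cutting out a set turns edges into
-- tip edges, and because the last exchange pays for the deletion of an edge with one additional tip
-- edge.

+-interchange : ∀ a b c d → (a + b) + (c + d) ≡ (a + c) + (b + d)
+-interchange a b c d = begin
  (a + b) + (c + d) ≡⟨ +-assoc a b (c + d) ⟩
  a + (b + (c + d)) ≡⟨ cong (a +_) (sym (+-assoc b c d)) ⟩
  a + ((b + c) + d) ≡⟨ cong (λ t → a + (t + d)) (+-comm b c) ⟩
  a + ((c + b) + d) ≡⟨ cong (a +_) (+-assoc c b d) ⟩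
  a + (c + (b + d)) ≡⟨ sym (+-assoc a c (b + d)) ⟩
  (a + c) + (b + d) ∎
  where open ≡-Reasoning

-- Linear arithmetic over the natural numbers by reflection.

module Lin where

  open import Data.Bool using (T)
  open import Data.List using (concatMap)
  open import Data.Vec using (Vec; []; _∷_; zipWith; replicate)
  import Data.Vec as Vec
  open import Data.Vec.N-ary using (N-ary; _$ⁿ_)
  open import Data.Unit using (⊤; tt)

  infixl 6 _⊕_
  infix 4 _≼_ _≈_
  infix 2 _⊢_

  data Expr (n : ℕ) : Set where
    var : Fin n → Expr n
    #_  : ℕ → Expr n
    _⊕_ : Expr n → Expr n → Expr n

  data Fact (n : ℕ) : Set where
    _≼_ _≈_ : Expr n → Expr n → Fact n
    absurd : Fact n

  record Problem (n : ℕ) : Set where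
    constructor _⊢_
    field
      hyps : List (Fact n)
      goal : Fact n

  ⟦_⟧ : ∀ {n} → Expr n → Vec ℕ n → ℕ
  ⟦ var i ⟧ ρ = Vec.lookup ρ i
  ⟦ # k ⟧ ρ = k
  ⟦ a ⊕ b ⟧ ρ = ⟦ a ⟧ ρ + ⟦ b ⟧ ρ

  ⟪_⟫ : ∀ {n} → Fact n → Vec ℕ n → Set
  ⟪ a ≼ b ⟫ ρ = ⟦ a ⟧ ρ ≤ ⟦ b ⟧ ρ
  ⟪ a ≈ b ⟫ ρ = ⟦ a ⟧ ρ ≡ ⟦ b ⟧ ρ
  ⟪ absurd ⟫ ρ = ⊥

  Claim : ∀ {n} → Problem n → Vec ℕ n → Set
  Claim ([] ⊢ g) ρ = ⟪ g ⟫ ρ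
  Claim ((h ∷ hs) ⊢ g) ρ = ⟪ h ⟫ ρ → Claim (hs ⊢ g) ρ

  -- The constant term and the coefficients.
  Form : ℕ → Set
  Form n = ℕ × Vec ℕ n

  dot : ∀ {n} → Vec ℕ n → Vec ℕ n → ℕ
  dot [] [] = 0
  dot (c ∷ cs) (x ∷ xs) = c * x + dot cs xs

  value : ∀ {n} → Form n → Vec ℕ n → ℕ
  value (k , cs) ρ = k + dot cs ρ

  unit : ∀ {n} → Fin n → Vec ℕ n
  unit zero = 1 ∷ replicate _ 0
  unit (suc i) = 0 ∷ unit i

  addF : ∀ {n} → Form n → Form n → Form n
  addF (k , cs) (l , ds) = k + l , zipWith _+_ cs ds

  zeroF : ∀ {n} → Form n
  zeroF = 0 , replicate _ 0

  mulF : ∀ {n} → ℕ → Form n → Form n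
  mulF zero f = zeroF
  mulF (suc m) f = addF f (mulF m f)

  form : ∀ {n} → Expr n → Form n
  form (var i) = 0 , unit i
  form (# k) = k , replicate _ 0
  form (a ⊕ b) = addF (form a) (form b)

  dot-zero : ∀ {n} (ρ : Vec ℕ n) → dot (replicate _ 0) ρ ≡ 0
  dot-zero [] = refl
  dot-zero (x ∷ ρ) = dot-zero ρ

  dot-unit : ∀ {n} (i : Fin n) (ρ : Vec ℕ n) → dot (unit i) ρ ≡ Vec.lookup ρ i
  dot-unit zero (x ∷ ρ) = trans (cong₂ _+_ (+-identityʳ x) (dot-zero ρ)) (+-identityʳ x)
  dot-unit (suc i) (x ∷ ρ) = dot-unit i ρ

  dot-add : ∀ {n} (cs ds ρ : Vec ℕ n) → dot (zipWith _+_ cs ds) ρ ≡ dot cs ρ + dot ds ρ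
  dot-add [] [] [] = refl
  dot-add (c ∷ cs) (d ∷ ds) (x ∷ ρ) =
    trans (cong₂ _+_ (*-distribʳ-+ x c d) (dot-add cs ds ρ)) (+-interchange (c * x) (d * x) _ _)

  value-add : ∀ {n} (f g : Form n) ρ → value (addF f g) ρ ≡ value f ρ + value g ρ
  value-add (k , cs) (l , ds) ρ = trans (cong (k + l +_) (dot-add cs ds ρ)) (+-interchange k l _ _)

  form-value : ∀ {n} (e : Expr n) ρ → value (form e) ρ ≡ ⟦ e ⟧ ρ
  form-value (var i) ρ = dot-unit i ρ
  form-value (# k) ρ = trans (cong (k +_) (dot-zero ρ)) (+-identityʳ k)
  form-value (a ⊕ b) ρ = trans (value-add (form a) (form b) ρ) (cong₂ _+_ (form-value a ρ) (form-value b ρ))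

  Ineq : ℕ → Set
  Ineq n = Form n × Form n

  Holds : ∀ {n} → Ineq n → Vec ℕ n → Set
  Holds (l , r) ρ = value l ρ ≤ value r ρ

  AllHold : ∀ {n} → List (Ineq n) → Vec ℕ n → Set
  AllHold [] ρ = ⊤
  AllHold (i ∷ is) ρ = Holds i ρ × AllHold is ρ

  mul-mono : ∀ {n} m (i : Ineq n) ρ → Holds i ρ → Holds (mulF m (proj₁ i) , mulF m (proj₂ i)) ρ
  mul-mono zero i ρ h = ≤-refl
  mul-mono (suc m) (l , r) ρ h =
    subst₂ _≤_ (sym (value-add l (mulF m l) ρ)) (sym (value-add r (mulF m r) ρ)) (+-mono-≤ h (mul-mono m (l , r) ρ h))

  combine : ∀ {n} → List ℕ → List (Ineq n) → Ineq n
  combine (m ∷ ms) ((l , r) ∷ is) =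
    addF (mulF m l) (proj₁ (combine ms is)) , addF (mulF m r) (proj₂ (combine ms is))
  combine _ _ = zeroF , zeroF

  combine-holds : ∀ {n} ms (is : List (Ineq n)) ρ → AllHold is ρ → Holds (combine ms is) ρ
  combine-holds [] [] ρ _ = ≤-refl
  combine-holds [] (i ∷ is) ρ _ = ≤-refl
  combine-holds (m ∷ ms) [] ρ _ = ≤-refl
  combine-holds (m ∷ ms) ((l , r) ∷ is) ρ (h , hs) =
    subst₂ _≤_ (sym (value-add (mulF m l) _ ρ)) (sym (value-add (mulF m r) _ ρ))
      (+-mono-≤ (mul-mono m (l , r) ρ h) (combine-holds ms is ρ hs))

  coeffs≤ : ∀ {n} → Vec ℕ n → Vec ℕ n → Bool
  coeffs≤ [] [] = true
  coeffs≤ (c ∷ cs) (d ∷ ds) = (c ≤ᵇ d) ∧ coeffs≤ cs ds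

  T-∧ : ∀ {a b} → T (a ∧ b) → T a × T b
  T-∧ {true} {true} _ = tt , tt

  coeffs≤-sound : ∀ {n} (cs ds ρ : Vec ℕ n) → T (coeffs≤ cs ds) → dot cs ρ ≤ dot ds ρ
  coeffs≤-sound [] [] [] _ = z≤n
  coeffs≤-sound (c ∷ cs) (d ∷ ds) (x ∷ ρ) t with T-∧ {c ≤ᵇ d} t
  ... | t₁ , t₂ = +-mono-≤ (*-monoˡ-≤ x (≤ᵇ⇒≤ c d t₁)) (coeffs≤-sound cs ds ρ t₂)

  -- Variables are nonnegative, so a larger constant and no smaller coefficients on the left are
  -- absurd. A certificate in the style of Farkas only has to end in such an inequality.
  refutes : ∀ {n} → Ineq n → Bool
  refutes ((k , cs) , (l , ds)) = (l <ᵇ k) ∧ coeffs≤ ds cs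

  refutes-sound : ∀ {n} (i : Ineq n) ρ → T (refutes i) → Holds i ρ → ⊥
  refutes-sound ((k , cs) , (l , ds)) ρ t h with T-∧ {l <ᵇ k} t
  ... | t₁ , t₂ = <⇒≱ (+-mono-<-≤ (<ᵇ⇒< l k t₁) (coeffs≤-sound ds cs ρ t₂)) h

  -- Search for the multipliers by Fourier-Motzkin elimination; nothing about it needs to be proved.
  Row : ℕ → Set
  Row n = ℤ × Vec ℤ n × List ℕ

  row : ∀ {n} → List ℕ → Ineq n → Row n
  row ms ((k , cs) , (l , ds)) = l ℤ.⊖ k , zipWith ℤ._⊖_ ds cs , ms

  addMs : List ℕ → List ℕ → List ℕ
  addMs [] ys = ys
  addMs xs [] = xs
  addMs (x ∷ xs) (y ∷ ys) = x + y ∷ addMs xs ys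

  scaleRow : ∀ {n} → ℕ → Row n → Row n
  scaleRow m (k , cs , ms) = ℤ.+ m ℤ.* k , Vec.map (ℤ._*_ (ℤ.+ m)) cs , map (m *_) ms

  addRow : ∀ {n} → Row n → Row n → Row n
  addRow (k , cs , ms) (l , ds , ns) = k ℤ.+ l , zipWith ℤ._+_ cs ds , addMs ms ns

  tailRow : ∀ {n} → Row (suc n) → Row n
  tailRow (k , _ ∷ cs , ms) = k , cs , ms

  positives negatives : ∀ {n} → List (Row (suc n)) → List (ℕ × Row n)
  positives [] = []
  positives (r@(k , ℤ.+ suc c ∷ _ , _) ∷ rs) = (suc c , tailRow r) ∷ positives rs
  positives (_ ∷ rs) = positives rs
  negatives [] = []
  negatives (r@(k , ℤ.-[1+ c ] ∷ _ , _) ∷ rs) = (suc c , tailRow r) ∷ negatives rs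
  negatives (_ ∷ rs) = negatives rs

  zeros : ∀ {n} → List (Row (suc n)) → List (Row n)
  zeros [] = []
  zeros (r@(k , ℤ.+ suc c ∷ _ , _) ∷ rs) = zeros rs
  zeros (r ∷ rs) = tailRow r ∷ zeros rs

  -- Variables are nonnegative, so a variable with negative coefficient may also simply be dropped.
  eliminate : ∀ {n} → List (Row (suc n)) → List (Row n)
  eliminate rs = zeros rs ++ map proj₂ (negatives rs) ++
    concatMap (λ p → map (λ q → addRow (scaleRow (proj₁ q) (proj₂ p)) (scaleRow (proj₁ p) (proj₂ q))) (negatives rs))
      (positives rs)

  refuting : List (Row 0) → List ℕ
  refuting [] = []
  refuting ((ℤ.-[1+ _ ] , [] , ms) ∷ rs) = ms
  refuting (_ ∷ rs) = refuting rs

  multipliers : ∀ {n} → List (Row n) → List ℕ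
  multipliers {zero} rs = refuting rs
  multipliers {suc n} rs = multipliers (eliminate rs)

  units : ∀ {n} → List ℕ → List (Ineq n) → List (Row n)
  units pre [] = []
  units pre (i ∷ is) = row (pre ++ 1 ∷ []) i ∷ units (0 ∷ pre) is

  contradictory : ∀ {n} → List (Ineq n) → Bool
  contradictory is = refutes (combine (multipliers (units [] is)) is)

  contradictory-sound : ∀ {n} (is : List (Ineq n)) ρ → T (contradictory is) → AllHold is ρ → ⊥
  contradictory-sound is ρ t hs = refutes-sound (combine ms is) ρ t (combine-holds ms is ρ hs)
    where ms = multipliers (units [] is)

  facts : ∀ {n} → Fact n → List (Ineq n) → List (Ineq n)
  facts (a ≼ b) is = (form a , form b) ∷ is
  facts (a ≈ b) is = (form a , form b) ∷ (form b , form a) ∷ is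
  facts absurd is = (form (# 1) , form (# 0)) ∷ is

  refutable : ∀ {n} → Fact n → List (Ineq n) → Bool
  refutable (a ≼ b) is = contradictory ((form (# 1 ⊕ b) , form a) ∷ is)
  refutable (a ≈ b) is = refutable (a ≼ b) is ∧ refutable (b ≼ a) is
  refutable absurd is = contradictory is

  valid : ∀ {n} → Problem n → List (Ineq n) → Bool
  valid ([] ⊢ g) is = refutable g is
  valid ((h ∷ hs) ⊢ g) is = valid (hs ⊢ g) (facts h is)

  facts-hold : ∀ {n} (h : Fact n) is ρ → ⟪ h ⟫ ρ → AllHold is ρ → AllHold (facts h is) ρ
  facts-hold (a ≼ b) is ρ p hs = subst₂ _≤_ (sym (form-value a ρ)) (sym (form-value b ρ)) p , hs
  facts-hold (a ≈ b) is ρ p hs =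
    ≤-reflexive e , ≤-reflexive (sym e) , hs
    where e = trans (form-value a ρ) (trans p (sym (form-value b ρ)))

  refutable-sound : ∀ {n} (g : Fact n) is ρ → T (refutable g is) → AllHold is ρ → ⟪ g ⟫ ρ
  refutable-sound (a ≼ b) is ρ t hs with ⟦ a ⟧ ρ ≤? ⟦ b ⟧ ρ
  ... | yes p = p
  ... | no ¬p = ⊥-elim (contradictory-sound ((form (# 1 ⊕ b) , form a) ∷ is) ρ t
          (subst₂ _≤_ (sym (form-value (# 1 ⊕ b) ρ)) (sym (form-value a ρ)) (≰⇒> ¬p) , hs))
  refutable-sound (a ≈ b) is ρ t hs with T-∧ {refutable (a ≼ b) is} t
  ... | t₁ , t₂ = ≤-antisym (refutable-sound (a ≼ b) is ρ t₁ hs) (refutable-sound (b ≼ a) is ρ t₂ hs)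
  refutable-sound absurd is ρ t hs = contradictory-sound is ρ t hs

  valid-sound : ∀ {n} (p : Problem n) is ρ → T (valid p is) → AllHold is ρ → Claim p ρ
  valid-sound ([] ⊢ g) is ρ t hs = refutable-sound g is ρ t hs
  valid-sound ((h ∷ hs) ⊢ g) is ρ t as p = valid-sound (hs ⊢ g) (facts h is) ρ t (facts-hold h is ρ p as)

  Lin : ∀ n → N-ary n (Expr n) (Problem n) → Problem n
  Lin n f = f $ⁿ Vec.tabulate var

  Quantified : ∀ n → (Vec ℕ n → Set) → Set
  Quantified zero P = P []
  Quantified (suc n) P = ∀ x → Quantified n (λ xs → P (x ∷ xs))

  quantify : ∀ n (P : Vec ℕ n → Set) → (∀ ρ → P ρ) → Quantified n P
  quantify zero P h = h []
  quantify (suc n) P h x = quantify n (λ xs → P (x ∷ xs)) (λ xs → h (x ∷ xs))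

  -- The implicit argument is settled by evaluation, so the search for multipliers runs during type
  -- checking; a problem that the search cannot settle leaves it unsolved.
  lin : ∀ n (f : N-ary n (Expr n) (Problem n)) {_ : T (valid (Lin n f) [])} → Quantified n (Claim (Lin n f))
  lin n f {t} = quantify n (Claim (Lin n f)) (λ ρ → valid-sound (Lin n f) [] ρ t tt)

open Lin using (lin; _⊢_; _≼_; _≈_; absurd; _⊕_; #_)

-- Arithmetic modulo 3 and the function τ.

pattern 0₃ = zero
pattern 1₃ = suc zero
pattern 2₃ = suc (suc zero)

+₃-comm : ∀ a b → a +₃ b ≡ b +₃ a
+₃-comm = from-yes (all? λ a → all? λ b → (a +₃ b) ≟ (b +₃ a))

+₃-assoc : ∀ a b c → (a +₃ b) +₃ c ≡ a +₃ (b +₃ c)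
+₃-assoc = from-yes (all? λ a → all? λ b → all? λ c → ((a +₃ b) +₃ c) ≟ (a +₃ (b +₃ c)))

+₃-identityʳ : ∀ a → a +₃ 0₃ ≡ a
+₃-identityʳ = from-yes (all? λ a → (a +₃ 0₃) ≟ a)

+₃-identityˡ : ∀ a → 0₃ +₃ a ≡ a
+₃-identityˡ = from-yes (all? λ a → (0₃ +₃ a) ≟ a)

+₃-interchange : ∀ a b c d → (a +₃ b) +₃ (c +₃ d) ≡ (a +₃ c) +₃ (b +₃ d)
+₃-interchange = from-yes (all? λ a → all? λ b → all? λ c → all? λ d →
  ((a +₃ b) +₃ (c +₃ d)) ≟ ((a +₃ c) +₃ (b +₃ d)))

+₃-swap : ∀ a b c → a +₃ (b +₃ c) ≡ b +₃ (a +₃ c)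
+₃-swap = from-yes (all? λ a → all? λ b → all? λ c → (a +₃ (b +₃ c)) ≟ (b +₃ (a +₃ c)))

-- What an edge directed by z contributes to the outflow of its other end: the sign true means that
-- the edge is directed towards that end.
q : Bool → Z3
q true = 2₃
q false = 1₃

∀Bool? : {P : Bool → Set} → (∀ b → Dec (P b)) → Dec (∀ b → P b)
∀Bool? d with d true | d false
... | yes p | yes p' = yes λ { true → p ; false → p' }
... | no ¬p | _ = no λ f → ¬p (f true)
... | _ | no ¬p = no λ f → ¬p (f false)

witness : {A : Set} (a? : Dec A) → does a? ≡ true → A
witness (yes a) _ = a

both : {Q : Bool → Set} → ∀ s → Q s → Q (not s) → ∀ s′ → Q s′
both true p p′ true = p
both true p p′ false = p′
both false p p′ true = p′
both false p p′ false = p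

-- A parity and an element of Z3 together name a residue modulo 6, and this is its distance from 0
-- on the cycle of residues. One more edge moves the residue to a neighbour, and a change of the
-- boundary alone moves it by two; the bounds below are this geometry, checked by tables.
τ' : Bool → Z3 → ℕ
τ' false zero = 0
τ' false (suc _) = 2
τ' true zero = 3
τ' true (suc _) = 1

odd : ℕ → Bool
odd zero = false
odd (suc n) = not (odd n)

τ : ℕ → Z3 → ℕ
τ d b = τ' (odd d) b

odd-suc² : ∀ d → odd (suc (suc d)) ≡ odd d
odd-suc² d = not-involutive (odd d)

τ-suc² : ∀ d b → τ (suc (suc d)) b ≡ τ d b
τ-suc² d b = cong (λ o → τ' o b) (odd-suc² d)

τ≤3 : ∀ d b → τ d b ≤ 3
τ≤3 d = lemma (odd d)
  where
  lemma : ∀ o b → τ' o b ≤ 3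
  lemma = from-yes (∀Bool? λ o → all? λ b → τ' o b ≤? 3)

τ≤2+τ : ∀ d b b' → τ d b' ≤ 2 + τ d b
τ≤2+τ d = lemma (odd d)
  where
  lemma : ∀ o b b' → τ' o b' ≤ 2 + τ' o b
  lemma = from-yes (∀Bool? λ o → all? λ b → all? λ b' → τ' o b' ≤? 2 + τ' o b)

τ≤1+τ : ∀ d b s → τ d b ≤ suc (τ (suc d) (q s +₃ b))
τ≤1+τ d = lemma (odd d)
  where
  lemma : ∀ o b s → τ' o b ≤ suc (τ' (not o) (q s +₃ b))
  lemma = from-yes (∀Bool? λ o → all? λ b → ∀Bool? λ s → τ' o b ≤? suc (τ' (not o) (q s +₃ b)))

odd-double : ∀ e → odd (e + e) ≡ false
odd-double zero = refl
odd-double (suc e) rewrite +-suc e e = trans (odd-suc² (e + e)) (odd-double e)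

odd-+ : ∀ m n → odd (m + n) ≡ odd m xor odd n
odd-+ zero n = refl
odd-+ (suc m) n rewrite odd-+ m n with odd m | odd n
... | true | true = refl
... | true | false = refl
... | false | true = refl
... | false | false = refl

-- The distance from 0 modulo 6 is subadditive. The `e` edges between the two parts count in both
-- degrees, which leaves the parity of the sum as it was.
τ-subadditive : ∀ d d₁ d₂ e b₁ b₂ → d₁ + d₂ ≡ d + (e + e) → τ d (b₁ +₃ b₂) ≤ τ d₁ b₁ + τ d₂ b₂
τ-subadditive d d₁ d₂ e b₁ b₂ eq = subst (λ o → τ' o (b₁ +₃ b₂) ≤ τ d₁ b₁ + τ d₂ b₂) same-parity (lemma (odd d₁) (odd d₂) b₁ b₂)
  where
  lemma : ∀ o₁ o₂ b₁ b₂ → τ' (o₁ xor o₂) (b₁ +₃ b₂) ≤ τ' o₁ b₁ + τ' o₂ b₂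
  lemma = from-yes (∀Bool? λ o₁ → ∀Bool? λ o₂ → all? λ b₁ → all? λ b₂ →
    τ' (o₁ xor o₂) (b₁ +₃ b₂) ≤? τ' o₁ b₁ + τ' o₂ b₂)
  xor-false : ∀ o → o xor false ≡ o
  xor-false true = refl
  xor-false false = refl
  same-parity : odd d₁ xor odd d₂ ≡ odd d
  same-parity = trans (sym (odd-+ d₁ d₂)) (trans (cong odd eq)
    (trans (odd-+ d (e + e)) (trans (cong (odd d xor_) (odd-double e)) (xor-false (odd d)))))

private
  odd-τ' : ∀ o b → odd (τ' o b) ≡ o
  odd-τ' true zero = refl
  odd-τ' true (suc _) = refl
  odd-τ' false zero = refl
  odd-τ' false (suc _) = refl

τ-parity : ∀ d b → d ≢ 5 + τ d b
τ-parity d b eq = absurd′ (odd d) (trans (cong odd eq) (trans (odd-+ 5 (τ d b)) (cong not (odd-τ' (odd d) b))))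
  where
  absurd′ : ∀ o → o ≢ not o
  absurd′ true ()
  absurd′ false ()

-- deg ≡ τ (mod 2), so the values strictly between 4 + τ and 6 + τ are not attained.
τ-gap : ∀ d b → 4 + τ d b ≤ d → d < 6 + τ d b → d ≡ 4 + τ d b
τ-gap d b lo hi with d ℕ.≟ 5 + τ d b
... | yes eq = ⊥-elim (τ-parity d b eq)
... | no ≢ = ≤-antisym (≤-pred (≤∧≢⇒< (≤-pred hi) ≢)) lo

τ-gap≤ : ∀ d b → d < 6 + τ d b → d ≤ 4 + τ d b
τ-gap≤ d b hi with d ℕ.≟ 5 + τ d b
... | yes eq = ⊥-elim (τ-parity d b eq)
... | no ≢ = ≤-pred (≤∧≢⇒< (≤-pred hi) ≢)

-- An end of degree d and boundary b still satisfies the degree condition after the deletion of an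
-- edge which is directed towards it (s = true) or away from it (s = false). As τ has period 2 in the
-- degree, suc d stands for d - 1.
Spare : Bool → ℕ → Z3 → Set
Spare s d b = 5 + τ (suc d) (q (not s) +₃ b) ≤ d

spare? : ∀ s d b → Dec (Spare s d b)
spare? s d b = 5 + τ (suc d) (q (not s) +₃ b) ≤? d

q-cancel : ∀ s b → q (not s) +₃ (q s +₃ b) ≡ b
q-cancel = from-yes (∀Bool? λ s → all? λ b → (q (not s) +₃ (q s +₃ b)) ≟ b)

q-cancel′ : ∀ s b → q s +₃ (q (not s) +₃ b) ≡ b
q-cancel′ = from-yes (∀Bool? λ s → all? λ b → (q s +₃ (q (not s) +₃ b)) ≟ b)

spare-deletion : ∀ s d b → Spare s (suc d) (q s +₃ b) → 4 + τ d b ≤ d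
spare-deletion s d b h = ≤-pred (subst (λ t → 5 + t ≤ suc d) (trans (τ-suc² d _) (cong (τ d) (q-cancel s b))) h)

roomy-deletion : ∀ s d b → 6 + τ (suc d) (q s +₃ b) ≤ suc d → 4 + τ d b ≤ d
roomy-deletion s d b h = lin 3 (λ d t t' → (t ≼ # 1 ⊕ t') ∷ (# 6 ⊕ t' ≼ # 1 ⊕ d) ∷ [] ⊢ # 4 ⊕ t ≼ d) d (τ d b) (τ (suc d) (q s +₃ b)) (τ≤1+τ d b s) h

-- Both neighbours of the residue modulo 6 lie farther from 0 only if the residue is 0. Then τ
-- vanishes, and parity leaves 4 as the only degree too small to spare an edge.
tight-end : ∀ d b → 4 + τ d b ≤ d → ¬ Spare true d b → ¬ Spare false d b → d ≡ 4 × b ≡ 0₃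
tight-end d b tame ¬in ¬out = d≡4 , b≡0
  where
  lemma : ∀ o b → τ' o b ≤ τ' (not o) (q false +₃ b) → τ' o b ≤ τ' (not o) (q true +₃ b) → τ' o b ≡ 0 × b ≡ 0₃
  lemma = from-yes (∀Bool? λ o → all? λ b → (τ' o b ≤? τ' (not o) (q false +₃ b)) →-dec
    ((τ' o b ≤? τ' (not o) (q true +₃ b)) →-dec ((τ' o b ℕ.≟ 0) ×-dec (b ≟ 0₃))))
  above : ∀ s → ¬ Spare s d b → τ d b ≤ τ (suc d) (q (not s) +₃ b)
  above s ¬sp = ≤-pred (≤-pred (≤-pred (≤-pred (≤-pred (≤-trans (s≤s tame) (≰⇒> ¬sp))))))
  vals = lemma (odd d) b (above true ¬in) (above false ¬out)
  b≡0 = proj₂ vals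
  small : d < 6 + τ d b
  small = lin 3 (λ d t t' → (d ≼ # 4 ⊕ t') ∷ (t' ≼ # 1 ⊕ t) ∷ [] ⊢ # 1 ⊕ d ≼ # 6 ⊕ t) d (τ d b) (τ (suc d) (q false +₃ b))
    (≤-pred (≰⇒> ¬in)) (subst (λ c → τ (suc d) (q false +₃ b) ≤ suc c) (trans (τ-suc² d _) (cong (τ d) (q-cancel′ true b))) (τ≤1+τ (suc d) _ true))
  d≡4 : d ≡ 4
  d≡4 = trans (τ-gap d b tame small) (cong (4 +_) (proj₁ vals))

-- If only the deletion of an edge of sign not s is harmless, then so is the reversal of an edge of
-- sign s.
reversal : ∀ s d b → 4 + τ d b ≤ d → ¬ Spare s d b → Spare (not s) d b → 4 + τ d (q (not s) +₃ b) ≤ d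
reversal s d b tame ¬sp sp with 6 + τ d b ≤? d
... | yes roomy = lin 3 (λ d t t' → (t' ≼ # 2 ⊕ t) ∷ (# 6 ⊕ t ≼ d) ∷ [] ⊢ # 4 ⊕ t' ≼ d) d (τ d b) (τ d (q (not s) +₃ b)) (τ≤2+τ d b _) roomy
... | no ¬roomy = subst (4 + τ d (q (not s) +₃ b) ≤_) (sym eq) (+-monoʳ-≤ 4
    (lemma (odd d) b s (≤-pred (≤-pred (≤-pred (≤-pred (subst (λ x → 5 + τ (suc d) (q (not (not s)) +₃ b) ≤ x) eq sp)))))
      (≤-pred (≤-pred (≤-pred (≤-pred (≤-pred (subst (_< 5 + τ (suc d) (q (not s) +₃ b)) eq (≰⇒> ¬sp)))))))))
  where
  eq = τ-gap d b tame (≰⇒> ¬roomy)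
  lemma : ∀ o b s → suc (τ' (not o) (q (not (not s)) +₃ b)) ≤ τ' o b → τ' o b ≤ τ' (not o) (q (not s) +₃ b) → τ' o (q (not s) +₃ b) ≤ τ' o b
  lemma = from-yes (∀Bool? λ o → all? λ b → ∀Bool? λ s → (suc (τ' (not o) (q (not (not s)) +₃ b)) ≤? τ' o b)
    →-dec ((τ' o b ≤? τ' (not o) (q (not s) +₃ b)) →-dec (τ' o (q (not s) +₃ b) ≤? τ' o b)))

-- Sums over lists

sum : {A : Set} → (A → ℕ) → List A → ℕ
sum f [] = 0
sum f (a ∷ l) = f a + sum f l

sum-cong : ∀ {A : Set} {f g : A → ℕ} → (∀ a → f a ≡ g a) → ∀ l → sum f l ≡ sum g l
sum-cong h [] = refl
sum-cong h (a ∷ l) = cong₂ _+_ (h a) (sum-cong h l)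

sum-mono : ∀ {A : Set} {f g : A → ℕ} → (∀ a → f a ≤ g a) → ∀ l → sum f l ≤ sum g l
sum-mono h [] = z≤n
sum-mono h (a ∷ l) = +-mono-≤ (h a) (sum-mono h l)

sum-+ : ∀ {A : Set} (f g : A → ℕ) l → sum (λ a → f a + g a) l ≡ sum f l + sum g l
sum-+ f g [] = refl
sum-+ f g (a ∷ l) = trans (cong (f a + g a +_) (sum-+ f g l)) (+-interchange (f a) (g a) _ _)

sum-++ : ∀ {A : Set} (f : A → ℕ) k l → sum f (k ++ l) ≡ sum f k + sum f l
sum-++ f [] l = refl
sum-++ f (a ∷ k) l = trans (cong (f a +_) (sum-++ f k l)) (sym (+-assoc (f a) _ _))

sum-map : ∀ {A B : Set} (f : B → ℕ) (g : A → B) l → sum f (map g l) ≡ sum (f ∘ g) l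
sum-map f g [] = refl
sum-map f g (a ∷ l) = cong (f (g a) +_) (sum-map f g l)

sum-1 : ∀ {A : Set} (l : List A) → sum (λ _ → 1) l ≡ length l
sum-1 [] = refl
sum-1 (a ∷ l) = cong suc (sum-1 l)

sum-filter : ∀ {A : Set} (f : A → ℕ) p l → (∀ a → p a ≡ false → f a ≡ 0) → sum f (filterᵇ p l) ≡ sum f l
sum-filter f p [] h = refl
sum-filter f p (a ∷ l) h with p a in eq
... | true = cong (f a +_) (sum-filter f p l h)
... | false = trans (sum-filter f p l h) (cong (_+ sum f l) (sym (h a eq)))

sum-partition : ∀ {A : Set} (f : A → ℕ) p l → sum f (filterᵇ p l) + sum f (filterᵇ (not ∘ p) l) ≡ sum f l
sum-partition f p [] = refl
sum-partition f p (a ∷ l) with p a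
... | true = trans (+-assoc (f a) _ _) (cong (f a +_) (sum-partition f p l))
... | false = trans (sym (+-assoc (sum f (filterᵇ p l)) (f a) _))
  (trans (cong (_+ sum f (filterᵇ (not ∘ p) l)) (+-comm (sum f (filterᵇ p l)) (f a)))
    (trans (+-assoc (f a) _ _) (cong (f a +_) (sum-partition f p l))))

sum-filter-mono : ∀ {A : Set} {f g : A → ℕ} p → (∀ a → p a ≡ true → f a ≤ g a) → ∀ l → sum f (filterᵇ p l) ≤ sum g (filterᵇ p l)
sum-filter-mono p h [] = z≤n
sum-filter-mono p h (a ∷ l) with p a in eq
... | true = +-mono-≤ (h a eq) (sum-filter-mono p h l)
... | false = sum-filter-mono p h l

sum-filter-cong : ∀ {A : Set} {f g : A → ℕ} p → (∀ a → p a ≡ true → f a ≡ g a) → ∀ l → sum f (filterᵇ p l) ≡ sum g (filterᵇ p l)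
sum-filter-cong p h l = ≤-antisym (sum-filter-mono p (λ a e → ≤-reflexive (h a e)) l) (sum-filter-mono p (λ a e → ≤-reflexive (sym (h a e))) l)

sum₃ : {A : Set} → (A → Z3) → List A → Z3
sum₃ f [] = 0₃
sum₃ f (a ∷ l) = f a +₃ sum₃ f l

sum₃-cong : ∀ {A : Set} {f g : A → Z3} → (∀ a → f a ≡ g a) → ∀ l → sum₃ f l ≡ sum₃ g l
sum₃-cong h [] = refl
sum₃-cong h (a ∷ l) = cong₂ _+₃_ (h a) (sum₃-cong h l)

sum₃-+ : ∀ {A : Set} (f g : A → Z3) l → sum₃ (λ a → f a +₃ g a) l ≡ sum₃ f l +₃ sum₃ g l
sum₃-+ f g [] = refl
sum₃-+ f g (a ∷ l) = trans (cong ((f a +₃ g a) +₃_) (sum₃-+ f g l)) (+₃-interchange (f a) (g a) _ _)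

sum₃-++ : ∀ {A : Set} (f : A → Z3) k l → sum₃ f (k ++ l) ≡ sum₃ f k +₃ sum₃ f l
sum₃-++ f [] l = sym (+₃-identityˡ _)
sum₃-++ f (a ∷ k) l = trans (cong (f a +₃_) (sum₃-++ f k l)) (sym (+₃-assoc (f a) _ _))

sum₃-map : ∀ {A B : Set} (f : B → Z3) (g : A → B) l → sum₃ f (map g l) ≡ sum₃ (f ∘ g) l
sum₃-map f g [] = refl
sum₃-map f g (a ∷ l) = cong (f (g a) +₃_) (sum₃-map f g l)

sum₃-0 : ∀ {A : Set} {f : A → Z3} → (∀ a → f a ≡ 0₃) → ∀ l → sum₃ f l ≡ 0₃
sum₃-0 h [] = refl
sum₃-0 h (a ∷ l) = cong₂ _+₃_ (h a) (sum₃-0 h l)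

sum₃-filter : ∀ {A : Set} (f : A → Z3) p l → (∀ a → p a ≡ false → f a ≡ 0₃) → sum₃ f (filterᵇ p l) ≡ sum₃ f l
sum₃-filter f p [] h = refl
sum₃-filter f p (a ∷ l) h with p a in eq
... | true = cong (f a +₃_) (sum₃-filter f p l h)
... | false = trans (sum₃-filter f p l h) (trans (sym (+₃-identityˡ _)) (cong (_+₃ sum₃ f l) (sym (h a eq))))

data Pick {A : Set} (a : A) : List A → List A → Set where
  here  : ∀ {l} → Pick a (a ∷ l) l
  there : ∀ {b k l} → Pick a k l → Pick a (b ∷ k) (b ∷ l)

sum-pick : ∀ {A : Set} (f : A → ℕ) {a k l} → Pick a k l → sum f k ≡ f a + sum f l
sum-pick f here = refl
sum-pick f {a} {b ∷ k} {_ ∷ l} (there p) = trans (cong (f b +_) (sum-pick f p))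
  (trans (sym (+-assoc (f b) (f a) _)) (trans (cong (_+ sum f l) (+-comm (f b) (f a))) (+-assoc (f a) (f b) _)))

sum₃-pick : ∀ {A : Set} (f : A → Z3) {a k l} → Pick a k l → sum₃ f k ≡ f a +₃ sum₃ f l
sum₃-pick f here = refl
sum₃-pick f {a} {b ∷ k} {_ ∷ l} (there p) = trans (cong (f b +₃_) (sum₃-pick f p)) (+₃-swap (f b) (f a) _)

length-pick : ∀ {A : Set} {a : A} {k l} → Pick a k l → length k ≡ suc (length l)
length-pick here = refl
length-pick (there p) = cong suc (length-pick p)

sum-positive : ∀ {A : Set} (f : A → ℕ) l → 1 ≤ sum f l → ∃[ a ] ∃[ k ] Pick a l k × 1 ≤ f a
sum-positive f (a ∷ l) h with f a in eq
... | suc _ = a , l , here , subst (1 ≤_) (sym eq) (s≤s z≤n)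
... | zero with sum-positive f l h
...   | b , k , p , h' = b , a ∷ k , there p , h'

sum-≡0 : ∀ {A : Set} {f : A → ℕ} → (∀ a → f a ≡ 0) → ∀ l → sum f l ≡ 0
sum-≡0 h [] = refl
sum-≡0 h (a ∷ l) = cong₂ _+_ (h a) (sum-≡0 h l)

-- Vertex sets

VSet : ℕ → Set
VSet n = Fin n → Bool

infix 4 _∈_ _∉_ _⊆_
infixl 6 _∩_ _∖_ _∪_

_∈_ _∉_ : ∀ {n} → Fin n → VSet n → Set
v ∈ S = S v ≡ true
v ∉ S = S v ≡ false

_⊆_ : ∀ {n} → VSet n → VSet n → Set
S ⊆ R = ∀ v → v ∈ S → v ∈ R

_∩_ _∖_ _∪_ : ∀ {n} → VSet n → VSet n → VSet n
(S ∩ R) v = S v ∧ R v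
(S ∖ R) v = S v ∧ not (R v)
(S ∪ R) v = S v ∨ R v

∁ : ∀ {n} → VSet n → VSet n
∁ S v = not (S v)

⁅_⁆ : ∀ {n} → Fin n → VSet n
⁅ v ⁆ w = does (v ≟ w)

∈⁅⁆ : ∀ {n} (v : Fin n) → v ∈ ⁅ v ⁆
∈⁅⁆ v with v ≟ v
... | yes _ = refl
... | no ≢ = ⊥-elim (≢ refl)

∈⁅⁆⇒≡ : ∀ {n} (v w : Fin n) → w ∈ ⁅ v ⁆ → v ≡ w
∈⁅⁆⇒≡ v w h with v ≟ w
... | yes eq = eq

∉⁅⁆ : ∀ {n} (v w : Fin n) → v ≢ w → w ∉ ⁅ v ⁆
∉⁅⁆ v w ≢ with v ≟ w
... | yes eq = ⊥-elim (≢ eq)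
... | no _ = refl

true≢false : ∀ {b} → b ≡ true → b ≡ false → ⊥
true≢false refl ()

∈∖ : ∀ {n} (S R : VSet n) v → v ∈ S → v ∉ R → v ∈ S ∖ R
∈∖ S R v h k rewrite h | k = refl

∖⊆ : ∀ {n} (S R : VSet n) v → v ∈ S ∖ R → v ∈ S
∖⊆ S R v h with S v
... | true = refl

∖∉ : ∀ {n} (S R : VSet n) v → v ∈ S ∖ R → v ∉ R
∖∉ S R v h with S v | R v
... | true | false = refl

∈∩ : ∀ {n} (S R : VSet n) v → v ∈ S → v ∈ R → v ∈ S ∩ R
∈∩ S R v h k rewrite h | k = refl

∩⊆ˡ : ∀ {n} (S R : VSet n) v → v ∈ S ∩ R → v ∈ S
∩⊆ˡ S R v h with S v
... | true = refl

∩⊆ʳ : ∀ {n} (S R : VSet n) v → v ∈ S ∩ R → v ∈ R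
∩⊆ʳ S R v h with S v | R v
... | true | true = refl

∪-elim : ∀ {n} (S R : VSet n) v → v ∈ S ∪ R → v ∈ S ⊎ v ∈ R
∪-elim S R v h with S v
... | true = inj₁ refl
... | false = inj₂ h

∈∪ˡ : ∀ {n} (S R : VSet n) v → v ∈ S → v ∈ S ∪ R
∈∪ˡ S R v h rewrite h = refl

∈∪ʳ : ∀ {n} (S R : VSet n) v → v ∈ R → v ∈ S ∪ R
∈∪ʳ S R v h with S v
... | true = refl
... | false = h

≗-⊆ : ∀ {n} (S R : VSet n) → S ⊆ R → R ⊆ S → S ≗ R
≗-⊆ S R h k v with S v in eq | R v in eq'
... | true | true = refl
... | false | false = refl
... | true | false = trans (sym (h v eq)) eq'
... | false | true = trans (sym eq) (k v eq')

∩-⊆ : ∀ {n} (S R : VSet n) → R ⊆ S → (S ∩ R) ≗ R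
∩-⊆ S R h = ≗-⊆ _ _ (∩⊆ʳ S R) (λ v e → ∈∩ S R v (h v e) e)

decide-∈ : ∀ {n} (S : VSet n) v → v ∈ S ⊎ v ∉ S
decide-∈ S v with S v
... | true = inj₁ refl
... | false = inj₂ refl

∉∖ : ∀ {n} (S R : VSet n) v → v ∈ R → v ∉ S ∖ R
∉∖ S R v h rewrite h with S v
... | true = refl
... | false = refl

∪-⊆ : ∀ {n} (S R Q : VSet n) → S ⊆ Q → R ⊆ Q → S ∪ R ⊆ Q
∪-⊆ S R Q h k v v∈ with ∪-elim S R v v∈
... | inj₁ e = h v e
... | inj₂ e = k v e

Nonempty : ∀ {n} → VSet n → Set
Nonempty S = ∃[ v ] v ∈ S

∖-empty : ∀ {n} (S R : VSet n) → ¬ Nonempty (S ∖ R) → S ⊆ R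
∖-empty S R none v v∈ with decide-∈ R v
... | inj₁ e = e
... | inj₂ e = ⊥-elim (none (v , ∈∖ S R v v∈ e))

≗-∖-empty : ∀ {n} (S R : VSet n) → R ⊆ S → ¬ Nonempty (S ∖ R) → S ≗ R
≗-∖-empty S R h none = ≗-⊆ S R (∖-empty S R none) h

⟨_⟩ : Bool → ℕ
⟨ true ⟩ = 1
⟨ false ⟩ = 0

⟨⟩≤1 : ∀ b → ⟨ b ⟩ ≤ 1
⟨⟩≤1 true = ≤-refl
⟨⟩≤1 false = z≤n

infix 21 _⋆_
_⋆_ : Bool → Z3 → Z3
true ⋆ c = c
false ⋆ c = 0₃

-- Cuts, tip ends and boundaries of vertex sets

-- Tail and head, if the edge is directed.
Edge : ℕ → Set
Edge n = Fin n × Fin n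

-- A tip edge: the end other than z, and the sign.
Tip : ℕ → Set
Tip n = Fin n × Bool

Charge : ℕ → Set
Charge n = Fin n × Z3

crossing : ∀ {n} → VSet n → Edge n → ℕ
crossing S (u , w) = ⟨ S u xor S w ⟩

cut : ∀ {n} → VSet n → List (Edge n) → ℕ
cut S = sum (crossing S)

at : ∀ {n} → VSet n → Tip n → ℕ
at S (v , _) = ⟨ S v ⟩

cnt : ∀ {n} → VSet n → List (Tip n) → ℕ
cnt S = sum (at S)

same : Bool → Bool → Bool
same true s = s
same false s = not s

same-pos : ∀ s {k} → 1 ≤ ⟨ same s s ⟩ + k
same-pos true = s≤s z≤n
same-pos false = s≤s z≤n

atSign : ∀ {n} → Bool → VSet n → Tip n → ℕ
atSign s S (v , s') = ⟨ S v ∧ same s s' ⟩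

sgn : ∀ {n} → Bool → VSet n → List (Tip n) → ℕ
sgn s S = sum (atSign s S)

weigh : ∀ {n} → VSet n → Charge n → Z3
weigh S (v , c) = S v ⋆ c

ev : ∀ {n} → VSet n → List (Charge n) → Z3
ev S = sum₃ (weigh S)

pull : ∀ {n} → VSet n → Tip n → Z3
pull S (v , s) = S v ⋆ q s

pulls : ∀ {n} → VSet n → List (Tip n) → Z3
pulls S = sum₃ (pull S)

-- Minus the contribution of a directed edge to the outflow of S.
arc : ∀ {n} → VSet n → Edge n → Z3
arc S (u , w) = S u ⋆ 2₃ +₃ S w ⋆ 1₃

net : ∀ {n} → VSet n → List (Edge n) → Z3
net S = sum₃ (arc S)

between : ∀ {n} → VSet n → VSet n → Edge n → ℕ
between S R (u , w) = ⟨ S u ∧ S w ∧ (R u xor R w) ⟩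

joins : ∀ {n} → VSet n → VSet n → List (Edge n) → ℕ
joins S R = sum (between S R)

module _ {n : ℕ} where

  cut-cong : ∀ {S R : VSet n} → S ≗ R → ∀ F → cut S F ≡ cut R F
  cut-cong h = sum-cong λ (u , w) → cong₂ (λ a b → ⟨ a xor b ⟩) (h u) (h w)

  cnt-cong : ∀ {S R : VSet n} → S ≗ R → ∀ P → cnt S P ≡ cnt R P
  cnt-cong h = sum-cong λ (v , _) → cong ⟨_⟩ (h v)

  sgn-cong : ∀ {S R : VSet n} s → S ≗ R → ∀ P → sgn s S P ≡ sgn s R P
  sgn-cong s h = sum-cong λ (v , s') → cong (λ b → ⟨ b ∧ same s s' ⟩) (h v)

  ev-cong : ∀ {S R : VSet n} → S ≗ R → ∀ ρ → ev S ρ ≡ ev R ρ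
  ev-cong h = sum₃-cong λ (v , c) → cong (_⋆ c) (h v)

  pulls-cong : ∀ {S R : VSet n} → S ≗ R → ∀ P → pulls S P ≡ pulls R P
  pulls-cong h = sum₃-cong λ (v , s) → cong (_⋆ q s) (h v)

  net-cong : ∀ {S R : VSet n} → S ≗ R → ∀ D → net S D ≡ net R D
  net-cong h = sum₃-cong λ (u , w) → cong₂ (λ a b → a ⋆ 2₃ +₃ b ⋆ 1₃) (h u) (h w)

  cut-split : ∀ (S R : VSet n) F → cut (S ∩ R) F + cut (S ∖ R) F ≡ cut S F + (joins S R F + joins S R F)
  cut-split S R F = trans (sym (sum-+ (crossing (S ∩ R)) (crossing (S ∖ R)) F))
    (trans (sum-cong pointwise F) (trans (sum-+ (crossing S) (λ e → between S R e + between S R e) F)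
      (cong (cut S F +_) (sum-+ (between S R) (between S R) F))))
    where
    table : ∀ a c x y → ⟨ (a ∧ x) xor (c ∧ y) ⟩ + ⟨ (a ∧ not x) xor (c ∧ not y) ⟩ ≡ ⟨ a xor c ⟩ + (⟨ a ∧ c ∧ (x xor y) ⟩ + ⟨ a ∧ c ∧ (x xor y) ⟩)
    table = from-yes (∀Bool? λ a → ∀Bool? λ c → ∀Bool? λ x → ∀Bool? λ y →
      (⟨ (a ∧ x) xor (c ∧ y) ⟩ + ⟨ (a ∧ not x) xor (c ∧ not y) ⟩) ℕ.≟ (⟨ a xor c ⟩ + (⟨ a ∧ c ∧ (x xor y) ⟩ + ⟨ a ∧ c ∧ (x xor y) ⟩)))
    pointwise : ∀ e → crossing (S ∩ R) e + crossing (S ∖ R) e ≡ crossing S e + (between S R e + between S R e)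
    pointwise (u , w) = table (S u) (S w) (R u) (R w)

  cut-submodular : ∀ (S R : VSet n) F → cut (S ∩ R) F + cut (S ∪ R) F ≤ cut S F + cut R F
  cut-submodular S R F = subst₂ _≤_ (sum-+ (crossing (S ∩ R)) (crossing (S ∪ R)) F) (sum-+ (crossing S) (crossing R) F) (sum-mono pointwise F)
    where
    table : ∀ a c x y → ⟨ (a ∧ x) xor (c ∧ y) ⟩ + ⟨ (a ∨ x) xor (c ∨ y) ⟩ ≤ ⟨ a xor c ⟩ + ⟨ x xor y ⟩
    table = from-yes (∀Bool? λ a → ∀Bool? λ c → ∀Bool? λ x → ∀Bool? λ y →
      (⟨ (a ∧ x) xor (c ∧ y) ⟩ + ⟨ (a ∨ x) xor (c ∨ y) ⟩) ≤? (⟨ a xor c ⟩ + ⟨ x xor y ⟩))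
    pointwise : ∀ e → crossing (S ∩ R) e + crossing (S ∪ R) e ≤ crossing S e + crossing R e
    pointwise (u , w) = table (S u) (S w) (R u) (R w)

  ⟨⟩-split : ∀ a b → ⟨ a ∧ b ⟩ + ⟨ a ∧ not b ⟩ ≡ ⟨ a ⟩
  ⟨⟩-split true true = refl
  ⟨⟩-split true false = refl
  ⟨⟩-split false b = refl

  cnt-split : ∀ (S R : VSet n) P → cnt (S ∩ R) P + cnt (S ∖ R) P ≡ cnt S P
  cnt-split S R P = trans (sym (sum-+ (at (S ∩ R)) (at (S ∖ R)) P)) (sum-cong (λ (v , _) → ⟨⟩-split (S v) (R v)) P)

  cnt-modular : ∀ (S R : VSet n) P → cnt (S ∩ R) P + cnt (S ∪ R) P ≡ cnt S P + cnt R P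
  cnt-modular S R P = trans (sym (sum-+ (at (S ∩ R)) (at (S ∪ R)) P))
    (trans (sum-cong (λ (v , _) → pointwise (S v) (R v)) P) (sum-+ (at S) (at R) P))
    where
    pointwise : ∀ a b → ⟨ a ∧ b ⟩ + ⟨ a ∨ b ⟩ ≡ ⟨ a ⟩ + ⟨ b ⟩
    pointwise true true = refl
    pointwise true false = refl
    pointwise false b = refl

  sgn-split : ∀ s (S R : VSet n) P → sgn s (S ∩ R) P + sgn s (S ∖ R) P ≡ sgn s S P
  sgn-split s S R P = trans (sym (sum-+ (atSign s (S ∩ R)) (atSign s (S ∖ R)) P))
    (sum-cong (λ (v , s') → pointwise (S v) (R v) (same s s')) P)
    where
    pointwise : ∀ a b c → ⟨ (a ∧ b) ∧ c ⟩ + ⟨ (a ∧ not b) ∧ c ⟩ ≡ ⟨ a ∧ c ⟩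
    pointwise true true true = refl
    pointwise true true false = refl
    pointwise true false c = refl
    pointwise false b c = refl

  cnt-sgn : ∀ (S : VSet n) P → sgn true S P + sgn false S P ≡ cnt S P
  cnt-sgn S P = trans (sym (sum-+ (atSign true S) (atSign false S) P)) (sum-cong (λ (v , s) → ⟨⟩-split (S v) s) P)

  sgn≤cnt : ∀ s (S : VSet n) P → sgn s S P ≤ cnt S P
  sgn≤cnt true S P = ≤-trans (m≤m+n _ _) (≤-reflexive (cnt-sgn S P))
  sgn≤cnt false S P = ≤-trans (m≤n+m _ _) (≤-reflexive (cnt-sgn S P))

  sgn-mono : ∀ s {S R : VSet n} → S ⊆ R → ∀ P → sgn s S P ≤ sgn s R P
  sgn-mono s {S} {R} h = sum-mono pointwise
    where
    pointwise : ∀ p → atSign s S p ≤ atSign s R p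
    pointwise (v , s') with S v in eq
    ... | false = z≤n
    ... | true rewrite h v eq = ≤-refl

  ⋆-split : ∀ a b c → (a ∧ b) ⋆ c +₃ (a ∧ not b) ⋆ c ≡ a ⋆ c
  ⋆-split true true c = +₃-identityʳ c
  ⋆-split true false c = +₃-identityˡ c
  ⋆-split false b c = refl

  ev-split : ∀ (S R : VSet n) ρ → ev (S ∩ R) ρ +₃ ev (S ∖ R) ρ ≡ ev S ρ
  ev-split S R ρ = trans (sym (sum₃-+ (weigh (S ∩ R)) (weigh (S ∖ R)) ρ)) (sum₃-cong (λ (v , c) → ⋆-split (S v) (R v) c) ρ)

  pulls-split : ∀ (S R : VSet n) P → pulls (S ∩ R) P +₃ pulls (S ∖ R) P ≡ pulls S P
  pulls-split S R P = trans (sym (sum₃-+ (pull (S ∩ R)) (pull (S ∖ R)) P)) (sum₃-cong (λ (v , s) → ⋆-split (S v) (R v) (q s)) P)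

  net-split : ∀ (S R : VSet n) D → net (S ∩ R) D +₃ net (S ∖ R) D ≡ net S D
  net-split S R D = trans (sym (sum₃-+ (arc (S ∩ R)) (arc (S ∖ R)) D)) (sum₃-cong pointwise D)
    where
    pointwise : ∀ e → arc (S ∩ R) e +₃ arc (S ∖ R) e ≡ arc S e
    pointwise (u , w) = trans (+₃-interchange ((S u ∧ R u) ⋆ 2₃) _ _ _)
      (cong₂ _+₃_ (⋆-split (S u) (R u) 2₃) (⋆-split (S w) (R w) 1₃))

  infix 4 _⊳_
  data _⊳_ : List (Edge n) → List (Edge n) → Set where
    []   : [] ⊳ []
    keep : ∀ {u w F D} → F ⊳ D → (u , w) ∷ F ⊳ (u , w) ∷ D
    flip : ∀ {u w F D} → F ⊳ D → (u , w) ∷ F ⊳ (w , u) ∷ D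

  -- The charges that remain to be carried away after the orientation D has been used.
  residue : List (Edge n) → List (Charge n) → List (Charge n)
  residue [] ρ = ρ
  residue ((u , w) ∷ D) ρ = (u , 2₃) ∷ (w , 1₃) ∷ residue D ρ

  ev-residue : ∀ S D ρ → ev S (residue D ρ) ≡ net S D +₃ ev S ρ
  ev-residue S [] ρ = sym (+₃-identityˡ _)
  ev-residue S ((u , w) ∷ D) ρ = trans (cong (λ t → S u ⋆ 2₃ +₃ (S w ⋆ 1₃ +₃ t)) (ev-residue S D ρ))
    (trans (sym (+₃-assoc (S u ⋆ 2₃) _ _)) (sym (+₃-assoc (arc S (u , w)) _ _)))

  -- `net` is the outflow with opposite sign, so the sum vanishes when the outflow of S equals its
  -- charge.
  record Balanced (S : VSet n) (D : List (Edge n)) (ρ : List (Charge n)) : Set where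
    constructor balanced
    field balance : net S D +₃ ev S ρ ≡ 0₃

  open Balanced public

  -- By additivity the single vertices of W would do. With all subsets at hand, balance passes
  -- through a contraction without sums over the contracted vertices. Sets that leave W are free, so
  -- the root absorbs whatever arrives.
  Flow : VSet n → List (Edge n) → List (Charge n) → Set
  Flow W F ρ = Σ[ D ∈ List (Edge n) ] F ⊳ D × (∀ S → S ⊆ W → Balanced S D ρ)

  ends : List (Edge n) → List (Tip n)
  ends [] = []
  ends ((u , w) ∷ D) = (u , false) ∷ (w , true) ∷ ends D

  -- What `residue` adds to the charges, the two tip ends of the edge take away again. Turning
  -- oriented edges into tip ends therefore preserves boundaries.
  net-ends : ∀ S D → net S D +₃ pulls S (ends D) ≡ 0₃
  net-ends S [] = refl
  net-ends S ((u , w) ∷ D) = trans (rearrange (S u) (S w) (net S D) (pulls S (ends D))) (net-ends S D)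
    where
    rearrange : ∀ a b x y → ((a ⋆ 2₃ +₃ b ⋆ 1₃) +₃ x) +₃ (a ⋆ 1₃ +₃ (b ⋆ 2₃ +₃ y)) ≡ x +₃ y
    rearrange = from-yes (∀Bool? λ a → ∀Bool? λ b → all? λ x → all? λ y →
      (((a ⋆ 2₃ +₃ b ⋆ 1₃) +₃ x) +₃ (a ⋆ 1₃ +₃ (b ⋆ 2₃ +₃ y))) ≟ (x +₃ y))

  ⊳-pick : ∀ {u w F F' D'} → Pick (u , w) F F' → F' ⊳ D' → (∃[ D ] F ⊳ D × Pick (u , w) D D') × (∃[ D ] F ⊳ D × Pick (w , u) D D')
  ⊳-pick here o = (_ , keep o , here) , (_ , flip o , here)
  ⊳-pick (there p) (keep o) with ⊳-pick p o
  ... | (D₁ , o₁ , p₁) , (D₂ , o₂ , p₂) = (_ , keep o₁ , there p₁) , (_ , keep o₂ , there p₂)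
  ⊳-pick (there p) (flip o) with ⊳-pick p o
  ... | (D₁ , o₁ , p₁) , (D₂ , o₂ , p₂) = (_ , flip o₁ , there p₁) , (_ , flip o₂ , there p₂)

  PickE : Fin n → Fin n → List (Edge n) → List (Edge n) → Set
  PickE u w F F' = Pick (u , w) F F' ⊎ Pick (w , u) F F'

  PickE-sym : ∀ {u w F F'} → PickE u w F F' → PickE w u F F'
  PickE-sym (inj₁ p) = inj₂ p
  PickE-sym (inj₂ p) = inj₁ p

  ⊳-pickE : ∀ {u w F F' D'} → PickE u w F F' → F' ⊳ D' → ∃[ D ] F ⊳ D × Pick (u , w) D D'
  ⊳-pickE (inj₁ p) o = proj₁ (⊳-pick p o)
  ⊳-pickE (inj₂ p) o = proj₂ (⊳-pick p o)

  xor-comm : ∀ a b → a xor b ≡ b xor a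
  xor-comm true true = refl
  xor-comm true false = refl
  xor-comm false true = refl
  xor-comm false false = refl

  cut-pickE : ∀ S {u w F F'} → PickE u w F F' → cut S F ≡ crossing S (u , w) + cut S F'
  cut-pickE S (inj₁ p) = sum-pick (crossing S) p
  cut-pickE S {u} {w} {F' = F'} (inj₂ p) = trans (sum-pick (crossing S) p) (cong (λ b → ⟨ b ⟩ + cut S F') (xor-comm (S w) (S u)))

  length-pickE : ∀ {u w F F'} → PickE u w F F' → length F ≡ suc (length F')
  length-pickE (inj₁ p) = length-pick p
  length-pickE (inj₂ p) = length-pick p

  crossing-edge : ∀ S F → 1 ≤ cut S F → ∃[ u ] ∃[ w ] ∃[ F' ] PickE u w F F' × u ∈ S × w ∉ S
  crossing-edge S F h with sum-positive (crossing S) F h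
  ... | (u , w) , F' , p , h' with S u in eu | S w in ew
  ...   | true | false = u , w , F' , inj₁ p , eu , ew
  ...   | false | true = w , u , F' , inj₂ p , ew , eu

  joining-edge : ∀ S R F → 1 ≤ joins S R F → ∃[ u ] ∃[ w ] ∃[ F' ] PickE u w F F' × u ∈ S ∩ R × w ∈ S ∖ R
  joining-edge S R F h with sum-positive (between S R) F h
  ... | (u , w) , F' , p , h' with S u in eSu | S w in eSw | R u in eu | R w in ew
  ...   | true | true | true | false = u , w , F' , inj₁ p , ∈∩ S R u eSu eu , ∈∖ S R w eSw ew
  ...   | true | true | false | true = w , u , F' , inj₂ p , ∈∩ S R w eSw ew , ∈∖ S R u eSu eu

  ⊳-merge : ∀ f F {D₁ D₂} → filterᵇ f F ⊳ D₁ → filterᵇ (not ∘ f) F ⊳ D₂ →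
    ∃[ D ] F ⊳ D × (∀ S → net S D ≡ net S D₁ +₃ net S D₂)
  ⊳-merge f [] [] [] = [] , [] , λ S → refl
  ⊳-merge f ((u , w) ∷ F) o₁ o₂ with f (u , w)
  ⊳-merge f ((u , w) ∷ F) (keep o₁) o₂ | true with ⊳-merge f F o₁ o₂
  ... | D , o , h = _ , keep o , λ S → trans (cong (arc S (u , w) +₃_) (h S)) (sym (+₃-assoc (arc S (u , w)) _ _))
  ⊳-merge f ((u , w) ∷ F) (flip o₁) o₂ | true with ⊳-merge f F o₁ o₂
  ... | D , o , h = _ , flip o , λ S → trans (cong (arc S (w , u) +₃_) (h S)) (sym (+₃-assoc (arc S (w , u)) _ _))
  ⊳-merge f ((u , w) ∷ F) {D₁} o₁ (keep {D = D₂} o₂) | false with ⊳-merge f F o₁ o₂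
  ... | D , o , h = _ , keep o , λ S → trans (cong (arc S (u , w) +₃_) (h S)) (+₃-swap (arc S (u , w)) (net S D₁) (net S D₂))
  ⊳-merge f ((u , w) ∷ F) {D₁} o₁ (flip {D = D₂} o₂) | false with ⊳-merge f F o₁ o₂
  ... | D , o , h = _ , flip o , λ S → trans (cong (arc S (w , u) +₃_) (h S)) (+₃-swap (arc S (w , u)) (net S D₁) (net S D₂))

  cut-⊳ : ∀ {F D} S → F ⊳ D → cut S F ≡ cut S D
  cut-⊳ S [] = refl
  cut-⊳ S (keep o) = cong₂ _+_ refl (cut-⊳ S o)
  cut-⊳ S (flip {u} {w} o) = cong₂ (λ b k → ⟨ b ⟩ + k) (xor-comm (S u) (S w)) (cut-⊳ S o)

-- Instances, and how flows of two contractions combine.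

module _ {n : ℕ} where

  deg : VSet n → List (Edge n) → List (Tip n) → ℕ
  deg S F P = cut S F + cnt S P

  bd : VSet n → List (Charge n) → List (Tip n) → Z3
  bd S ρ P = ev S ρ +₃ pulls S P

  Tame : List (Edge n) → List (Charge n) → List (Tip n) → VSet n → Set
  Tame F ρ P S = 4 + τ (deg S F P) (bd S ρ P) ≤ deg S F P

  Mixed : List (Tip n) → VSet n → Set
  Mixed P S = ∀ s → 1 ≤ sgn s S P

  -- Tallness of the easel in which everything outside S is identified with the root.
  Tall : List (Edge n) → List (Tip n) → VSet n → Set
  Tall F P S = cnt S P ≤ cut S F + 2 × (cnt S P ≡ cut S F + 2 → Mixed P S)

  record Good (F : List (Edge n)) (ρ : List (Charge n)) (P : List (Tip n)) (S : VSet n) : Set where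
    constructor good
    field
      isTame : Tame F ρ P S
      isTall : Tall F P S

  open Good public

  -- W contains neither tip nor root: every vertex outside W counts as the root. The charges ρ are what
  -- the edges F have to carry, that is, the boundary after subtraction of what the tip edges P carry.
  Inst : VSet n → List (Edge n) → List (Charge n) → List (Tip n) → Set
  Inst W F ρ P = ∀ S → S ⊆ W → Nonempty S → Good F ρ P S

  deg-cong : ∀ {S R} → S ≗ R → ∀ F P → deg S F P ≡ deg R F P
  deg-cong h F P = cong₂ _+_ (cut-cong h F) (cnt-cong h P)

  bd-cong : ∀ {S R} → S ≗ R → ∀ ρ P → bd S ρ P ≡ bd R ρ P
  bd-cong h ρ P = cong₂ _+₃_ (ev-cong h ρ) (pulls-cong h P)

  Tame-cong : ∀ {S R} → S ≗ R → ∀ F ρ P → Tame F ρ P S → Tame F ρ P R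
  Tame-cong h F ρ P = subst₂ (λ d b → 4 + τ d b ≤ d) (deg-cong h F P) (bd-cong h ρ P)

  Mixed-cong : ∀ {S R} → S ≗ R → ∀ P → Mixed P S → Mixed P R
  Mixed-cong h P m s = subst (1 ≤_) (sgn-cong s h P) (m s)

  Mixed-mono : ∀ {S R} → S ⊆ R → ∀ P → Mixed P S → Mixed P R
  Mixed-mono h P m s = ≤-trans (m s) (sgn-mono s h P)

  deg-split : ∀ S R F P → deg (S ∩ R) F P + deg (S ∖ R) F P ≡ deg S F P + (joins S R F + joins S R F)
  deg-split S R F P = lin 8 (λ a b c d e f g j → (a ⊕ c ≈ e ⊕ j) ∷ (b ⊕ d ≈ f) ∷ [] ⊢ (a ⊕ b ⊕ (c ⊕ d) ≈ e ⊕ f ⊕ j))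
    (cut (S ∩ R) F) (cnt (S ∩ R) P) (cut (S ∖ R) F) (cnt (S ∖ R) P) (cut S F) (cnt S P) 0 (joins S R F + joins S R F)
    (cut-split S R F) (cnt-split S R P)

  bd-split : ∀ S R ρ P → bd (S ∩ R) ρ P +₃ bd (S ∖ R) ρ P ≡ bd S ρ P
  bd-split S R ρ P = trans (+₃-interchange (ev (S ∩ R) ρ) _ _ _) (cong₂ _+₃_ (ev-split S R ρ) (pulls-split S R P))

  τ-split : ∀ S R F ρ P → τ (deg S F P) (bd S ρ P) ≤ τ (deg (S ∩ R) F P) (bd (S ∩ R) ρ P) + τ (deg (S ∖ R) F P) (bd (S ∖ R) ρ P)
  τ-split S R F ρ P = subst (λ b → τ (deg S F P) b ≤ τ (deg (S ∩ R) F P) (bd (S ∩ R) ρ P) + τ (deg (S ∖ R) F P) (bd (S ∖ R) ρ P))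
    (bd-split S R ρ P) (τ-subadditive (deg S F P) (deg (S ∩ R) F P) (deg (S ∖ R) F P) (joins S R F) (bd (S ∩ R) ρ P) (bd (S ∖ R) ρ P) (deg-split S R F P))

  size : List (Edge n) → List (Tip n) → ℕ
  size F P = length F + length F + length P

  -- Cutting out the vertices of K: the edges leaving K, once oriented, become tip edges.

  inside : VSet n → Edge n → Bool
  inside K (u , w) = K u ∧ K w

  inner outer : VSet n → List (Edge n) → List (Edge n)
  inner K = filterᵇ (inside K)
  outer K = filterᵇ (not ∘ inside K)

  length-partition : ∀ K F → length (inner K F) + length (outer K F) ≡ length F
  length-partition K F = trans (cong₂ _+_ (sym (sum-1 (inner K F))) (sym (sum-1 (outer K F)))) (trans (sum-partition (λ _ → 1) (inside K) F) (sum-1 F))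

  tipsIn : VSet n → List (Edge n) → List (Tip n) → List (Tip n)
  tipsIn K D P = filterᵇ (λ p → K (proj₁ p)) (ends D ++ P)

  ⊆-false : ∀ {S R : VSet n} → S ⊆ R → ∀ v → v ∉ R → v ∉ S
  ⊆-false {S} h v v∉ with S v in eq
  ... | false = refl
  ... | true = trans (sym (h v eq)) v∉

  -- An outer edge has at most one end in K, so within S ⊆ K it leaves a tip end exactly when it
  -- crosses S.
  ends-cut : ∀ {S K} F {D} → S ⊆ K → outer K F ⊳ D → cnt S (ends D) ≡ cut S (outer K F)
  ends-cut [] h [] = refl
  ends-cut {S} {K} ((u , w) ∷ F) h o with K u in eu | K w in ew
  ... | true | true = ends-cut F h o
  ends-cut {S} {K} ((u , w) ∷ F) h (keep o) | true | false rewrite ⊆-false h w ew with S u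
  ... | true = cong suc (ends-cut F h o)
  ... | false = ends-cut F h o
  ends-cut {S} {K} ((u , w) ∷ F) h (flip o) | true | false rewrite ⊆-false h w ew with S u
  ... | true = cong suc (ends-cut F h o)
  ... | false = ends-cut F h o
  ends-cut {S} {K} ((u , w) ∷ F) h (keep o) | false | b rewrite ⊆-false h u eu with S w
  ... | true = cong suc (ends-cut F h o)
  ... | false = ends-cut F h o
  ends-cut {S} {K} ((u , w) ∷ F) h (flip o) | false | b rewrite ⊆-false h u eu with S w
  ... | true = cong suc (ends-cut F h o)
  ... | false = ends-cut F h o

  -- Subsets of K keep their degrees and boundaries, so tameness carries over as it stands. Only
  -- tallness has to be established anew, because cut edges have become tip edges.
  module Interior (K : VSet n) (F : List (Edge n)) (ρ : List (Charge n)) (P : List (Tip n))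
                  {D : List (Edge n)} (o : outer K F ⊳ D) where

    F′ = inner K F
    ρ′ = residue D ρ
    P′ = tipsIn K D P

    cut-parts : ∀ S → cut S F′ + cut S (outer K F) ≡ cut S F
    cut-parts S = sum-partition (crossing S) (inside K) F

    cnt′ : ∀ S → S ⊆ K → cnt S P′ ≡ cut S (outer K F) + cnt S P
    cnt′ S h = trans (sum-filter (at S) (λ p → K (proj₁ p)) (ends D ++ P) (λ (v , s) v∉ → cong ⟨_⟩ (⊆-false h v v∉)))
      (trans (sum-++ (at S) (ends D) P) (cong (_+ cnt S P) (ends-cut F h o)))

    deg′ : ∀ S → S ⊆ K → deg S F′ P′ ≡ deg S F P
    deg′ S h = lin 5 (λ a b c d e → (a ⊕ b ≈ c) ∷ (d ≈ b ⊕ e) ∷ [] ⊢ (a ⊕ d ≈ c ⊕ e)) (cut S F′) (cut S (outer K F)) (cut S F) (cnt S P′) (cnt S P)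
      (cut-parts S) (cnt′ S h)

    bd′ : ∀ S → S ⊆ K → bd S ρ′ P′ ≡ bd S ρ P
    bd′ S h = trans (cong₂ _+₃_ (ev-residue S D ρ) (trans (sum₃-filter (pull S) (λ p → K (proj₁ p)) (ends D ++ P)
        (λ (v , s) v∉ → cong (_⋆ q s) (⊆-false h v v∉))) (sum₃-++ (pull S) (ends D) P)))
      (trans (+₃-interchange (net S D) _ _ _) (trans (cong (_+₃ bd S ρ P) (net-ends S D)) (+₃-identityˡ _)))

    sgn′ : ∀ s S → S ⊆ K → sgn s S P′ ≡ sgn s S (ends D) + sgn s S P
    sgn′ s S h = trans (sum-filter (atSign s S) (λ p → K (proj₁ p)) (ends D ++ P)
        (λ (v , s') v∉ → cong (λ b → ⟨ b ∧ same s s' ⟩) (⊆-false h v v∉)))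
      (sum-++ (atSign s S) (ends D) P)

    Tame′ : ∀ S → S ⊆ K → Tame F ρ P S → Tame F′ ρ′ P′ S
    Tame′ S h = subst₂ (λ d b → 4 + τ d b ≤ d) (sym (deg′ S h)) (sym (bd′ S h))

    Mixed′ : ∀ S → S ⊆ K → Mixed P S → Mixed P′ S
    Mixed′ S h m s = ≤-trans (m s) (≤-trans (m≤n+m _ _) (≤-reflexive (sym (sgn′ s S h))))

    inner-0 : cut K F′ ≡ 0
    inner-0 = trans (sum-filter-cong {g = λ _ → 0} (inside K)
        (λ (u , w) e → cong₂ (λ a b → ⟨ a xor b ⟩) (∩⊆ˡ (λ _ → K u) (λ _ → K w) u e) (∩⊆ʳ (λ _ → K u) (λ _ → K w) u e)) F)
      (sum-≡0 (λ _ → refl) F′)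

    length-P′ : length P′ ≡ cut K F + cnt K P
    length-P′ = trans (sym (sum-1 P′)) (trans (sum-filter-cong (λ p → K (proj₁ p)) (λ (v , s) e → cong ⟨_⟩ (sym e)) (ends D ++ P))
      (trans (cnt′ K (λ _ e → e)) (cong (_+ cnt K P) (trans (cong (_+ cut K (outer K F)) (sym inner-0)) (cut-parts K)))))

    cut≤outer : cut K F ≤ length (outer K F)
    cut≤outer = ≤-trans (≤-reflexive (trans (sym (cut-parts K)) (cong (_+ cut K (outer K F)) inner-0)))
      (≤-trans (sum-mono (λ (u , w) → ⟨⟩≤1 (K u xor K w)) (outer K F)) (≤-reflexive (sum-1 (outer K F))))

    cnt-∁ : cnt K P + cnt (∁ K) P ≡ length P
    cnt-∁ = trans (sym (sum-+ (at K) (at (∁ K)) P)) (trans (sum-cong (λ (v , s) → one (K v)) P) (sum-1 P))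
      where
      one : ∀ b → ⟨ b ⟩ + ⟨ not b ⟩ ≡ 1
      one true = refl
      one false = refl

    -- An edge leaving K loses half its weight on becoming a tip edge, and a tip edge outside K
    -- loses all of it.
    size′ : 1 ≤ cut K F + cnt (∁ K) P → size F′ P′ < size F P
    size′ = lin 8 (λ fi fo f c p cp lp lp' → (fi ⊕ fo ≈ f) ∷ (lp' ≈ c ⊕ p) ∷ (c ≼ fo) ∷ (p ⊕ cp ≈ lp) ∷ (# 1 ≼ c ⊕ cp) ∷ [] ⊢ (# 1 ⊕ (fi ⊕ fi ⊕ lp') ≼ f ⊕ f ⊕ lp))
      (length F′) (length (outer K F)) (length F) (cut K F) (cnt K P) (cnt (∁ K) P) (length P) (length P′)
      (length-partition K F) length-P′ cut≤outer cnt-∁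

    combine-⊳ : ∀ {D₂} → F′ ⊳ D₂ → ∃[ D₃ ] F ⊳ D₃ × (∀ S → net S D₃ +₃ ev S ρ ≡ net S D₂ +₃ ev S ρ′)
    combine-⊳ {D₂} o₂ with ⊳-merge (inside K) F o₂ o
    ... | D₃ , o₃ , h = D₃ , o₃ , λ S → trans (cong (_+₃ ev S ρ) (h S)) (trans (+₃-assoc (net S D₂) _ _) (cong (net S D₂ +₃_) (sym (ev-residue S D ρ))))

  net-inner : ∀ (S K : VSet n) F {D} → inner K F ⊳ D → (∀ u w → u ∈ K → w ∈ K → S u ≡ S w) → net S D ≡ 0₃
  net-inner S K [] [] h = refl
  net-inner S K ((u , w) ∷ F) o h with K u in eu | K w in ew
  net-inner S K ((u , w) ∷ F) o h | false | b = net-inner S K F o h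
  net-inner S K ((u , w) ∷ F) o h | true | false = net-inner S K F o h
  net-inner S K ((u , w) ∷ F) (keep {D = D} o) h | true | true rewrite h u w eu ew with S w
  ... | true = trans (+₃-identityˡ (net S D)) (net-inner S K F o h)
  ... | false = trans (+₃-identityˡ (net S D)) (net-inner S K F o h)
  net-inner S K ((u , w) ∷ F) (flip {D = D} o) h | true | true rewrite h u w eu ew with S w
  ... | true = trans (+₃-identityˡ (net S D)) (net-inner S K F o h)
  ... | false = trans (+₃-identityˡ (net S D)) (net-inner S K F o h)

  Balanced-split : ∀ (S R : VSet n) D ρ → Balanced (S ∩ R) D ρ → Balanced (S ∖ R) D ρ → Balanced S D ρ
  Balanced-split S R D ρ (balanced h) (balanced k) = balanced (trans (cong₂ _+₃_ (sym (net-split S R D)) (sym (ev-split S R ρ)))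
    (trans (+₃-interchange (net (S ∩ R) D) (net (S ∖ R) D) (ev (S ∩ R) ρ) (ev (S ∖ R) ρ)) (cong₂ _+₃_ h k)))

  Balanced-∩ : ∀ (S R : VSet n) D ρ → Balanced S D ρ → Balanced (S ∖ R) D ρ → Balanced (S ∩ R) D ρ
  Balanced-∩ S R D ρ (balanced h) (balanced k) = balanced (trans (sym (+₃-identityʳ (net (S ∩ R) D +₃ ev (S ∩ R) ρ))) (trans (cong ((net (S ∩ R) D +₃ ev (S ∩ R) ρ) +₃_) (sym k))
    (trans (+₃-interchange (net (S ∩ R) D) (ev (S ∩ R) ρ) (net (S ∖ R) D) (ev (S ∖ R) ρ)) (trans (cong₂ _+₃_ (net-split S R D) (ev-split S R ρ)) h))))

  Balanced-cong : ∀ {S R : VSet n} → S ≗ R → ∀ {D ρ} → Balanced S D ρ → Balanced R D ρ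
  Balanced-cong h {D} {ρ} (balanced e) = balanced (subst₂ (λ a b → a +₃ b ≡ 0₃) (net-cong h D) (ev-cong h ρ) e)

  module _ {W B : VSet n} {F : List (Edge n)} {ρ : List (Charge n)} where

    -- B is contracted in D; r is the root of what has been contracted.
    flow-in : ∀ {r D} → B ⊆ W → r ∈ B → (o : outer B F ⊳ D) →
      (∀ S → S ⊆ W → B ⊆ S ⊎ (∀ v → v ∈ S → v ∉ B) → Balanced S D ρ) →
      Flow (B ∖ ⁅ r ⁆) (inner B F) (residue D ρ) → Flow W F ρ
    flow-in {r} {D} B⊆W r∈B o bal (D₂ , o₂ , bal₂) with Interior.combine-⊳ B F ρ [] o o₂
    ... | D₃ , o₃ , eq = D₃ , o₃ , λ S S⊆W → Balanced-split S B D₃ ρ (in-B S) (off-B S S⊆W)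
      where
      undivided : ∀ S → (∀ u w → u ∈ B → w ∈ B → S u ≡ S w) → Balanced S D ρ → Balanced S D₃ ρ
      undivided S h (balanced b) = balanced (trans (eq S) (trans (cong₂ _+₃_ (net-inner S B F o₂ h) (ev-residue S D ρ)) (trans (+₃-identityˡ (net S D +₃ ev S ρ)) b)))
      off-B : ∀ S → S ⊆ W → Balanced (S ∖ B) D₃ ρ
      off-B S S⊆W = undivided (S ∖ B) (λ u w u∈ w∈ → trans (∉∖ S B u u∈) (sym (∉∖ S B w w∈)))
        (bal (S ∖ B) (λ v v∈ → S⊆W v (∖⊆ S B v v∈)) (inj₂ (∖∉ S B)))
      whole : Balanced B D₃ ρ
      whole = undivided B (λ u w u∈ w∈ → trans u∈ (sym w∈)) (bal B B⊆W (inj₁ (λ _ v∈ → v∈)))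
      small : ∀ S → S ⊆ B → r ∉ S → Balanced S D₃ ρ
      small S h r∉S = balanced (trans (eq S) (balance (bal₂ S (λ v v∈ → ∈∖ B ⁅ r ⁆ v (h v v∈) (∉⁅⁆ r v λ { refl → true≢false v∈ r∉S })))))
      in-B : ∀ S → Balanced (S ∩ B) D₃ ρ
      in-B S with decide-∈ S r
      ... | inj₂ r∉S = small (S ∩ B) (∩⊆ʳ S B) (cong (_∧ B r) r∉S)
      -- The flow inside B says nothing about sets with the root r. Such a part of B is B minus a
      -- part without r, and B itself was balanced as a contracted vertex.
      ... | inj₁ r∈S = Balanced-cong (λ v → ∧-comm (B v) (S v)) (Balanced-∩ B S D₃ ρ whole (small (B ∖ S) (∖⊆ B S) (trans (cong (λ b → b ∧ not (S r)) r∈B) (cong not r∈S))))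
        where
        ∧-comm : ∀ a b → a ∧ b ≡ b ∧ a
        ∧-comm true true = refl
        ∧-comm true false = refl
        ∧-comm false true = refl
        ∧-comm false false = refl

    -- Everything outside B is contracted into the root in D.
    flow-out : ∀ {D} → (o : outer (∁ B) F ⊳ D) → (∀ S → S ⊆ B → Balanced S D ρ) →
      Flow (W ∖ B) (inner (∁ B) F) (residue D ρ) → Flow W F ρ
    flow-out {D} o bal (D₂ , o₂ , bal₂) with Interior.combine-⊳ (∁ B) F ρ [] o o₂
    ... | D₃ , o₃ , eq = D₃ , o₃ , λ S S⊆W → Balanced-split S B D₃ ρ (in-B S) (off-B S S⊆W)
      where
      in-B : ∀ S → Balanced (S ∩ B) D₃ ρ
      in-B S = balanced (trans (eq (S ∩ B)) (trans (cong₂ _+₃_ (net-inner (S ∩ B) (∁ B) F o₂ (λ u w u∈ w∈ → trans (out u u∈) (sym (out w w∈))))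
          (ev-residue (S ∩ B) D ρ)) (trans (+₃-identityˡ (net (S ∩ B) D +₃ ev (S ∩ B) ρ)) (balance (bal (S ∩ B) (∩⊆ʳ S B))))))
        where
        out : ∀ u → u ∈ ∁ B → u ∉ S ∩ B
        out u h with S u | B u
        ... | true | false = refl
        ... | false | false = refl
      off-B : ∀ S → S ⊆ W → Balanced (S ∖ B) D₃ ρ
      off-B S S⊆W = balanced (trans (eq (S ∖ B)) (balance (bal₂ (S ∖ B) (λ v v∈ → ∈∖ W B v (S⊆W v (∖⊆ S B v v∈)) (∖∉ S B v v∈)))))

-- Signs around a contracted set, and the instances inside and outside it.

m₃ : ℕ → Z3
m₃ zero = 0₃
m₃ (suc k) = 1₃ +₃ m₃ k

signs-dec : (i o : Fin 8) → Dec (6 ≤ toℕ i + toℕ o →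
    toℕ i + toℕ o ≤ 4 + τ (toℕ i + toℕ o) (m₃ (toℕ o) +₃ (m₃ (toℕ i) +₃ m₃ (toℕ i))) →
    1 ≤ toℕ i × 1 ≤ toℕ o × (toℕ i + toℕ o ≤ toℕ i + 2 ⊎ toℕ i + toℕ o ≤ toℕ o + 2))
signs-dec i o = (_ ≤? _) →-dec ((_ ≤? _) →-dec ((_ ≤? _) ×-dec ((_ ≤? _) ×-dec ((_ ≤? _) ⊎-dec (_ ≤? _)))))

-- Modulo 6, τ is the distance of o - i from 0. A total of 6 forces o - i to be 2 or 4 up to sign,
-- and a total of 7 forces 3 up to sign; in each case both signs occur and one of them at most
-- twice.
signs : ∀ i o → 6 ≤ i + o → i + o ≤ 4 + τ (i + o) (m₃ o +₃ (m₃ i +₃ m₃ i)) →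
  1 ≤ i × 1 ≤ o × (i + o ≤ i + 2 ⊎ i + o ≤ o + 2)
signs i o lo hi = go i o (s≤s (≤-trans (m≤m+n i o) top)) (s≤s (≤-trans (m≤n+m o i) top)) lo hi
  where
  top : i + o ≤ 7
  top = ≤-trans hi (+-monoʳ-≤ 4 (τ≤3 (i + o) _))
  table : ∀ (i o : Fin 8) → 6 ≤ toℕ i + toℕ o →
    toℕ i + toℕ o ≤ 4 + τ (toℕ i + toℕ o) (m₃ (toℕ o) +₃ (m₃ (toℕ i) +₃ m₃ (toℕ i))) →
    1 ≤ toℕ i × 1 ≤ toℕ o × (toℕ i + toℕ o ≤ toℕ i + 2 ⊎ toℕ i + toℕ o ≤ toℕ o + 2)
  table = from-yes (all? λ i → all? λ o → signs-dec i o)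
  go : ∀ i o → i < 8 → o < 8 → 6 ≤ i + o → i + o ≤ 4 + τ (i + o) (m₃ o +₃ (m₃ i +₃ m₃ i)) →
    1 ≤ i × 1 ≤ o × (i + o ≤ i + 2 ⊎ i + o ≤ o + 2)
  go i o i< o< = subst₂ (λ i o → 6 ≤ i + o → i + o ≤ 4 + τ (i + o) (m₃ o +₃ (m₃ i +₃ m₃ i)) →
    1 ≤ i × 1 ≤ o × (i + o ≤ i + 2 ⊎ i + o ≤ o + 2)) (toℕ-fromℕ< i<) (toℕ-fromℕ< o<) (table (fromℕ< i<) (fromℕ< o<))

module _ {n : ℕ} where

  nonempty? : (S : VSet n) → Dec (Nonempty S)
  nonempty? S = any? λ v → S v 𝔹.≟ true

  ∣_∣ : VSet n → ℕ
  ∣ S ∣ = sum (λ v → ⟨ S v ⟩) (allFin n)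

  sum-< : ∀ {A : Set} {f g : A → ℕ} {a} → (∀ a → f a ≤ g a) → f a < g a → ∀ {l} → a L.∈ l → sum f l < sum g l
  sum-< h lt {b ∷ l} (Any.here refl) = +-mono-<-≤ lt (sum-mono h l)
  sum-< h lt {b ∷ l} (Any.there a∈) = +-mono-≤-< (h b) (sum-< h lt a∈)

  ∣∣-strict : ∀ {S R : VSet n} {v} → S ⊆ R → v ∈ R → v ∉ S → ∣ S ∣ < ∣ R ∣
  ∣∣-strict {S} {R} {v} h v∈ v∉ = sum-< le lt (∈-allFin v)
    where
    le : ∀ w → ⟨ S w ⟩ ≤ ⟨ R w ⟩
    le w with S w in eq
    ... | false = z≤n
    ... | true rewrite h w eq = ≤-refl
    lt : ⟨ S v ⟩ < ⟨ R v ⟩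
    lt rewrite v∈ | v∉ = ≤-refl

  ⁅⁆⊆ : ∀ (S : VSet n) {v} → v ∈ S → ⁅ v ⁆ ⊆ S
  ⁅⁆⊆ S {v} v∈ w e = subst (_∈ S) (∈⁅⁆⇒≡ v w e) v∈

  alone : ∀ (S : VSet n) {v} → v ∈ S → ¬ Nonempty (S ∖ ⁅ v ⁆) → ⁅ v ⁆ ≗ S
  alone S {v} v∈ none = ≗-⊆ ⁅ v ⁆ S (⁅⁆⊆ S v∈) (∖-empty S ⁅ v ⁆ none)

  pulls-sgn : ∀ (S : VSet n) P → pulls S P ≡ m₃ (sgn false S P) +₃ (m₃ (sgn true S P) +₃ m₃ (sgn true S P))
  pulls-sgn S [] = refl
  pulls-sgn S ((v , s) ∷ P) with S v | s
  ... | false | _ = trans (+₃-identityˡ (pulls S P)) (pulls-sgn S P)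
  ... | true | false = trans (cong (1₃ +₃_) (pulls-sgn S P)) (sym (+₃-assoc 1₃ (m₃ (sgn false S P)) _))
  ... | true | true = trans (cong (2₃ +₃_) (pulls-sgn S P)) (rearrange (m₃ (sgn false S P)) (m₃ (sgn true S P)))
    where
    rearrange : ∀ x y → 2₃ +₃ (x +₃ (y +₃ y)) ≡ x +₃ ((1₃ +₃ y) +₃ (1₃ +₃ y))
    rearrange = from-yes (all? λ x → all? λ y → (2₃ +₃ (x +₃ (y +₃ y))) ≟ (x +₃ ((1₃ +₃ y) +₃ (1₃ +₃ y))))

  module _ (F : List (Edge n)) (ρ : List (Charge n)) (P : List (Tip n)) where

    private
      d : VSet n → ℕ
      d S = deg S F P
      b : VSet n → Z3
      b S = bd S ρ P
      t : VSet n → ℕ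
      t S = τ (d S) (b S)

    t-cong : ∀ {S R} → S ≗ R → t S ≡ t R
    t-cong h = cong₂ τ (deg-cong h F P) (bd-cong h ρ P)

    d-⁅⁆-split : ∀ (S : VSet n) {v} → v ∈ S → d ⁅ v ⁆ + d (S ∖ ⁅ v ⁆) ≡ d S + (joins S ⁅ v ⁆ F + joins S ⁅ v ⁆ F)
    d-⁅⁆-split S {v} v∈ = trans (cong (_+ d (S ∖ ⁅ v ⁆)) (sym (deg-cong (∩-⊆ S ⁅ v ⁆ (⁅⁆⊆ S v∈)) F P))) (deg-split S ⁅ v ⁆ F P)

    t-⁅⁆-split : ∀ (S : VSet n) {v} → v ∈ S → t S ≤ t ⁅ v ⁆ + t (S ∖ ⁅ v ⁆)
    t-⁅⁆-split S {v} v∈ = ≤-trans (τ-split S ⁅ v ⁆ F ρ P) (≤-reflexive (cong (_+ t (S ∖ ⁅ v ⁆)) (t-cong (∩-⊆ S ⁅ v ⁆ (⁅⁆⊆ S v∈)))))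

    -- τ is subadditive, so it cannot vanish at every vertex of S. The bound `k` on the size of S
    -- drives the recursion.
    τ-witness : ∀ k (S : VSet n) → ∣ S ∣ < k → Nonempty S → 1 ≤ t S → ∃[ v ] v ∈ S × 1 ≤ t ⁅ v ⁆
    τ-witness (suc k) S lt (v , v∈) h with 1 ≤? t ⁅ v ⁆
    ... | yes p = v , v∈ , p
    ... | no ¬p with nonempty? (S ∖ ⁅ v ⁆)
    ...   | no none = ⊥-elim (¬p (subst (1 ≤_) (sym (t-cong (alone S v∈ none))) h))
    ...   | yes ne with τ-witness k (S ∖ ⁅ v ⁆) (≤-trans (∣∣-strict (∖⊆ S ⁅ v ⁆) v∈ v∉) (≤-pred lt)) ne
                        (lin 3 (λ x y z → (# 1 ≼ x) ∷ (x ≼ y ⊕ z) ∷ (# 1 ⊕ y ≼ # 1) ∷ [] ⊢ (# 1 ≼ z)) _ _ _ h (t-⁅⁆-split S v∈) (≰⇒> ¬p))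
      where
      v∉ : v ∉ S ∖ ⁅ v ⁆
      v∉ rewrite v∈ | ∈⁅⁆ v = refl
    ...     | w , w∈ , p = w , ∖⊆ S ⁅ v ⁆ w w∈ , p

    joins-inner : ∀ (B S : VSet n) → joins B S F ≡ cut S (inner B F)
    joins-inner B S = trans (sym (sum-filter (between B S) (inside B) F (λ (u , w) e → vanish (B u) (B w) (S u xor S w) e)))
      (sum-filter-cong (inside B) (λ (u , w) e → agree (B u) (B w) (S u xor S w) e) F)
      where
      vanish : ∀ a b c → a ∧ b ≡ false → ⟨ a ∧ b ∧ c ⟩ ≡ 0
      vanish true false c e = refl
      vanish false b c e = refl
      agree : ∀ a b c → a ∧ b ≡ true → ⟨ a ∧ b ∧ c ⟩ ≡ ⟨ c ⟩
      agree true true c e = refl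

    module _ {B : VSet n} {D : List (Edge n)} (o : outer B F ⊳ D) where

      private
        module I = Interior B F ρ P o

      cut-inner-∖ : ∀ S → cut (B ∖ S) I.F′ ≡ cut S I.F′
      cut-inner-∖ S = sum-filter-cong (inside B) (λ (u , w) e → agree (B u) (B w) (S u) (S w) e) F
        where
        agree : ∀ a b c d → a ∧ b ≡ true → ⟨ (a ∧ not c) xor (b ∧ not d) ⟩ ≡ ⟨ c xor d ⟩
        agree true true true true e = refl
        agree true true true false e = refl
        agree true true false true e = refl
        agree true true false false e = refl

      cnt-B : cnt B I.P′ ≡ d B
      cnt-B = trans (I.cnt′ B (λ _ e → e)) (cong (_+ cnt B P) (trans (sym (cong (_+ cut B (outer B F)) I.inner-0)) (I.cut-parts B)))

      -- After the cut, the `d B` edges at B are all tip edges. Those not at S, together with the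
      -- inner edges that S cuts, make up the degree of the complement of S in B. So tallness of S
      -- turns into a lower bound on the degree of the part that contains the root.
      complement : ∀ S → S ⊆ B → cnt S I.P′ + d (B ∖ S) ≡ cut S I.F′ + d B
      complement S h = lin 8 (λ c' cT' p' pT' dT dB pB z → (pB ≈ dB) ∷ (p' ⊕ pT' ≈ pB) ∷ (cT' ≈ c') ∷ (cT' ⊕ pT' ≈ dT) ∷ [] ⊢ (p' ⊕ dT ≈ c' ⊕ dB))
        (cut S I.F′) (cut (B ∖ S) I.F′) (cnt S I.P′) (cnt (B ∖ S) I.P′) (d (B ∖ S)) (d B) (cnt B I.P′) 0
        cnt-B (trans (cong (_+ cnt (B ∖ S) I.P′) (sym (cnt-cong (∩-⊆ B S h) I.P′))) (cnt-split B S I.P′)) (cut-inner-∖ S) (I.deg′ (B ∖ S) (∖⊆ B S))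

      Loose : VSet n → Set
      Loose S = d B ≤ d (B ∖ S) + 1 ⊎ (d B ≤ d (B ∖ S) + 2 × Mixed I.P′ S)

      inside-inst : ∀ {r} → r ∈ B → (∀ S → S ⊆ B → r ∉ S → Nonempty S → Tame F ρ P S) →
        (∀ S → S ⊆ B → r ∉ S → Nonempty S → Loose S) → Inst (B ∖ ⁅ r ⁆) I.F′ I.ρ′ I.P′
      inside-inst {r} r∈B tame loose S S⊆ ne = good (I.Tame′ S S⊆B (tame S S⊆B r∉S ne)) (tall (loose S S⊆B r∉S ne))
        where
        S⊆B : S ⊆ B
        S⊆B v v∈ = ∖⊆ B ⁅ r ⁆ v (S⊆ v v∈)
        r∉S : r ∉ S
        r∉S = ⊆-false S⊆ r (trans (cong (λ b → B r ∧ not b) (∈⁅⁆ r)) (∧-false (B r)))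
          where
          ∧-false : ∀ b → b ∧ false ≡ false
          ∧-false true = refl
          ∧-false false = refl
        tall : Loose S → Tall I.F′ I.P′ S
        tall (inj₁ h) = lin 4 (λ p c dT dB → (p ⊕ dT ≈ c ⊕ dB) ∷ (dB ≼ dT ⊕ # 1) ∷ [] ⊢ (p ≼ c ⊕ # 2)) _ _ _ _ (complement S S⊆B) h ,
          λ e → ⊥-elim (lin 4 (λ p c dT dB → (p ⊕ dT ≈ c ⊕ dB) ∷ (dB ≼ dT ⊕ # 1) ∷ (p ≈ c ⊕ # 2) ∷ [] ⊢ absurd) _ _ _ _ (complement S S⊆B) h e)
        tall (inj₂ (h , mixed)) = lin 4 (λ p c dT dB → (p ⊕ dT ≈ c ⊕ dB) ∷ (dB ≼ dT ⊕ # 2) ∷ [] ⊢ (p ≼ c ⊕ # 2)) _ _ _ _ (complement S S⊆B) h , λ _ → mixed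

  ∪-disjoint-cut : ∀ (S B : VSet n) F → (∀ v → v ∈ S → v ∉ B) →
    cut S F + cut B F ≡ cut (S ∪ B) F + (cut S (outer (∁ B) F) + cut S (outer (∁ B) F))
  ∪-disjoint-cut S B F h = trans (sym (sum-+ (crossing S) (crossing B) F)) (trans (sum-cong pointwise F)
    (trans (sum-+ (crossing (S ∪ B)) (λ e → half e + half e) F) (cong (cut (S ∪ B) F +_) (trans (sum-+ half half F) (cong₂ _+_ total total)))))
    where
    half : Edge n → ℕ
    half e = ⟨ not (inside (∁ B) e) ∧ (S (proj₁ e) xor S (proj₂ e)) ⟩
    total : sum half F ≡ cut S (outer (∁ B) F)
    total = trans (sym (sum-filter half (not ∘ inside (∁ B)) F (λ e eq → cong (λ b → ⟨ b ∧ (S (proj₁ e) xor S (proj₂ e)) ⟩) eq)))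
      (sum-filter-cong (not ∘ inside (∁ B)) (λ e eq → cong (λ b → ⟨ b ∧ (S (proj₁ e) xor S (proj₂ e)) ⟩) eq) F)
    table : ∀ s s' b b' → (s ≡ true → b ≡ false) → (s' ≡ true → b' ≡ false) →
      ⟨ s xor s' ⟩ + ⟨ b xor b' ⟩ ≡ ⟨ (s ∨ b) xor (s' ∨ b') ⟩ + (⟨ not (not b ∧ not b') ∧ (s xor s') ⟩ + ⟨ not (not b ∧ not b') ∧ (s xor s') ⟩)
    table true s' true b' h k with () ← h refl
    table s true b true h k with () ← k refl
    table true true false false h k = refl
    table true false false true h k = refl
    table true false false false h k = refl
    table false true true false h k = refl
    table false true false false h k = refl
    table false false true true h k = refl
    table false false true false h k = refl
    table false false false true h k = refl
    table false false false false h k = refl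
    pointwise : ∀ e → crossing S e + crossing B e ≡ crossing (S ∪ B) e + (half e + half e)
    pointwise (u , w) = table (S u) (S w) (B u) (B w) (h u) (h w)

  ∪-disjoint-cnt : ∀ (S B : VSet n) P → (∀ v → v ∈ S → v ∉ B) → cnt (S ∪ B) P ≡ cnt S P + cnt B P
  ∪-disjoint-cnt S B P h = trans (sum-cong (λ (v , _) → table (S v) (B v) (h v)) P) (sum-+ (at S) (at B) P)
    where
    table : ∀ s b → (s ≡ true → b ≡ false) → ⟨ s ∨ b ⟩ ≡ ⟨ s ⟩ + ⟨ b ⟩
    table true true h with () ← h refl
    table true false h = refl
    table false b h = refl

  -- If B has at least as many tip edges as cut edges, orienting the edges at B and deleting B leaves
  -- an easel with the same root.
  outside-inst : ∀ {W B : VSet n} F ρ P {D} (o : outer (∁ B) F ⊳ D) →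
    (∀ S → S ⊆ W ∖ B → Nonempty S → Tame F ρ P S) →
    cut B F ≤ cnt B P →
    (∀ S → S ⊆ W ∖ B → Nonempty S → cnt (S ∪ B) P ≤ cut (S ∪ B) F + 2) →
    (∀ S → S ⊆ W ∖ B → Nonempty S → cnt B P ≡ cut B F → cnt (S ∪ B) P ≡ cut (S ∪ B) F + 2 → Mixed P S) →
    let module I = Interior (∁ B) F ρ P o in Inst (W ∖ B) I.F′ I.ρ′ I.P′
  outside-inst {W} {B} F ρ P o tame B≥ tall mixed S S⊆ ne = good (I.Tame′ S S⊆∁ (tame S S⊆ ne)) (
    lin 10 (λ p p' c c' e pB cB pU cU z → (c' ⊕ e ≈ c) ∷ (p' ≈ e ⊕ p) ∷ (c ⊕ cB ≈ cU ⊕ (e ⊕ e)) ∷ (pU ≈ p ⊕ pB) ∷ (cB ≼ pB) ∷ (pU ≼ cU ⊕ # 2) ∷ []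
        ⊢ (p' ≼ c' ⊕ # 2)) _ _ _ _ _ _ _ _ _ 0 (I.cut-parts S) (I.cnt′ S S⊆∁) cutU cntU B≥ (tall S S⊆ ne) ,
    λ eq → I.Mixed′ S S⊆∁ (mixed S S⊆ ne
      (lin 10 (λ p p' c c' e pB cB pU cU z → (c' ⊕ e ≈ c) ∷ (p' ≈ e ⊕ p) ∷ (c ⊕ cB ≈ cU ⊕ (e ⊕ e)) ∷ (pU ≈ p ⊕ pB) ∷ (cB ≼ pB) ∷ (pU ≼ cU ⊕ # 2) ∷ (p' ≈ c' ⊕ # 2) ∷ []
        ⊢ (pB ≈ cB)) _ _ _ _ _ _ _ _ _ 0 (I.cut-parts S) (I.cnt′ S S⊆∁) cutU cntU B≥ (tall S S⊆ ne) eq)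
      (lin 10 (λ p p' c c' e pB cB pU cU z → (c' ⊕ e ≈ c) ∷ (p' ≈ e ⊕ p) ∷ (c ⊕ cB ≈ cU ⊕ (e ⊕ e)) ∷ (pU ≈ p ⊕ pB) ∷ (cB ≼ pB) ∷ (pU ≼ cU ⊕ # 2) ∷ (p' ≈ c' ⊕ # 2) ∷ []
        ⊢ (pU ≈ cU ⊕ # 2)) _ _ _ _ _ _ _ _ _ 0 (I.cut-parts S) (I.cnt′ S S⊆∁) cutU cntU B≥ (tall S S⊆ ne) eq)))
    where
    module I = Interior (∁ B) F ρ P o
    S⊆∁ : S ⊆ ∁ B
    S⊆∁ v v∈ = cong not (∖∉ W B v (S⊆ v v∈))
    cutU = ∪-disjoint-cut S B F (λ v v∈ → ∖∉ W B v (S⊆ v v∈))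
    cntU = ∪-disjoint-cnt S B P (λ v v∈ → ∖∉ W B v (S⊆ v v∈))

-- Replacement of edge lists: picking, lifting, and the star of a vertex.

module _ {n : ℕ} where

  Good-transport : ∀ F F′ ρ ρ′ P P′ (S S′ : VSet n) → cut S′ F′ ≡ cut S F → cnt S′ P′ ≡ cnt S P →
    (∀ s → sgn s S′ P′ ≡ sgn s S P) → bd S′ ρ′ P′ ≡ bd S ρ P → Good F ρ P S → Good F′ ρ′ P′ S′
  Good-transport F F′ ρ ρ′ P P′ S S′ c p s b (good tame (tall , mixed)) = good
    (subst₂ (λ d b → 4 + τ d b ≤ d) (sym (cong₂ _+_ c p)) (sym b) tame) (
    subst₂ (λ c p → p ≤ c + 2) (sym c) (sym p) tall ,
    λ eq s' → subst (1 ≤_) (sym (s s')) (mixed (trans (sym p) (trans eq (cong (_+ 2) c))) s'))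

  edgeMap : (Fin n → Fin n) → Edge n → Edge n
  edgeMap f (u , w) = f u , f w

  ⊳-map : ∀ f F {D′ : List (Edge n)} → map (edgeMap f) F ⊳ D′ → ∃[ D ] F ⊳ D × D′ ≡ map (edgeMap f) D
  ⊳-map f [] [] = [] , [] , refl
  ⊳-map f ((u , w) ∷ F) (keep o) with ⊳-map f F o
  ... | D , o′ , refl = (u , w) ∷ D , keep o′ , refl
  ⊳-map f ((u , w) ∷ F) (flip o) with ⊳-map f F o
  ... | D , o′ , refl = (w , u) ∷ D , flip o′ , refl

module _ {n : ℕ} where

  infix 4 _⇛_
  -- Only the nets of sets enter a flow, so a flow of G gives one of F with the same charges, even
  -- when F has more edges, as after lifting.
  _⇛_ : List (Edge n) → List (Edge n) → Set
  F ⇛ G = ∀ {D′} → G ⊳ D′ → ∃[ D ] F ⊳ D × (∀ S → net S D ≡ net S D′)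

  ⇛-refl : ∀ {F} → F ⇛ F
  ⇛-refl o = _ , o , λ S → refl

  ⇛-trans : ∀ {F G H} → F ⇛ G → G ⇛ H → F ⇛ H
  ⇛-trans f g o with g o
  ... | D , o₁ , h with f o₁
  ...   | D₂ , o₂ , h₂ = D₂ , o₂ , λ S → trans (h₂ S) (h S)

  ⇛-cons : ∀ {F G} e → F ⇛ G → e ∷ F ⇛ e ∷ G
  ⇛-cons (u , w) f (keep o) with f o
  ... | D , o₁ , h = _ , keep o₁ , λ S → cong (arc S (u , w) +₃_) (h S)
  ⇛-cons (u , w) f (flip o) with f o
  ... | D , o₁ , h = _ , flip o₁ , λ S → cong (arc S (w , u) +₃_) (h S)

  ⇛-pick : ∀ {u w F F′} → PickE u w F F′ → F ⇛ (u , w) ∷ F′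
  ⇛-pick p (keep o) with ⊳-pickE p o
  ... | D , o₁ , q = D , o₁ , λ S → sum₃-pick (arc S) q
  ⇛-pick p (flip o) with ⊳-pickE (PickE-sym p) o
  ... | D , o₁ , q = D , o₁ , λ S → sum₃-pick (arc S) q

  ⇛-swap : ∀ {e e′ F} → e ∷ e′ ∷ F ⇛ e′ ∷ e ∷ F
  ⇛-swap {e} {e′} {F} = ⇛-pick {u = proj₁ e′} {w = proj₂ e′} (inj₁ (there here))

  -- A directed path u, v, w through v carries what an edge from u to w carries.
  ⇛-lift : ∀ {v u w F} → (v , u) ∷ (v , w) ∷ F ⇛ (u , w) ∷ F
  ⇛-lift {v} {u} {w} (keep {D = D} o) = _ , flip (keep o) , λ S → table (S u) (S v) (S w) (net S D)
    where
    table : ∀ a b c x → (a ⋆ 2₃ +₃ b ⋆ 1₃) +₃ ((b ⋆ 2₃ +₃ c ⋆ 1₃) +₃ x) ≡ (a ⋆ 2₃ +₃ c ⋆ 1₃) +₃ x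
    table = from-yes (∀Bool? λ a → ∀Bool? λ b → ∀Bool? λ c → all? λ x →
      ((a ⋆ 2₃ +₃ b ⋆ 1₃) +₃ ((b ⋆ 2₃ +₃ c ⋆ 1₃) +₃ x)) ≟ ((a ⋆ 2₃ +₃ c ⋆ 1₃) +₃ x))
  ⇛-lift {v} {u} {w} (flip {D = D} o) = _ , keep (flip o) , λ S → table (S u) (S v) (S w) (net S D)
    where
    table : ∀ a b c x → (b ⋆ 2₃ +₃ a ⋆ 1₃) +₃ ((c ⋆ 2₃ +₃ b ⋆ 1₃) +₃ x) ≡ (c ⋆ 2₃ +₃ a ⋆ 1₃) +₃ x
    table = from-yes (∀Bool? λ a → ∀Bool? λ b → ∀Bool? λ c → all? λ x →
      ((b ⋆ 2₃ +₃ a ⋆ 1₃) +₃ ((c ⋆ 2₃ +₃ b ⋆ 1₃) +₃ x)) ≟ ((c ⋆ 2₃ +₃ a ⋆ 1₃) +₃ x))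

  Flow-⇛ : ∀ {W : VSet n} {F G ρ} → F ⇛ G → Flow W G ρ → Flow W F ρ
  Flow-⇛ {ρ = ρ} f (D , o , bal) with f o
  ... | D₁ , o₁ , h = D₁ , o₁ , λ S S⊆ → balanced (trans (cong (_+₃ ev S ρ) (h S)) (balance (bal S S⊆)))

  Flow-orient : ∀ {W : VSet n} {F ρ u w} → Flow W F ((u , 2₃) ∷ (w , 1₃) ∷ ρ) → Flow W ((u , w) ∷ F) ρ
  Flow-orient {ρ = ρ} {u} {w} (D , o , bal) = _ , keep o , λ S S⊆ →
    balanced (trans (table (S u) (S w) (net S D) (ev S ρ)) (balance (bal S S⊆)))
    where
    table : ∀ a b x y → ((a ⋆ 2₃ +₃ b ⋆ 1₃) +₃ x) +₃ y ≡ x +₃ (a ⋆ 2₃ +₃ (b ⋆ 1₃ +₃ y))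
    table = from-yes (∀Bool? λ a → ∀Bool? λ b → all? λ x → all? λ y →
      (((a ⋆ 2₃ +₃ b ⋆ 1₃) +₃ x) +₃ y) ≟ (x +₃ (a ⋆ 2₃ +₃ (b ⋆ 1₃ +₃ y))))

  Flow-orient′ : ∀ {W : VSet n} {F ρ u w} → Flow W F ((u , 1₃) ∷ (w , 2₃) ∷ ρ) → Flow W ((u , w) ∷ F) ρ
  Flow-orient′ {ρ = ρ} {u} {w} (D , o , bal) = _ , flip o , λ S S⊆ →
    balanced (trans (table (S u) (S w) (net S D) (ev S ρ)) (balance (bal S S⊆)))
    where
    table : ∀ a b x y → ((b ⋆ 2₃ +₃ a ⋆ 1₃) +₃ x) +₃ y ≡ x +₃ (a ⋆ 1₃ +₃ (b ⋆ 2₃ +₃ y))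
    table = from-yes (∀Bool? λ a → ∀Bool? λ b → all? λ x → all? λ y →
      (((b ⋆ 2₃ +₃ a ⋆ 1₃) +₃ x) +₃ y) ≟ (x +₃ (a ⋆ 1₃ +₃ (b ⋆ 2₃ +₃ y))))

  net-uncut : ∀ (S : VSet n) {F D} → F ⊳ D → cut S F ≡ 0 → net S D ≡ 0₃
  net-uncut S [] e = refl
  net-uncut S (keep {u} {w} {D = D} o) e with S u | S w
  ... | true | true = trans (+₃-identityˡ (net S D)) (net-uncut S o e)
  ... | false | false = trans (+₃-identityˡ (net S D)) (net-uncut S o e)
  net-uncut S (flip {u} {w} {D = D} o) e with S u | S w
  ... | true | true = trans (+₃-identityˡ (net S D)) (net-uncut S o e)
  ... | false | false = trans (+₃-identityˡ (net S D)) (net-uncut S o e)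

  Flow-isolated : ∀ {W : VSet n} {F ρ} v → cut ⁅ v ⁆ F ≡ 0 → ev ⁅ v ⁆ ρ ≡ 0₃ → Flow (W ∖ ⁅ v ⁆) F ρ → Flow W F ρ
  Flow-isolated {W} {F} {ρ} v c e (D , o , bal) = D , o , λ S S⊆ → Balanced-split S ⁅ v ⁆ D ρ (single S)
      (bal (S ∖ ⁅ v ⁆) (λ w w∈ → ∈∖ W ⁅ v ⁆ w (S⊆ w (∖⊆ S ⁅ v ⁆ w w∈)) (∖∉ S ⁅ v ⁆ w w∈)))
    where
    single : ∀ S → Balanced (S ∩ ⁅ v ⁆) D ρ
    single S with decide-∈ S v
    ... | inj₁ v∈ = Balanced-cong (λ w → sym (∩-⊆ S ⁅ v ⁆ (⁅⁆⊆ S v∈) w)) (balanced (cong₂ _+₃_ (net-uncut ⁅ v ⁆ o c) e))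
    ... | inj₂ v∉ = balanced (cong₂ _+₃_ (trans (net-cong none D) (sum₃-0 (λ _ → refl) D)) (trans (ev-cong none ρ) (sum₃-0 (λ _ → refl) ρ)))
      where
      none : (S ∩ ⁅ v ⁆) ≗ (λ _ → false)
      none w with v ≟ w
      ... | yes refl rewrite v∉ = refl
      ... | no _ with S w
      ...   | true = refl
      ...   | false = refl

  -- The edges at v are kept as the list of their other ends, so that parallel edges stay
  -- distinguishable and a pairing is changed by permuting the list.
  record Star (v : Fin n) (us : List (Fin n)) (F F₀ : List (Edge n)) : Set where
    field
      simulates : F ⇛ map (v ,_) us ++ F₀
      cuts : ∀ S → cut S F ≡ sum (λ u → crossing S (v , u)) us + cut S F₀
      proper : All (v ≢_) us
      size-star : length F ≡ length us + length F₀
      bare : cut ⁅ v ⁆ F₀ ≡ 0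

  open Star public

  star : ∀ v k (F : List (Edge n)) → cut ⁅ v ⁆ F ≡ k → ∃[ us ] ∃[ F₀ ] length us ≡ k × Star v us F F₀
  star v zero F e = [] , F , refl , record { simulates = ⇛-refl ; cuts = λ S → refl ; proper = [] ; size-star = refl ; bare = e }
  star v (suc k) F e with crossing-edge ⁅ v ⁆ F (subst (1 ≤_) (sym e) (s≤s z≤n))
  ... | u , w , F′ , p , u∈ , w∉ with ∈⁅⁆⇒≡ v u u∈
  ...   | refl with star v k F′ (suc-injective (trans (sym (trans (cut-pickE ⁅ v ⁆ p) (cong₂ (λ a b → ⟨ a xor b ⟩ + cut ⁅ v ⁆ F′) u∈ w∉))) e))
  ...     | us , F₀ , len , s = w ∷ us , F₀ , cong suc len , record
    { simulates = ⇛-trans (⇛-pick p) (⇛-cons (v , w) (simulates s))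
    ; cuts = λ S → trans (cut-pickE S p) (trans (cong (crossing S (v , w) +_) (cuts s S)) (sym (+-assoc (crossing S (v , w)) _ _)))
    ; proper = (λ { refl → true≢false u∈ w∉ }) ∷ proper s
    ; size-star = trans (length-pickE p) (cong suc (size-star s))
    ; bare = bare s }

  sum-↭ : ∀ {A : Set} (f : A → ℕ) {k l} → k ↭ l → sum f k ≡ sum f l
  sum-↭ f ↭.refl = refl
  sum-↭ f (↭.prep x p) = cong (f x +_) (sum-↭ f p)
  sum-↭ f {l = _ ∷ _ ∷ l} (↭.swap x y p) = trans (cong (λ k → f x + (f y + k)) (sum-↭ f p))
    (trans (sym (+-assoc (f x) (f y) _)) (trans (cong (_+ sum f l) (+-comm (f x) (f y))) (+-assoc (f y) (f x) _)))
  sum-↭ f (↭.trans p q) = trans (sum-↭ f p) (sum-↭ f q)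

  ⇛-↭ : ∀ {us vs F} (v : Fin n) → us ↭ vs → map (v ,_) us ++ F ⇛ map (v ,_) vs ++ F
  ⇛-↭ v ↭.refl = ⇛-refl
  ⇛-↭ v (↭.prep x p) = ⇛-cons (v , x) (⇛-↭ v p)
  ⇛-↭ v (↭.swap x y p) = ⇛-trans ⇛-swap (⇛-cons (v , y) (⇛-cons (v , x) (⇛-↭ v p)))
  ⇛-↭ v (↭.trans p q) = ⇛-trans (⇛-↭ v p) (⇛-↭ v q)

  star-↭ : ∀ {v us vs F F₀} → us ↭ vs → Star v us F F₀ → Star v vs F F₀
  star-↭ {v} {F₀ = F₀} p s = record
    { simulates = ⇛-trans (simulates s) (⇛-↭ v p)
    ; cuts = λ S → trans (cuts s S) (cong (_+ cut S F₀) (sum-↭ (λ u → crossing S (v , u)) p))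
    ; proper = All-resp-↭ p (proper s)
    ; size-star = trans (size-star s) (cong (_+ length F₀) (↭-length p))
    ; bare = bare s }

  tips-at : ∀ v k (P : List (Tip n)) → cnt ⁅ v ⁆ P ≡ suc k → ∃[ s ] ∃[ P′ ] Pick (v , s) P P′ × cnt ⁅ v ⁆ P′ ≡ k
  tips-at v k P e with sum-positive (at ⁅ v ⁆) P (subst (1 ≤_) (sym e) (s≤s z≤n))
  ... | (w , s) , P′ , p , h with ⁅ v ⁆ w in eq
  ...   | true with ∈⁅⁆⇒≡ v w eq
  ...     | refl = s , P′ , p , suc-injective (trans (sym (trans (sum-pick (at ⁅ v ⁆) p) (cong (λ b → ⟨ b ⟩ + cnt ⁅ v ⁆ P′) eq))) e)

  cut-∪-bare : ∀ (S : VSet n) v F → v ∉ S → cut ⁅ v ⁆ F ≡ 0 → cut (⁅ v ⁆ ∪ S) F ≡ cut S F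
  cut-∪-bare S v F v∉ e = lin 5 (λ cv cS cU o i → (cv ⊕ cS ≈ cU ⊕ (o ⊕ o)) ∷ (cv ≈ # 0) ∷ (i ⊕ o ≈ cv) ∷ [] ⊢ (cU ≈ cS))
    (cut ⁅ v ⁆ F) (cut S F) (cut (⁅ v ⁆ ∪ S) F) (cut ⁅ v ⁆ (outer (∁ S) F)) (cut ⁅ v ⁆ (inner (∁ S) F))
    (∪-disjoint-cut ⁅ v ⁆ S F λ w w∈ → subst (_∉ S) (∈⁅⁆⇒≡ v w w∈) v∉) e (sum-partition (crossing ⁅ v ⁆) (inside (∁ S)) F)

  Flow-sign : ∀ {W : VSet n} {F ρ u w} s → Flow W F ((u , q s) ∷ (w , q (not s)) ∷ ρ) → Flow W ((u , w) ∷ F) ρ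
  Flow-sign true = Flow-orient
  Flow-sign false = Flow-orient′

-- The induction step: consequences of the absence of a flow.

module Step {n : ℕ} (m : ℕ)
  (IH : ∀ (W : VSet n) F ρ P → size F P < m → Inst W F ρ P → ¬ ¬ Flow W F ρ)
  (W : VSet n) (F : List (Edge n)) (ρ : List (Charge n)) (P : List (Tip n))
  (sz : size F P < suc m) (inst : Inst W F ρ P) (noflow : ¬ Flow W F ρ) where

  d : VSet n → ℕ
  d S = deg S F P

  b : VSet n → Z3
  b S = bd S ρ P

  t : VSet n → ℕ
  t S = τ (d S) (b S)

  tame : ∀ S → S ⊆ W → Nonempty S → 4 + t S ≤ d S
  tame S h ne = isTame (inst S h ne)

  tall : ∀ S → S ⊆ W → Nonempty S → cnt S P ≤ cut S F + 2
  tall S h ne = proj₁ (isTall (inst S h ne))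

  mixed : ∀ S → S ⊆ W → Nonempty S → cnt S P ≡ cut S F + 2 → Mixed P S
  mixed S h ne = proj₂ (isTall (inst S h ne))

  smaller : ∀ W′ F′ ρ′ P′ → size F′ P′ < size F P → Inst W′ F′ ρ′ P′ → ¬ ¬ Flow W′ F′ ρ′
  smaller W′ F′ ρ′ P′ h = IH W′ F′ ρ′ P′ (≤-trans h (≤-pred sz))

  size-outer : ∀ K → 1 ≤ length (inner K F) → length (outer K F) < length F
  size-outer K h = lin 3 (λ i o f → (i ⊕ o ≈ f) ∷ (# 1 ≼ i) ∷ [] ⊢ (# 1 ⊕ o ≼ f)) _ _ _ (length-partition K F) h

  cut≤length : ∀ (S : VSet n) G → cut S G ≤ length G
  cut≤length S G = ≤-trans (sum-mono (λ (u , w) → ⟨⟩≤1 (S u xor S w)) G) (≤-reflexive (sum-1 G))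

  module _ {B : VSet n} {u : Fin n} (B⊆W : B ⊆ W) (u∈B : u ∈ B) where

    private
      f : Fin n → Fin n
      f w = if B w then u else w

      -- Contraction keeps the vertex type, so `n` need not vary in the induction: `f` moves B onto
      -- u, and the vertices that `f` moves drop out of W. A set S of the contraction corresponds to
      -- its preimage under `f`.
      W′ : VSet n
      W′ w = W w ∧ does (f w ≟ w)

      fixed : ∀ w → w ∈ W′ → f w ≡ w
      fixed w h with f w ≟ w | W w
      ... | yes eq | _ = eq
      ... | no _ | true = case h
        where
        case : false ≡ true → _
        case ()
      ... | no _ | false = case h
        where
        case : false ≡ true → _
        case ()

      W′⊆W : W′ ⊆ W
      W′⊆W w h with W w
      ... | true = refl

      in-W : ∀ S → S ⊆ W′ → S ∘ f ⊆ W
      in-W S h w e with B w in eq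
      ... | true = B⊆W w eq
      ... | false = W′⊆W w (h w e)

      undivided : ∀ (S : VSet n) e → not (inside B e) ≡ false → crossing (S ∘ f) e ≡ 0
      undivided S (v , w) e with B v | B w
      ... | true | true with S u
      ...   | true = refl
      ...   | false = refl

      F⁺ : List (Edge n)
      F⁺ = map (edgeMap f) (outer B F)

      ρ⁺ : List (Charge n)
      ρ⁺ = map (λ c → f (proj₁ c) , proj₂ c) ρ

      P⁺ : List (Tip n)
      P⁺ = map (λ p → f (proj₁ p) , proj₂ p) P

      transported : Inst W′ F⁺ ρ⁺ P⁺
      transported S h (v , v∈) = Good-transport F F⁺ ρ ρ⁺ P P⁺ (S ∘ f) S
        (trans (sum-map (crossing S) (edgeMap f) (outer B F)) (sum-filter (crossing (S ∘ f)) (not ∘ inside B) F (undivided S)))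
        (sum-map (at S) _ P)
        (λ s → sum-map (atSign s S) _ P)
        (cong₂ _+₃_ (sum₃-map (weigh S) _ ρ) (sum₃-map (pull S) _ P))
        (inst (S ∘ f) (in-W S h) (v , subst (_∈ S) (sym (fixed v (h v v∈))) v∈))

    contracted : 1 ≤ length (inner B F) → ¬ ¬ (∃[ D ] outer B F ⊳ D ×
      (∀ S → S ⊆ W → B ⊆ S ⊎ (∀ v → v ∈ S → v ∉ B) → Balanced S D ρ))
    contracted h k = smaller W′ F⁺ ρ⁺ P⁺ small transported λ { (D′ , o′ , bal) → result bal (⊳-map f (outer B F) o′) }
      where
      small : size F⁺ P⁺ < size F P
      small = lin 6 (λ o o' l p p' z → (o' ≈ o) ∷ (p' ≈ p) ∷ (# 1 ⊕ o ≼ l) ∷ [] ⊢ (# 1 ⊕ (o' ⊕ o' ⊕ p') ≼ l ⊕ l ⊕ p)) _ _ _ _ _ 0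
        (length-map (edgeMap f) (outer B F)) (length-map _ P) (size-outer B h)
      result : ∀ {D′} → (∀ S → S ⊆ W′ → Balanced S D′ ρ⁺) → ∃[ D ] outer B F ⊳ D × D′ ≡ map (edgeMap f) D → ⊥
      result bal (D , o , refl) = k (D , o , λ S S⊆W undiv → Balanced-cong (pulled S S⊆W undiv)
          (balanced (trans (cong₂ _+₃_ (sym (sum₃-map (arc (S ∩ W′)) (edgeMap f) D)) (sym (sum₃-map (weigh (S ∩ W′)) _ ρ))) (balance (bal (S ∩ W′) (∩⊆ʳ S W′))))))
        where
        pulled : ∀ S → S ⊆ W → B ⊆ S ⊎ (∀ v → v ∈ S → v ∉ B) → ((S ∩ W′) ∘ f) ≗ S
        pulled S S⊆W (inj₁ B⊆S) w with B w in eq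
        ... | true rewrite B⊆S u u∈B | B⊆S w eq | B⊆W u u∈B | u∈B with u ≟ u
        ...   | yes _ = refl
        ...   | no ≢ = ⊥-elim (≢ refl)
        pulled S S⊆W (inj₁ B⊆S) w | false rewrite eq with S w in eS
        ... | false = refl
        ... | true rewrite S⊆W w eS with w ≟ w
        ...   | yes _ = refl
        ...   | no ≢ = ⊥-elim (≢ refl)
        pulled S S⊆W (inj₂ dis) w with B w in eq
        ... | true = trans (cong (_∧ W′ u) u∉) (sym w∉)
          where
          u∉ : u ∉ S
          u∉ with decide-∈ S u
          ... | inj₁ e = ⊥-elim (true≢false u∈B (dis u e))
          ... | inj₂ e = e
          w∉ : w ∉ S
          w∉ with decide-∈ S w
          ... | inj₁ e = ⊥-elim (true≢false eq (dis w e))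
          ... | inj₂ e = e
        pulled S S⊆W (inj₂ dis) w | false rewrite eq with S w in eS
        ... | false = refl
        ... | true rewrite S⊆W w eS with w ≟ w
        ...   | yes _ = refl
        ...   | no ≢ = ⊥-elim (≢ refl)

  ∈-∖⁅⁆ : ∀ (B : VSet n) u v → u ≢ v → v ∈ B → v ∈ B ∖ ⁅ u ⁆
  ∈-∖⁅⁆ B u v ≢ v∈ = ∈∖ B ⁅ u ⁆ v v∈ (∉⁅⁆ u v ≢)

  ⊆-trans : ∀ {S R Q : VSet n} → S ⊆ R → R ⊆ Q → S ⊆ Q
  ⊆-trans h k v e = k v (h v e)

  tame-⁅⁆ : ∀ v → v ∈ W → 4 + t ⁅ v ⁆ ≤ d ⁅ v ⁆
  tame-⁅⁆ v v∈ = tame ⁅ v ⁆ (⁅⁆⊆ W v∈) (v , ∈⁅⁆ v)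

  module _ {B : VSet n} (B⊆W : B ⊆ W) (hi : d B ≤ 4 + t B) where

    -- Both u and the rest of B have degree at least 4 + τ. If B itself has at most 4 + τ,
    -- subadditivity leaves an excess of four, and each edge between the two parts accounts for two.
    joins≥2 : ∀ {u v} → u ∈ B → v ∈ B → u ≢ v → 2 ≤ joins B ⁅ u ⁆ F
    joins≥2 {u} {v} u∈ v∈ u≢v = lin 7 (λ du dr dB j tu tr tB → (du ⊕ dr ≈ dB ⊕ (j ⊕ j)) ∷ (dB ≼ # 4 ⊕ tB) ∷ (tB ≼ tu ⊕ tr) ∷ (# 4 ⊕ tu ≼ du) ∷ (# 4 ⊕ tr ≼ dr) ∷ [] ⊢ (# 2 ≼ j))
      _ _ _ _ _ _ _ (d-⁅⁆-split F ρ P B u∈) hi (t-⁅⁆-split F ρ P B u∈) (tame-⁅⁆ u (B⊆W u u∈))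
      (tame (B ∖ ⁅ u ⁆) (⊆-trans (∖⊆ B ⁅ u ⁆) B⊆W) (v , ∈-∖⁅⁆ B u v u≢v v∈))

    module _ {D : List (Edge n)} (o : outer B F ⊳ D) (bal : Balanced B D ρ) where

      private
        module I = Interior B F ρ P o

      sgn-total : sgn true B I.P′ + sgn false B I.P′ ≡ d B
      sgn-total = trans (cnt-sgn B I.P′) (cnt-B F ρ P o)

      bd-B : m₃ (sgn false B I.P′) +₃ (m₃ (sgn true B I.P′) +₃ m₃ (sgn true B I.P′)) ≡ b B
      bd-B = trans (sym (pulls-sgn B I.P′)) (trans (sym (+₃-identityˡ (pulls B I.P′)))
        (trans (cong (_+₃ pulls B I.P′) (sym (trans (ev-residue B D ρ) (balance bal)))) (I.bd′ B (λ _ e → e))))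

      signs-B : 6 ≤ d B → 1 ≤ sgn true B I.P′ × 1 ≤ sgn false B I.P′ × (d B ≤ sgn true B I.P′ + 2 ⊎ d B ≤ sgn false B I.P′ + 2)
      signs-B lo = subst (λ k → 1 ≤ i × 1 ≤ o′ × (k ≤ i + 2 ⊎ k ≤ o′ + 2)) sgn-total
        (signs i o′ (subst (6 ≤_) (sym sgn-total) lo)
          (subst₂ (λ k c → k ≤ 4 + τ k c) (sym sgn-total) (sym bd-B) hi))
        where
        i = sgn true B I.P′
        o′ = sgn false B I.P′

      -- This is `Loose` for the set of all vertices of B except r. For smaller sets the complement
      -- in B has a second vertex, and its degree is then large enough by recursion.
      Root : Fin n → Set
      Root r = d B ≤ d ⁅ r ⁆ + 1 ⊎ (d B ≤ d ⁅ r ⁆ + 2 × Mixed I.P′ (B ∖ ⁅ r ⁆))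

      sgn-⁅⁆-split : ∀ s {v} → v ∈ B → sgn s ⁅ v ⁆ I.P′ + sgn s (B ∖ ⁅ v ⁆) I.P′ ≡ sgn s B I.P′
      sgn-⁅⁆-split s {v} v∈ = trans (cong (_+ sgn s (B ∖ ⁅ v ⁆) I.P′) (sym (sgn-cong s (∩-⊆ B ⁅ v ⁆ (⁅⁆⊆ B v∈)) I.P′))) (sgn-split s B ⁅ v ⁆ I.P′)

      -- At least `d B` - 2 tip edges have sign s. The degree of u is at most `d B` - 2 and includes
      -- an inner edge, so u can have at most `d B` - 3 of them.
      major : ∀ s {u v} → u ∈ B → v ∈ B → u ≢ v → d B ≤ sgn s B I.P′ + 2 → ¬ d B ≤ d ⁅ u ⁆ + 1 → 1 ≤ sgn s (B ∖ ⁅ u ⁆) I.P′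
      major s {u} {v} u∈ v∈ u≢v big small = lin 7 (λ dB i iu ir du cu pu → (dB ≼ i ⊕ # 2) ∷ (iu ⊕ ir ≈ i) ∷ (du ⊕ # 2 ≼ dB) ∷ (cu ⊕ pu ≈ du) ∷ (iu ≼ pu) ∷ (# 1 ≼ cu) ∷ [] ⊢ (# 1 ≼ ir))
        (d B) (sgn s B I.P′) (sgn s ⁅ u ⁆ I.P′) (sgn s (B ∖ ⁅ u ⁆) I.P′) (d ⁅ u ⁆) (cut ⁅ u ⁆ I.F′) (cnt ⁅ u ⁆ I.P′)
        big (sgn-⁅⁆-split s u∈) (subst (_≤ d B) (sym (+-suc (d ⁅ u ⁆) 1)) (≰⇒> small)) (I.deg′ ⁅ u ⁆ (⁅⁆⊆ B u∈)) (sgn≤cnt s ⁅ u ⁆ I.P′)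
        (≤-trans (m≤n+m 1 1) (≤-trans (joins≥2 u∈ v∈ u≢v) (≤-reflexive (joins-inner F ρ P B ⁅ u ⁆))))

      -- The majority sign survives the removal of either vertex. An edge of the other sign lies
      -- outside u or, failing that, at u and hence outside v.
      root-of-two : ∀ s {u v} → u ∈ B → v ∈ B → u ≢ v → d B ≤ d ⁅ u ⁆ + 2 → d B ≤ d ⁅ v ⁆ + 2 →
        d B ≤ sgn s B I.P′ + 2 → 1 ≤ sgn (not s) B I.P′ → ∃[ r ] r ∈ B × Root r
      root-of-two s {u} {v} u∈ v∈ u≢v du dv big pos = go (d B ≤? d ⁅ u ⁆ + 1) (d B ≤? d ⁅ v ⁆ + 1) (1 ≤? sgn (not s) (B ∖ ⁅ u ⁆) I.P′)
        where
        go : Dec (d B ≤ d ⁅ u ⁆ + 1) → Dec (d B ≤ d ⁅ v ⁆ + 1) → Dec (1 ≤ sgn (not s) (B ∖ ⁅ u ⁆) I.P′) → ∃[ r ] r ∈ B × Root r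
        go (yes p) _ _ = u , u∈ , inj₁ p
        go (no _) (yes p) _ = v , v∈ , inj₁ p
        go (no ¬p) (no _) (yes k) = u , u∈ , inj₂ (du , both s (major s u∈ v∈ u≢v big ¬p) k)
        go (no _) (no ¬p) (no ¬k) = v , v∈ , inj₂ (dv , both s (major s v∈ u∈ (λ e → u≢v (sym e)) big ¬p)
          (lin 4 (λ ov or ou o → (ov ⊕ or ≈ o) ∷ (ov ≼ ou) ∷ (# 1 ⊕ ou ≼ # 1) ∷ (# 1 ≼ o) ∷ [] ⊢ (# 1 ≼ or))
            (sgn (not s) ⁅ v ⁆ I.P′) (sgn (not s) (B ∖ ⁅ v ⁆) I.P′) (sgn (not s) (B ∖ ⁅ u ⁆) I.P′) (sgn (not s) B I.P′)
            (sgn-⁅⁆-split (not s) v∈) (sgn-mono (not s) (⁅⁆⊆ (B ∖ ⁅ u ⁆) (∈-∖⁅⁆ B u v u≢v v∈)) I.P′) (≰⇒> ¬k) pos))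

      root-of-two′ : ∀ {u v} → u ∈ B → v ∈ B → u ≢ v → 6 ≤ d B → d B ≤ d ⁅ u ⁆ + 2 → d B ≤ d ⁅ v ⁆ + 2 → ∃[ r ] r ∈ B × Root r
      root-of-two′ u∈ v∈ u≢v lo du dv = go (signs-B lo)
        where
        go : _ → _
        go (i , o′ , inj₁ big) = root-of-two true u∈ v∈ u≢v du dv big o′
        go (i , o′ , inj₂ big) = root-of-two false u∈ v∈ u≢v du dv big i

      -- A vertex whose degree is within one of `d B` is a root whatever the signs, and of two
      -- vertices within two of it one can be chosen by signs. Up to `d B` = 6 this only takes
      -- degrees of at least 4. If `d B` = 7, then τ is 3 and some vertex w has nonzero τ; when its
      -- degree is only 5, its τ is 1, and a second such vertex remains in the rest.
      find-root : ∀ {u v} → u ∈ B → v ∈ B → u ≢ v → ∃[ r ] r ∈ B × Root r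
      find-root {u} {v} u∈ v∈ u≢v with d B ≤? 5 | d B ≤? 6
      ... | yes ≤5 | _ = u , u∈ , inj₁ (lin 3 (λ dB du tu → (dB ≼ # 5) ∷ (# 4 ⊕ tu ≼ du) ∷ [] ⊢ (dB ≼ du ⊕ # 1)) _ _ _ ≤5 (tame-⁅⁆ u (B⊆W u u∈)))
      ... | no ≰5 | yes ≤6 = root-of-two′ u∈ v∈ u≢v (≰⇒> ≰5) (six u u∈) (six v v∈)
        where
        six : ∀ w → w ∈ B → d B ≤ d ⁅ w ⁆ + 2
        six w w∈ = lin 3 (λ dB du tu → (dB ≼ # 6) ∷ (# 4 ⊕ tu ≼ du) ∷ [] ⊢ (dB ≼ du ⊕ # 2)) _ _ _ ≤6 (tame-⁅⁆ w (B⊆W w w∈))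
      ... | no ≰5 | no ≰6 with τ-witness F ρ P (suc ∣ B ∣) B ≤-refl (u , u∈) (lin 2 (λ dB tB → (dB ≼ # 4 ⊕ tB) ∷ (# 7 ≼ dB) ∷ [] ⊢ (# 1 ≼ tB)) _ _ hi (≰⇒> ≰6))
      ...   | w , w∈ , tw with 6 ≤? d ⁅ w ⁆
      ...     | yes big = w , w∈ , inj₁ (lin 3 (λ dB dw tB → (dB ≼ # 4 ⊕ tB) ∷ (tB ≼ # 3) ∷ (# 6 ≼ dw) ∷ [] ⊢ (dB ≼ dw ⊕ # 1)) _ _ _ hi (τ≤3 (d B) (b B)) big)
      ...     | no small with nonempty? (B ∖ ⁅ w ⁆)
      ...       | no none = ⊥-elim (lin 3 (λ dB dw z → (dw ≈ dB) ∷ (# 7 ≼ dB) ∷ (# 1 ⊕ dw ≼ # 6) ∷ [] ⊢ absurd) (d B) (d ⁅ w ⁆) 0 (deg-cong (alone B w∈ none) F P) (≰⇒> ≰6) (≰⇒> small))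
      ...       | yes ne with τ-witness F ρ P (suc ∣ B ∖ ⁅ w ⁆ ∣) (B ∖ ⁅ w ⁆) ≤-refl ne
                    (lin 5 (λ dB tB dw tw tr → (dB ≼ # 4 ⊕ tB) ∷ (# 7 ≼ dB) ∷ (# 4 ⊕ tw ≼ dw) ∷ (# 1 ⊕ dw ≼ # 6) ∷ (tB ≼ tw ⊕ tr) ∷ [] ⊢ (# 1 ≼ tr))
                      _ _ _ _ _ hi (≰⇒> ≰6) (tame-⁅⁆ w (B⊆W w w∈)) (≰⇒> small) (t-⁅⁆-split F ρ P B w∈))
      ...         | w′ , w′∈ , tw′ = root-of-two′ w∈ (∖⊆ B ⁅ w ⁆ w′ w′∈) w≢ (≰⇒> ≰5) (five w w∈ tw) (five w′ (∖⊆ B ⁅ w ⁆ w′ w′∈) tw′)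
        where
        w≢ : w ≢ w′
        w≢ refl = true≢false (∈⁅⁆ w) (∖∉ B ⁅ w ⁆ w w′∈)
        five : ∀ v → v ∈ B → 1 ≤ t ⁅ v ⁆ → d B ≤ d ⁅ v ⁆ + 2
        five v v∈ tv = lin 4 (λ dB tB dv tv → (dB ≼ # 4 ⊕ tB) ∷ (tB ≼ # 3) ∷ (# 4 ⊕ tv ≼ dv) ∷ (# 1 ≼ tv) ∷ [] ⊢ (dB ≼ dv ⊕ # 2)) _ _ _ _ hi (τ≤3 (d B) (b B)) (tame-⁅⁆ v (B⊆W v v∈)) tv

  -- Contract B, then extend the flow obtained into B; its part of the tip edges may exceed the
  -- degree of a vertex of B by at most two, so some vertex of B can serve as a root.
  roomy : ∀ k B → ∣ B ∣ < k → B ⊆ W → ∀ {u v} → u ∈ B → v ∈ B → u ≢ v → 6 + t B ≤ d B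
  roomy (suc k) B lt B⊆W {u} {v} u∈ v∈ u≢v with 6 + t B ≤? d B
  ... | yes p = p
  ... | no ¬p = ⊥-elim (contracted B⊆W u∈ inner≥1 λ { (D , o , bal) → extend o bal (find-root B⊆W hi o (bal B B⊆W (inj₁ (λ _ e → e))) u∈ v∈ u≢v) })
    where
    hi : d B ≤ 4 + t B
    hi = τ-gap≤ (d B) (b B) (≰⇒> ¬p)
    inner≥1 : 1 ≤ length (inner B F)
    inner≥1 = ≤-trans (m≤n+m 1 1) (≤-trans (joins≥2 B⊆W hi u∈ v∈ u≢v) (≤-trans (≤-reflexive (joins-inner F ρ P B ⁅ u ⁆)) (cut≤length ⁅ u ⁆ (inner B F))))
    cut≥1 : 1 ≤ cut B F
    cut≥1 = lin 3 (λ c p t → (p ≼ c ⊕ # 2) ∷ (# 4 ⊕ t ≼ c ⊕ p) ∷ [] ⊢ (# 1 ≼ c)) (cut B F) (cnt B P) (t B) (tall B B⊆W (u , u∈)) (tame B B⊆W (u , u∈))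
    extend : ∀ {D} (o : outer B F ⊳ D) (bal : ∀ S → S ⊆ W → B ⊆ S ⊎ (∀ v → v ∈ S → v ∉ B) → Balanced S D ρ) →
      ∃[ r ] r ∈ B × Root B⊆W hi o (bal B B⊆W (inj₁ (λ _ e → e))) r → ⊥
    extend {D} o bal (r , r∈ , root) = smaller (B ∖ ⁅ r ⁆) I.F′ I.ρ′ I.P′ (I.size′ (≤-trans cut≥1 (m≤m+n _ _)))
      (inside-inst F ρ P o r∈ (λ S S⊆ _ ne → tame S (⊆-trans S⊆ B⊆W) ne) loose)
      (λ fl → noflow (flow-in B⊆W r∈ o bal fl))
      where
      module I = Interior B F ρ P o
      loose : ∀ S → S ⊆ B → r ∉ S → Nonempty S → Loose F ρ P o S
      loose S S⊆ r∉ (s , s∈) with nonempty? ((B ∖ S) ∖ ⁅ r ⁆)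
      -- The complement of S in B has two vertices, so by recursion its degree is at least 6, while
      -- `d B` is at most 7.
      ... | yes (w , w∈) = inj₁ (lin 4 (λ dB tB dT tT → (dB ≼ # 4 ⊕ tB) ∷ (tB ≼ # 3) ∷ (# 6 ⊕ tT ≼ dT) ∷ [] ⊢ (dB ≼ dT ⊕ # 1)) _ _ _ _ hi (τ≤3 (d B) (b B))
        (roomy k (B ∖ S) (≤-trans (∣∣-strict (∖⊆ B S) (S⊆ s s∈) (∉∖ B S s s∈)) (≤-pred lt)) (⊆-trans (∖⊆ B S) B⊆W) r∈T (∖⊆ (B ∖ S) ⁅ r ⁆ w w∈) r≢w))
        where
        r∈T : r ∈ B ∖ S
        r∈T = ∈∖ B S r r∈ r∉
        r≢w : r ≢ w
        r≢w refl = true≢false (∈⁅⁆ r) (∖∉ (B ∖ S) ⁅ r ⁆ r w∈)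
      ... | no none = transfer root
        where
        eq : ⁅ r ⁆ ≗ (B ∖ S)
        eq = alone (B ∖ S) (∈∖ B S r r∈ r∉) none
        sub : B ∖ ⁅ r ⁆ ⊆ S
        sub v v∈ with decide-∈ S v
        ... | inj₁ e = e
        ... | inj₂ e = ⊥-elim (true≢false (trans (eq v) (∈∖ B S v (∖⊆ B ⁅ r ⁆ v v∈) e)) (∖∉ B ⁅ r ⁆ v v∈))
        transfer : Root B⊆W hi o (bal B B⊆W (inj₁ (λ _ e → e))) r → Loose F ρ P o S
        transfer (inj₁ h) = inj₁ (subst (λ k → d B ≤ k + 1) (deg-cong eq F P) h)
        transfer (inj₂ (h , m)) = inj₂ (subst (λ k → d B ≤ k + 2) (deg-cong eq F P) h , Mixed-mono sub I.P′ m)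

  roomy′ : ∀ B → B ⊆ W → ∀ {u v} → u ∈ B → v ∈ B → u ≢ v → 6 + t B ≤ d B
  roomy′ B = roomy (suc ∣ B ∣) B ≤-refl

  -- Contract the complement of B into the root, then delete B.
  separate : ∀ B → B ⊆ W → Nonempty B → Nonempty (W ∖ B) → cut B F ≤ cnt B P →
    (∀ S → S ⊆ W ∖ B → Nonempty S → cnt B P ≡ cut B F → cnt (S ∪ B) P ≡ cut (S ∪ B) F + 2 → Mixed P S) → ⊥
  separate B B⊆W ne@(u , u∈) (v , v∈) B≥ mix =
    smaller B (outer (∁ B) F) ρ P
      (lin 3 (λ o l p → (# 1 ⊕ o ≼ l) ∷ [] ⊢ (# 1 ⊕ (o ⊕ o ⊕ p) ≼ l ⊕ l ⊕ p)) _ _ _ (size-outer (∁ B) inner≥1))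
      (λ S S⊆ neS → Good-transport F (outer (∁ B) F) ρ ρ P P S S (sum-filter (crossing S) (not ∘ inside (∁ B)) F (λ e → off S S⊆ e)) refl (λ _ → refl) refl (inst S (⊆-trans S⊆ B⊆W) neS))
      λ { (D , o , bal) → delete o bal }
    where
    union : ∀ S → S ⊆ W ∖ B → S ∪ B ⊆ W
    union S h = ∪-⊆ S B W (λ w e → ∖⊆ W B w (h w e)) B⊆W
    off : ∀ S → S ⊆ B → ∀ e → not (inside (∁ B) e) ≡ false → crossing S e ≡ 0
    off S h (a , c) e with B a in ea | B c in ec
    ... | false | false rewrite ⊆-false h a ea | ⊆-false h c ec = refl
    v⊆ : ⁅ v ⁆ ⊆ W ∖ B
    v⊆ = ⁅⁆⊆ (W ∖ B) v∈
    -- If all edges of v went to B, adding v to B would raise the excess of tip edges over cut edges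
    -- by the whole degree of v, at least 4, from a value that is not negative; tallness allows only
    -- 2.
    inner≥1 : 1 ≤ length (inner (∁ B) F)
    inner≥1 = ≤-trans (lin 9 (λ cv cB cU e p pB pU t i → (cv ⊕ cB ≈ cU ⊕ (e ⊕ e)) ∷ (pU ≈ p ⊕ pB) ∷ (cB ≼ pB) ∷ (pU ≼ cU ⊕ # 2) ∷ (# 4 ⊕ t ≼ cv ⊕ p) ∷ (i ⊕ e ≈ cv) ∷ [] ⊢ (# 1 ≼ i))
        (cut ⁅ v ⁆ F) (cut B F) (cut (⁅ v ⁆ ∪ B) F) (cut ⁅ v ⁆ (outer (∁ B) F)) (cnt ⁅ v ⁆ P) (cnt B P) (cnt (⁅ v ⁆ ∪ B) P) (t ⁅ v ⁆) (cut ⁅ v ⁆ (inner (∁ B) F))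
        (∪-disjoint-cut ⁅ v ⁆ B F (λ w w∈ → ∖∉ W B w (v⊆ w w∈))) (∪-disjoint-cnt ⁅ v ⁆ B P (λ w w∈ → ∖∉ W B w (v⊆ w w∈))) B≥
        (tall (⁅ v ⁆ ∪ B) (union ⁅ v ⁆ v⊆) (v , ∈∪ˡ ⁅ v ⁆ B v (∈⁅⁆ v))) (tame-⁅⁆ v (∖⊆ W B v v∈)) (sum-partition (crossing ⁅ v ⁆) (inside (∁ B)) F))
      (cut≤length ⁅ v ⁆ (inner (∁ B) F))
    delete : ∀ {D} → outer (∁ B) F ⊳ D → (∀ S → S ⊆ B → Balanced S D ρ) → ⊥
    delete o bal = smaller (W ∖ B) I.F′ I.ρ′ I.P′ (I.size′ positive)
      (outside-inst F ρ P o (λ S S⊆ → tame S (⊆-trans S⊆ (∖⊆ W B))) B≥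
        (λ S S⊆ neS → tall (S ∪ B) (union S S⊆) (u , ∈∪ʳ S B u u∈)) mix)
      (λ fl → noflow (flow-out o bal fl))
      where
      module I = Interior (∁ B) F ρ P o
      positive : 1 ≤ cut (∁ B) F + cnt (∁ (∁ B)) P
      positive = subst (1 ≤_) (cong₂ _+_ (sum-cong (λ (a , c) → not-xor (B a) (B c)) F) (cnt-cong (λ a → not² (B a)) P)) (≤-trans (s≤s z≤n) (tame B B⊆W ne))
        where
        not-xor : ∀ a c → ⟨ a xor c ⟩ ≡ ⟨ not a xor not c ⟩
        not-xor true true = refl
        not-xor true false = refl
        not-xor false true = refl
        not-xor false false = refl
        not² : ∀ a → a ≡ not (not a)
        not² true = refl
        not² false = refl

  cnt≤cut : ∀ B → B ⊆ W → Nonempty B → Nonempty (W ∖ B) → cnt B P ≤ cut B F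
  cnt≤cut B B⊆W ne ne′ with cnt B P ≤? cut B F
  ... | yes p = p
  ... | no ¬p = ⊥-elim (separate B B⊆W ne ne′ (<⇒≤ (≰⇒> ¬p)) (λ S _ _ e _ → ⊥-elim (¬p (≤-reflexive e))))

  module _ {B : VSet n} (B⊆W : B ⊆ W) (ne : Nonempty B) (ne′ : Nonempty (W ∖ B)) (eq : cnt B P ≡ cut B F) where

    private
      exhausts : ∀ S → S ⊆ W ∖ B → cnt (S ∪ B) P ≡ cut (S ∪ B) F + 2 → (S ∪ B) ≗ W
      exhausts S S⊆ e = λ w → sym (≗-∖-empty W (S ∪ B) sub none w)
        where
        sub : S ∪ B ⊆ W
        sub = ∪-⊆ S B W (λ w h → ∖⊆ W B w (S⊆ w h)) B⊆W
        none : ¬ Nonempty (W ∖ (S ∪ B))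
        none ne″ = lin 2 (λ p c → (p ≈ c ⊕ # 2) ∷ (p ≼ c) ∷ [] ⊢ absurd) _ _ e (cnt≤cut (S ∪ B) sub (proj₁ ne , ∈∪ʳ S B (proj₁ ne) (proj₂ ne)) ne″)

    -- Only the demand for both signs can prevent the deletion of such a B, and it arises only when
    -- some union S ∪ B attains the bound of tallness. Proper subsets of W have no more tip edges
    -- than cut edges, so this union is W.
    cnt≡cut⇒tight : cnt W P ≡ cut W F + 2
    cnt≡cut⇒tight with cnt W P ℕ.≟ cut W F + 2
    ... | yes e = e
    ... | no ≢ = ⊥-elim (separate B B⊆W ne ne′ (≤-reflexive (sym eq)) λ S S⊆ _ _ e →
      ⊥-elim (≢ (trans (sym (cnt-cong (exhausts S S⊆ e) P)) (trans e (cong (_+ 2) (cut-cong (exhausts S S⊆ e) F))))))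

    -- When the demand for both signs arises, S contains all of W outside B; two signs there would
    -- meet it and let B be deleted.
    cnt≡cut⇒unmixed : ¬ Mixed P (W ∖ B)
    cnt≡cut⇒unmixed mix = separate B B⊆W ne ne′ (≤-reflexive (sym eq)) λ S S⊆ _ _ e → Mixed-mono (sub S S⊆ e) P mix
      where
      sub : ∀ S → S ⊆ W ∖ B → cnt (S ∪ B) P ≡ cut (S ∪ B) F + 2 → W ∖ B ⊆ S
      sub S S⊆ e w w∈ with ∪-elim S B w (trans (exhausts S S⊆ e w) (∖⊆ W B w w∈))
      ... | inj₁ h = h
      ... | inj₂ h = ⊥-elim (true≢false h (∖∉ W B w w∈))

  loneOr : ∀ {x} (S : VSet n) → S ⊆ W → x ∈ S → 6 + t S ≤ d S ⊎ ⁅ x ⁆ ≗ S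
  loneOr {x} S S⊆ x∈ with nonempty? (S ∖ ⁅ x ⁆)
  ... | yes (y , y∈) = inj₁ (roomy′ S S⊆ x∈ (∖⊆ S ⁅ x ⁆ y y∈) λ { refl → true≢false (∈⁅⁆ x) (∖∉ S ⁅ x ⁆ x y∈) })
  ... | no none = inj₂ (alone S x∈ none)

  Spare-at : Bool → Fin n → Set
  Spare-at s v = Spare s (d ⁅ v ⁆) (b ⁅ v ⁆)

  -- Only the singleton of x depends on the direction of the deleted edge; any larger set containing
  -- x is roomy.
  deletion-tame : ∀ x s S F′ ρ′ P′ → S ⊆ W → x ∈ S → Spare-at s x →
    d S ≡ suc (deg S F′ P′) → b S ≡ q s +₃ bd S ρ′ P′ → Tame F′ ρ′ P′ S
  deletion-tame x s S F′ ρ′ P′ S⊆ x∈ sp de be = go (loneOr S S⊆ x∈)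
    where
    go : 6 + t S ≤ d S ⊎ ⁅ x ⁆ ≗ S → Tame F′ ρ′ P′ S
    go (inj₁ roomy) = roomy-deletion s (deg S F′ P′) (bd S ρ′ P′) (subst₂ (λ k c → 6 + τ k c ≤ k) de be roomy)
    go (inj₂ eq) = spare-deletion s (deg S F′ P′) (bd S ρ′ P′)
      (subst₂ (Spare s) (trans (deg-cong eq F P) de) (trans (bd-cong eq ρ P) be) sp)

  strict-tall : ∀ F′ P′ (S : VSet n) → cnt S P′ ≤ cut S F′ + 1 → Tall F′ P′ S
  strict-tall F′ P′ S h = lin 2 (λ p c → (p ≼ c ⊕ # 1) ∷ [] ⊢ (p ≼ c ⊕ # 2)) (cnt S P′) (cut S F′) h ,
    λ e → ⊥-elim (lin 2 (λ p c → (p ≼ c ⊕ # 1) ∷ (p ≈ c ⊕ # 2) ∷ [] ⊢ absurd) (cnt S P′) (cut S F′) h e)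

  -- Tip edges affect a flow only through ρ. Forgetting one leaves the flow problem itself unchanged
  -- and alters only the degrees and boundaries in which tameness and tallness are measured.
  tip-deletion : ∀ {v s P′} → Pick (v , s) P P′ → Spare-at s v → ⊥
  tip-deletion {v} {s} {P′} p sp = smaller W F ρ P′
      (lin 3 (λ f p p' → (p ≈ # 1 ⊕ p') ∷ [] ⊢ (# 1 ⊕ (f ⊕ f ⊕ p') ≼ f ⊕ f ⊕ p)) (length F) (length P) (length P′) (length-pick p))
      reduced noflow
    where
    reduced : Inst W F ρ P′
    reduced S S⊆ ne with decide-∈ S v
    ... | inj₁ v∈ = good
        (deletion-tame v s S F ρ P′ S⊆ v∈ sp (trans (cong (cut S F +_) cnt-eq) (+-suc (cut S F) _))
          (trans (cong (ev S ρ +₃_) (trans (sum₃-pick (pull S) p) (cong (λ a → a ⋆ q s +₃ pulls S P′) v∈))) (+₃-swap (ev S ρ) (q s) (pulls S P′))))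
        (strict-tall F P′ S (lin 3 (λ p p' c → (p ≈ # 1 ⊕ p') ∷ (p ≼ c ⊕ # 2) ∷ [] ⊢ (p' ≼ c ⊕ # 1)) (cnt S P) (cnt S P′) (cut S F) cnt-eq (tall S S⊆ ne)))
      where
      cnt-eq : cnt S P ≡ suc (cnt S P′)
      cnt-eq = trans (sum-pick (at S) p) (cong (λ a → ⟨ a ⟩ + cnt S P′) v∈)
    ... | inj₂ v∉ = Good-transport F F ρ ρ P P′ S S refl
        (sym (trans (sum-pick (at S) p) (cong (λ a → ⟨ a ⟩ + cnt S P′) v∉)))
        (λ s′ → sym (trans (sum-pick (atSign s′ S) p) (cong (λ a → ⟨ a ∧ same s′ s ⟩ + sgn s′ S P′) v∉)))
        (cong (ev S ρ +₃_) (sym (trans (sum₃-pick (pull S) p) (trans (cong (λ a → a ⋆ q s +₃ pulls S P′) v∉) (+₃-identityˡ _)))))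
        (inst S S⊆ ne)

  -- Deleting an edge that is directed from u to w (s = true) or from w to u (s = false).
  edge-deletion : ∀ {u w F′} s → PickE u w F F′ → (u ∈ W → Spare-at (not s) u) → (w ∈ W → Spare-at s w) →
    (∀ S → S ⊆ W → Nonempty S → S u ≢ S w → cnt S P ≤ cut S F) → ⊥
  edge-deletion {u} {w} {F′} s p spu spw low = smaller W F′ ρ′ P
      (lin 3 (λ f f' p → (f ≈ # 1 ⊕ f') ∷ [] ⊢ (# 1 ⊕ (f' ⊕ f' ⊕ p) ≼ f ⊕ f ⊕ p)) (length F) (length F′) (length P) (length-pickE p))
      reduced (λ fl → noflow (Flow-⇛ (⇛-pick p) (Flow-sign s fl)))
    where
    ρ′ : List (Charge n)
    ρ′ = (u , q s) ∷ (w , q (not s)) ∷ ρ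
    cut-eq : ∀ S {a c} → S u ≡ a → S w ≡ c → cut S F ≡ ⟨ a xor c ⟩ + cut S F′
    cut-eq S e e′ = trans (cut-pickE S p) (cong₂ (λ a c → ⟨ a xor c ⟩ + cut S F′) e e′)
    ev-eq : ∀ S {a c} → S u ≡ a → S w ≡ c → bd S ρ′ P ≡ (a ⋆ q s +₃ (c ⋆ q (not s) +₃ ev S ρ)) +₃ pulls S P
    ev-eq S e e′ = cong₂ (λ a c → (a ⋆ q s +₃ (c ⋆ q (not s) +₃ ev S ρ)) +₃ pulls S P) e e′
    both-in : ∀ s x y → (q s +₃ (q (not s) +₃ x)) +₃ y ≡ x +₃ y
    both-in = from-yes (∀Bool? λ s → all? λ x → all? λ y → ((q s +₃ (q (not s) +₃ x)) +₃ y) ≟ (x +₃ y))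
    none-in : ∀ x y → (0₃ +₃ (0₃ +₃ x)) +₃ y ≡ x +₃ y
    none-in = from-yes (all? λ x → all? λ y → ((0₃ +₃ (0₃ +₃ x)) +₃ y) ≟ (x +₃ y))
    u-in : ∀ s x y → x +₃ y ≡ q (not s) +₃ ((q s +₃ (0₃ +₃ x)) +₃ y)
    u-in = from-yes (∀Bool? λ s → all? λ x → all? λ y → (x +₃ y) ≟ (q (not s) +₃ ((q s +₃ (0₃ +₃ x)) +₃ y)))
    w-in : ∀ s x y → x +₃ y ≡ q s +₃ ((0₃ +₃ (q (not s) +₃ x)) +₃ y)
    w-in = from-yes (∀Bool? λ s → all? λ x → all? λ y → (x +₃ y) ≟ (q s +₃ ((0₃ +₃ (q (not s) +₃ x)) +₃ y)))
    tall′ : ∀ S → cut S F ≡ 1 + cut S F′ → cnt S P ≤ cut S F → Tall F′ P S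
    tall′ S ce h = strict-tall F′ P S (lin 3 (λ c c' p → (c ≈ # 1 ⊕ c') ∷ (p ≼ c) ∷ [] ⊢ (p ≼ c' ⊕ # 1)) (cut S F) (cut S F′) (cnt S P) ce h)
    reduced : Inst W F′ ρ′ P
    reduced S S⊆ ne with decide-∈ S u | decide-∈ S w
    ... | inj₁ u∈ | inj₁ w∈ = Good-transport F F′ ρ ρ′ P P S S (sym (cut-eq S u∈ w∈)) refl (λ _ → refl)
      (trans (ev-eq S u∈ w∈) (both-in s (ev S ρ) (pulls S P))) (inst S S⊆ ne)
    ... | inj₂ u∉ | inj₂ w∉ = Good-transport F F′ ρ ρ′ P P S S (sym (cut-eq S u∉ w∉)) refl (λ _ → refl)
      (trans (ev-eq S u∉ w∉) (none-in (ev S ρ) (pulls S P))) (inst S S⊆ ne)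
    ... | inj₁ u∈ | inj₂ w∉ = good
      (deletion-tame u (not s) S F′ ρ′ P S⊆ u∈ (spu (S⊆ u u∈)) (cong (_+ cnt S P) (cut-eq S u∈ w∉))
        (trans (u-in s (ev S ρ) (pulls S P)) (cong (q (not s) +₃_) (sym (ev-eq S u∈ w∉)))))
      (tall′ S (cut-eq S u∈ w∉) (low S S⊆ ne λ e → true≢false u∈ (trans e w∉)))
    ... | inj₂ u∉ | inj₁ w∈ = good
      (deletion-tame w s S F′ ρ′ P S⊆ w∈ (spw (S⊆ w w∈)) (cong (_+ cnt S P) (cut-eq S u∉ w∈))
        (trans (w-in s (ev S ρ) (pulls S P)) (cong (q s +₃_) (sym (ev-eq S u∉ w∈)))))
      (tall′ S (cut-eq S u∉ w∈) (low S S⊆ ne λ e → true≢false w∈ (trans (sym e) u∉)))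

  mixed? : ∀ S → Dec (Mixed P S)
  mixed? S = ∀Bool? λ s → 1 ≤? sgn s S P

  -- Splitting off a vertex of degree 4 with boundary 0.

  module Split {v} (v∈W : v ∈ W) (dv : d ⁅ v ⁆ ≡ 4) (bv : b ⁅ v ⁆ ≡ 0₃) (rest : Nonempty (W ∖ ⁅ v ⁆)) where

    W⁻ : VSet n
    W⁻ = W ∖ ⁅ v ⁆

    module _ (S : VSet n) (S⊆ : S ⊆ W⁻) (ne : Nonempty S) where

      S⊆W : S ⊆ W
      S⊆W = ⊆-trans S⊆ (∖⊆ W ⁅ v ⁆)

      v∉S : v ∉ S
      v∉S = ⊆-false S⊆ v (v∉W⁻ (W v) (∈⁅⁆ v))
        where
        v∉W⁻ : ∀ {c} a → c ≡ true → a ∧ not c ≡ false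
        v∉W⁻ true refl = refl
        v∉W⁻ false e = refl

      -- After the splitting, S has either the degree it had, or that of S with v added, or two less
      -- than it had. Adding v does not change the boundary, since v has boundary 0, so tameness of
      -- both sets can be used.
      S⁺ : VSet n
      S⁺ = ⁅ v ⁆ ∪ S

      v∈W∖S : v ∈ W ∖ S
      v∈W∖S = ∈∖ W S v v∈W v∉S

      low : cnt S P ≤ cut S F
      low = cnt≤cut S S⊆W ne (v , v∈W∖S)

      S⁺⊆W : S⁺ ⊆ W
      S⁺⊆W = ∪-⊆ ⁅ v ⁆ S W (⁅⁆⊆ W v∈W) S⊆W

      ne⁺ : Nonempty S⁺
      ne⁺ = v , ∈∪ˡ ⁅ v ⁆ S v (∈⁅⁆ v)

      apart : ∀ w → w ∈ ⁅ v ⁆ → w ∉ S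
      apart w w∈ = subst (_∉ S) (∈⁅⁆⇒≡ v w w∈) v∉S

      cnt⁺ : cnt S⁺ P ≡ cnt ⁅ v ⁆ P + cnt S P
      cnt⁺ = ∪-disjoint-cnt ⁅ v ⁆ S P apart

      S⁺∩ : (S⁺ ∩ ⁅ v ⁆) ≗ ⁅ v ⁆
      S⁺∩ = ∩-⊆ S⁺ ⁅ v ⁆ (∈∪ˡ ⁅ v ⁆ S)

      S⁺∖ : (S⁺ ∖ ⁅ v ⁆) ≗ S
      S⁺∖ w with v ≟ w
      ... | yes refl = sym v∉S
      ... | no _ with S w
      ...   | true = refl
      ...   | false = refl

      b⁺ : b S⁺ ≡ b S
      b⁺ = trans (sym (bd-split S⁺ ⁅ v ⁆ ρ P)) (trans (cong₂ _+₃_ (trans (bd-cong S⁺∩ ρ P) bv) (bd-cong S⁺∖ ρ P)) (+₃-identityˡ (b S)))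

      sgn⁺ : ∀ s → sgn s S⁺ P ≡ sgn s ⁅ v ⁆ P + sgn s S P
      sgn⁺ s = trans (sym (sgn-split s S⁺ ⁅ v ⁆ P)) (cong₂ _+_ (sgn-cong s S⁺∩ P) (sgn-cong s S⁺∖ P))

      star-cut : ∀ {us F₀} → Star v us F F₀ → cut S F ≡ sum (λ u → ⟨ S u ⟩) us + cut S F₀
      star-cut {us} {F₀} st = trans (cuts st S) (cong (_+ cut S F₀) (sum-cong (λ u → cong (λ a → ⟨ a xor S u ⟩) v∉S) us))

      star-cut⁺ : ∀ {us F₀} → Star v us F F₀ → cut S⁺ F ≡ sum (λ u → ⟨ not (S u) ⟩) us + cut S F₀
      star-cut⁺ {us} {F₀} st = trans (cuts st S⁺) (cong₂ _+_ (far (proper st)) (cut-∪-bare S v F₀ v∉S (bare st)))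
        where
        far : ∀ {us} → All (v ≢_) us → sum (λ u → crossing S⁺ (v , u)) us ≡ sum (λ u → ⟨ not (S u) ⟩) us
        far [] = refl
        far (_∷_ {x = u} ≢ all) = cong₂ _+_ (cong₂ (λ a c → ⟨ (a ∨ S v) xor (c ∨ S u) ⟩) (∈⁅⁆ v) (∉⁅⁆ v u ≢)) (far all)

      same-tame : ∀ d′ → d′ ≡ d S → 4 + τ d′ (b S) ≤ d′
      same-tame d′ refl = tame S S⊆W ne

      merged-tame : ∀ d′ → d′ ≡ d S⁺ → 4 + τ d′ (b S) ≤ d′
      merged-tame d′ refl = subst (λ c → 4 + τ (d S⁺) c ≤ d S⁺) b⁺ (tame S⁺ S⁺⊆W ne⁺)

      lowered-tame : ∀ d′ → d S ≡ 2 + d′ → 6 + t S ≤ d S → 4 + τ d′ (b S) ≤ d′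
      lowered-tame d′ e h = ≤-pred (≤-pred (subst (λ k → 6 + k ≤ 2 + d′) (τ-suc² d′ (b S)) (subst (λ k → 6 + τ k (b S) ≤ k) e h)))

    off-⁅⁆ : ∀ {a c} → v ≢ a → v ≢ c → crossing ⁅ v ⁆ (a , c) ≡ 0
    off-⁅⁆ {a} {c} ≢a ≢c = cong₂ (λ x y → ⟨ x xor y ⟩) (∉⁅⁆ v a ≢a) (∉⁅⁆ v c ≢c)

    pulls-0 : ∀ {S : VSet n} Q → cnt S Q ≡ 0 → pulls S Q ≡ 0₃
    pulls-0 [] e = refl
    pulls-0 {S} ((u , s) ∷ Q) e with S u
    ... | false = trans (+₃-identityˡ _) (pulls-0 Q e)

    Pattern : (x y z w : Fin n) → VSet n → Set
    Pattern x y z w S = (S x ≡ true × S y ≡ true × S z ≡ false × S w ≡ false)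

    -- What is in the way when a pairing takes two edges off the cut of S. If S has as many tip
    -- edges as cut edges, it then attains the bound of tallness and needs both signs.
    Obstacle : VSet n → Set
    Obstacle S = d S < 6 + t S ⊎ (cnt S P ≡ cut S F × ¬ Mixed P S)

    -- v has four edges, to x, y, z and w, which are replaced by the edges xy and zw.
    module Four {x y z w F₀} (st : Star v (x ∷ y ∷ z ∷ w ∷ []) F F₀) (tipless : cnt ⁅ v ⁆ P ≡ 0)
      (clear : ∀ S → S ⊆ W⁻ → Nonempty S → Pattern x y z w S ⊎ Pattern z w x y S → Obstacle S → ⊥) where

      F′ : List (Edge n)
      F′ = (x , y) ∷ (z , w) ∷ F₀

      reduced : Inst W⁻ F′ ρ P
      reduced S S⊆ ne = by-case (S x) (S y) (S z) (S w) refl refl refl refl (star-cut S S⊆ ne st) (star-cut⁺ S S⊆ ne st) refl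
        where
        unchanged : cut S F′ ≡ cut S F → Good F′ ρ P S
        unchanged e = good (same-tame S S⊆ ne (deg S F′ P) (cong (_+ cnt S P) e))
          (strict-tall F′ P S (subst (λ c → cnt S P ≤ c + 1) (sym e) (≤-trans (low S S⊆ ne) (m≤m+n _ 1))))
        sgn-S : ∀ s → sgn s (S⁺ S S⊆ ne) P ≡ sgn s S P
        sgn-S s = trans (sgn⁺ S S⊆ ne s) (cong (_+ sgn s S P) (n≤0⇒n≡0 (≤-trans (sgn≤cnt s ⁅ v ⁆ P) (≤-reflexive tipless))))
        cnt-S : cnt (S⁺ S S⊆ ne) P ≡ cnt S P
        cnt-S = trans (cnt⁺ S S⊆ ne) (cong (_+ cnt S P) tipless)
        merged : cut S F′ ≡ cut (S⁺ S S⊆ ne) F → Good F′ ρ P S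
        merged e = good (merged-tame S S⊆ ne (deg S F′ P) (cong₂ _+_ e (sym cnt-S)))
          (subst₂ (λ p c → p ≤ c + 2) cnt-S (sym e) (tall _ (S⁺⊆W S S⊆ ne) (ne⁺ S S⊆ ne)) ,
           λ eq s → subst (1 ≤_) (sgn-S s) (mixed _ (S⁺⊆W S S⊆ ne) (ne⁺ S S⊆ ne) (trans cnt-S (trans eq (cong (_+ 2) e))) s))
        lowered : Pattern x y z w S ⊎ Pattern z w x y S → cut S F ≡ 2 + cut S F′ → Good F′ ρ P S
        lowered pat e = good (lowered-tame S S⊆ ne (deg S F′ P) (cong (_+ cnt S P) e) (≮⇒≥ λ lt → clear S S⊆ ne pat (inj₁ lt)))
          (subst (cnt S P ≤_) (trans e (+-comm 2 _)) (low S S⊆ ne) , λ eq → is-mixed (mixed? S) (trans eq (trans (+-comm _ 2) (sym e))))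
          where
          is-mixed : Dec (Mixed P S) → cnt S P ≡ cut S F → Mixed P S
          is-mixed (yes m) _ = m
          is-mixed (no ¬m) eq = ⊥-elim (clear S S⊆ ne pat (inj₂ (eq , ¬m)))
        by-case : ∀ a c e f → S x ≡ a → S y ≡ c → S z ≡ e → S w ≡ f →
          cut S F ≡ (⟨ a ⟩ + (⟨ c ⟩ + (⟨ e ⟩ + (⟨ f ⟩ + 0)))) + cut S F₀ →
          cut (S⁺ S S⊆ ne) F ≡ (⟨ not a ⟩ + (⟨ not c ⟩ + (⟨ not e ⟩ + (⟨ not f ⟩ + 0)))) + cut S F₀ →
          cut S F′ ≡ ⟨ a xor c ⟩ + (⟨ e xor f ⟩ + cut S F₀) → Good F′ ρ P S
        -- With at least three neighbours in S, the two new edges cross S as often as the four old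
        -- ones would if v belonged to S.
        by-case true true true true _ _ _ _ _ m c′ = merged (trans c′ (sym m))
        by-case true true true false _ _ _ _ _ m c′ = merged (trans c′ (sym m))
        by-case true true false true _ _ _ _ _ m c′ = merged (trans c′ (sym m))
        by-case true true false false p q r s l _ c′ = lowered (inj₁ (p , q , r , s)) (trans l (cong (2 +_) (sym c′)))
        by-case false true true true _ _ _ _ _ m c′ = merged (trans c′ (sym m))
        by-case true false true true _ _ _ _ _ m c′ = merged (trans c′ (sym m))
        by-case false false true true p q r s l _ c′ = lowered (inj₂ (r , s , p , q)) (trans l (cong (2 +_) (sym c′)))
        by-case true false true false _ _ _ _ l _ c′ = unchanged (trans c′ (sym l))
        by-case true false false true _ _ _ _ l _ c′ = unchanged (trans c′ (sym l))
        by-case true false false false _ _ _ _ l _ c′ = unchanged (trans c′ (sym l))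
        by-case false true true false _ _ _ _ l _ c′ = unchanged (trans c′ (sym l))
        by-case false true false true _ _ _ _ l _ c′ = unchanged (trans c′ (sym l))
        by-case false true false false _ _ _ _ l _ c′ = unchanged (trans c′ (sym l))
        by-case false false true false _ _ _ _ l _ c′ = unchanged (trans c′ (sym l))
        by-case false false false true _ _ _ _ l _ c′ = unchanged (trans c′ (sym l))
        by-case false false false false _ _ _ _ l _ c′ = unchanged (trans c′ (sym l))

      contradiction : ⊥
      contradiction = smaller W⁻ F′ ρ P
        (lin 4 (λ f g p z → (f ≈ # 4 ⊕ g) ∷ [] ⊢ (# 1 ⊕ ((# 2 ⊕ g) ⊕ (# 2 ⊕ g) ⊕ p) ≼ f ⊕ f ⊕ p)) (length F) (length F₀) (length P) 0 (size-star st))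
        reduced λ fl → noflow (Flow-⇛ sim (Flow-isolated v isolated balance-v fl))
        where
        sim : F ⇛ F′
        sim = ⇛-trans (simulates st) (⇛-trans ⇛-lift (⇛-cons (x , y) ⇛-lift))
        isolated : cut ⁅ v ⁆ F′ ≡ 0
        isolated with proper st
        ... | ≢x ∷ ≢y ∷ ≢z ∷ ≢w ∷ [] = cong₂ _+_ (off-⁅⁆ ≢x ≢y) (cong₂ _+_ (off-⁅⁆ ≢z ≢w) (bare st))
        balance-v : ev ⁅ v ⁆ ρ ≡ 0₃
        balance-v = trans (sym (+₃-identityʳ _)) (trans (cong (ev ⁅ v ⁆ ρ +₃_) (sym (pulls-0 P tipless))) bv)

    -- The edges of v can be paired up in at least two ways, and sets that obstruct two different
    -- pairings have exactly one of the four neighbours in common: uncrossing them leaves no tip edge of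
    -- one of the signs.
    module Clash {x y z w F₀} (st : Star v (x ∷ y ∷ z ∷ w ∷ []) F F₀) (tipless : cnt ⁅ v ⁆ P ≡ 0)
      {S S′ : VSet n} (S⊆ : S ⊆ W⁻) (S′⊆ : S′ ⊆ W⁻) (p : Pattern x y z w S) (p′ : Pattern x z y w S′) where

      private
        x∈S = proj₁ p
        y∈S = proj₁ (proj₂ p)
        z∉S = proj₁ (proj₂ (proj₂ p))
        w∉S = proj₂ (proj₂ (proj₂ p))
        x∈S′ = proj₁ p′
        z∈S′ = proj₁ (proj₂ p′)
        y∉S′ = proj₁ (proj₂ (proj₂ p′))
        w∉S′ = proj₂ (proj₂ (proj₂ p′))

      -- The other set separates x from y, so they are distinct even if v has parallel edges. This
      -- excludes the first kind of obstacle.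
      roomy-S : 6 + t S ≤ d S
      roomy-S = roomy′ S (⊆-trans S⊆ (∖⊆ W ⁅ v ⁆)) x∈S y∈S λ e → true≢false (subst (_∈ S′) e x∈S′) y∉S′

      roomy-S′ : 6 + t S′ ≤ d S′
      roomy-S′ = roomy′ S′ (⊆-trans S′⊆ (∖⊆ W ⁅ v ⁆)) x∈S′ z∈S′ λ e → true≢false (subst (_∈ S) e x∈S) z∉S

      A B : VSet n
      A = S ∩ S′
      B = S ∪ S′

      x∈A : x ∈ A
      x∈A = ∈∩ S S′ x x∈S x∈S′

      A⊆ : A ⊆ W⁻
      A⊆ u e = S⊆ u (∩⊆ˡ S S′ u e)

      B⊆ : B ⊆ W⁻
      B⊆ = ∪-⊆ S S′ W⁻ S⊆ S′⊆

      neB : Nonempty B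
      neB = x , ∈∪ˡ S S′ x x∈S

      B⁺ : VSet n
      B⁺ = ⁅ v ⁆ ∪ B

      unmixed-clash : cnt S P ≡ cut S F → cnt S′ P ≡ cut S′ F → ¬ Mixed P S → ¬ Mixed P S′ → ⊥
      unmixed-clash eq eq′ ¬m ¬m′ = signs-clash (sum-sign A (lin 3 (λ c p t → (p ≈ c) ∷ (# 4 ⊕ t ≼ c ⊕ p) ∷ [] ⊢ (# 1 ≼ p)) (cut A F) (cnt A P) (t A) eqA (tame A (S⊆W A A⊆ (x , x∈A)) (x , x∈A))))
        where
        x∈B = ∈∪ˡ S S′ x x∈S
        y∈B = ∈∪ˡ S S′ y y∈S
        z∈B = ∈∪ʳ S S′ z z∈S′
        w∉B : w ∉ B
        w∉B rewrite w∉S | w∉S′ = refl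
        neighbours : (f : Bool → ℕ) → f (B x) + (f (B y) + (f (B z) + (f (B w) + 0))) ≡ f true + (f true + (f true + (f false + 0)))
        neighbours f = cong₂ (λ a k → f a + k) x∈B (cong₂ (λ a k → f a + k) y∈B (cong₂ (λ a k → f a + k) z∈B (cong (λ a → f a + 0) w∉B)))
        cutB : cut B F ≡ 3 + cut B F₀
        cutB = trans (star-cut B B⊆ neB st) (cong (_+ cut B F₀) (neighbours ⟨_⟩))
        cutB⁺ : cut B⁺ F ≡ 1 + cut B F₀
        cutB⁺ = trans (star-cut⁺ B B⊆ neB st) (cong (_+ cut B F₀) (neighbours (λ a → ⟨ not a ⟩)))
        lowA : cnt A P ≤ cut A F
        lowA = low A A⊆ (x , x∈A)
        lowB : cnt B P ≤ cut B F
        lowB = low B B⊆ neB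
        -- Neither A nor B has more tip edges than cut edges, whereas S and S′ have equally many.
        -- Submodularity of the cut forces equality for A and for B.
        eqA : cnt A P ≡ cut A F
        eqA = lin 8 (λ pA cA pB cB pS cS pT cT → (pA ≼ cA) ∷ (pB ≼ cB) ∷ (pS ≈ cS) ∷ (pT ≈ cT) ∷ (cA ⊕ cB ≼ cS ⊕ cT) ∷ (pA ⊕ pB ≈ pS ⊕ pT) ∷ [] ⊢ (pA ≈ cA))
          (cnt A P) (cut A F) (cnt B P) (cut B F) (cnt S P) (cut S F) (cnt S′ P) (cut S′ F) lowA lowB eq eq′ (cut-submodular S S′ F) (cnt-modular S S′ P)
        eqB : cnt B P ≡ cut B F
        eqB = lin 8 (λ pA cA pB cB pS cS pT cT → (pA ≼ cA) ∷ (pB ≼ cB) ∷ (pS ≈ cS) ∷ (pT ≈ cT) ∷ (cA ⊕ cB ≼ cS ⊕ cT) ∷ (pA ⊕ pB ≈ pS ⊕ pT) ∷ [] ⊢ (pB ≈ cB))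
          (cnt A P) (cut A F) (cnt B P) (cut B F) (cnt S P) (cut S F) (cnt S′ P) (cut S′ F) lowA lowB eq eq′ (cut-submodular S S′ F) (cnt-modular S S′ P)
        -- Adding v to B replaces three cut edges by one and brings no tip edge. The result has more
        -- tip edges than cut edges, which only W can have.
        exhausted : ¬ Nonempty (W ∖ B⁺)
        exhausted ne = lin 5 (λ p p' c c' k → (p ≈ c) ∷ (c ≈ # 3 ⊕ k) ∷ (c' ≈ # 1 ⊕ k) ∷ (p' ≈ p) ∷ (p' ≼ c') ∷ [] ⊢ absurd)
          (cnt B P) (cnt B⁺ P) (cut B F) (cut B⁺ F) (cut B F₀) eqB cutB cutB⁺ (trans (cnt⁺ B B⊆ neB) (cong (_+ cnt B P) tipless))
          (cnt≤cut B⁺ (S⁺⊆W B B⊆ neB) (ne⁺ B B⊆ neB) ne)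
        W-mixed : Mixed P W
        W-mixed = mixed W (λ _ e → e) (v , v∈W) (cnt≡cut⇒tight (S⊆W A A⊆ (x , x∈A)) (x , x∈A) (v , v∈W∖S A A⊆ (x , x∈A)) eqA)
        sum-sign : ∀ S → 1 ≤ cnt S P → ∃[ s ] 1 ≤ sgn s S P
        sum-sign S h with sgn true S P in e
        ... | suc _ = true , subst (1 ≤_) (sym e) (s≤s z≤n)
        ... | zero = false , subst (1 ≤_) (trans (sym (cnt-sgn S P)) (cong (_+ sgn false S P) e)) h
        pure : ∀ s {R : VSet n} → ¬ Mixed P R → 1 ≤ sgn s R P → sgn (not s) R P ≡ 0
        pure s {R} ¬m h with sgn (not s) R P in e
        ... | zero = refl
        ... | suc _ = ⊥-elim (¬m (both s h (subst (1 ≤_) (sym e) (s≤s z≤n))))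
        signs-clash : ∃[ s ] 1 ≤ sgn s A P → ⊥
        signs-clash (s , h) = <⇒≱ (W-mixed (not s)) (≤-trans (sgn-mono (not s) cover P) (≤-trans (≤-reflexive (sgn⁺ B B⊆ neB (not s)))
          (≤-trans (+-mono-≤ (≤-trans (sgn≤cnt (not s) ⁅ v ⁆ P) (≤-reflexive tipless)) union) ≤-refl)))
          where
          cover : W ⊆ B⁺
          cover = ∖-empty W B⁺ exhausted
          union : sgn (not s) B P ≤ 0
          union = ≤-trans (≤-reflexive (sym (sgn-split (not s) B S P))) (+-mono-≤
            (≤-trans (sgn-mono (not s) (∩⊆ʳ B S) P) (≤-reflexive (pure s ¬m (≤-trans h (sgn-mono s (∩⊆ˡ S S′) P)))))
            (≤-trans (sgn-mono (not s) rest′ P) (≤-reflexive (pure s ¬m′ (≤-trans h (sgn-mono s (∩⊆ʳ S S′) P))))))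
            where
            rest′ : B ∖ S ⊆ S′
            rest′ u e with ∪-elim S S′ u (∖⊆ B S u e)
            ... | inj₁ k = ⊥-elim (true≢false k (∖∉ B S u e))
            ... | inj₂ k = k

      clash : Obstacle S → Obstacle S′ → ⊥
      clash (inj₁ lt) _ = <⇒≱ lt roomy-S
      clash (inj₂ _) (inj₁ lt) = <⇒≱ lt roomy-S′
      clash (inj₂ (eq , ¬m)) (inj₂ (eq′ , ¬m′)) = unmixed-clash eq eq′ ¬m ¬m′

    no-tips : ∀ {x y z w F₀} → Star v (x ∷ y ∷ z ∷ w ∷ []) F F₀ → cnt ⁅ v ⁆ P ≡ 0 → ⊥
    no-tips {x} {y} {z} {w} {F₀} st tipless = Four.contradiction st tipless λ S S⊆ ne pat ob →
      Four.contradiction (star-↭ (↭.prep x (↭.swap y z ↭.refl)) st) tipless λ S′ S′⊆ ne′ pat′ ob′ → conflict S⊆ S′⊆ pat pat′ ob ob′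
      where
      conflict : ∀ {S S′} → S ⊆ W⁻ → S′ ⊆ W⁻ → Pattern x y z w S ⊎ Pattern z w x y S → Pattern x z y w S′ ⊎ Pattern y w x z S′ →
        Obstacle S → Obstacle S′ → ⊥
      -- In each case the neighbours are permuted so that the one common to both sets comes first
      -- and the one in neither comes last.
      conflict S⊆ S′⊆ (inj₁ p) (inj₁ p′) = Clash.clash st tipless S⊆ S′⊆ p p′
      conflict S⊆ S′⊆ (inj₁ (px , py , pz , pw)) (inj₂ p′) =
        Clash.clash (star-↭ (↭.swap x y (↭.swap z w ↭.refl)) st) tipless S⊆ S′⊆ (py , px , pw , pz) p′
      conflict S⊆ S′⊆ (inj₂ p) (inj₁ (px , pz , py , pw)) =
        Clash.clash (star-↭ (++-comm (x ∷ y ∷ []) (z ∷ w ∷ [])) st) tipless S⊆ S′⊆ p (pz , px , pw , py)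
      conflict S⊆ S′⊆ (inj₂ (pz , pw , px , py)) (inj₂ (qy , qw , qx , qz)) =
        Clash.clash (star-↭ (↭.trans (++-comm (x ∷ y ∷ []) (z ∷ w ∷ [])) (↭.swap z w (↭.swap x y ↭.refl))) st) tipless S⊆ S′⊆
          (pw , pz , py , px) (qw , qy , qz , qx)

    tip-sign : ∀ {s P′} {S : VSet n} → Pick (v , s) P P′ → v ∈ S → 1 ≤ sgn s S P
    tip-sign {s} {P′} {S} tip v∈ = ≤-trans (≤-reflexive (sym (trans (cong (λ a → ⟨ a ∧ same s s ⟩) v∈) (same-refl s))))
      (≤-trans (m≤m+n _ (sgn s S P′)) (≤-reflexive (sym (sum-pick (atSign s S) tip))))
      where
      same-refl : ∀ s → ⟨ same s s ⟩ ≡ 1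
      same-refl true = refl
      same-refl false = refl

    -- S has as many tip edges as cut edges, so the tip edges outside S, among them one at v, have the
    -- same sign; the other sign occurs in S.
    zero-gap-mixed : ∀ S → S ⊆ W⁻ → Nonempty S → ∀ s P′ → cnt S P ≡ cut S F → 1 ≤ sgn s (W ∖ S) P → 1 ≤ sgn s S P′ →
      (∀ s → sgn s S P ≤ sgn s S P′) → Mixed P′ S
    zero-gap-mixed S S⊆ ne s P′ eq out-s in-s mono = both s in-s (≤-trans other (mono (not s)))
      where
      ne′ : Nonempty (W ∖ S)
      ne′ = v , v∈W∖S S S⊆ ne
      S⊆W′ = S⊆W S S⊆ ne
      W-mixed : Mixed P W
      W-mixed = mixed W (λ _ e → e) (v , v∈W) (cnt≡cut⇒tight S⊆W′ ne ne′ eq)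
      other : 1 ≤ sgn (not s) S P
      other with 1 ≤? sgn (not s) S P
      ... | yes h = h
      ... | no ¬h = ⊥-elim (cnt≡cut⇒unmixed S⊆W′ ne ne′ eq (both s out-s
        (lin 3 (λ a b c → (a ⊕ b ≈ c) ∷ (# 1 ≼ c) ∷ (# 1 ⊕ a ≼ # 1) ∷ [] ⊢ (# 1 ≼ b)) (sgn (not s) S P) (sgn (not s) (W ∖ S) P) (sgn (not s) W P)
          (trans (cong (_+ sgn (not s) (W ∖ S) P) (sym (sgn-cong (not s) (∩-⊆ W S S⊆W′) P))) (sgn-split (not s) W S P)) (W-mixed (not s)) (≰⇒> ¬h))))

    tight⁺ : ∀ S (S⊆ : S ⊆ W⁻) (ne : Nonempty S) → cnt (S⁺ S S⊆ ne) P ≡ cut (S⁺ S S⊆ ne) F + 2 → W ⊆ S⁺ S S⊆ ne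
    tight⁺ S S⊆ ne e = ∖-empty W (S⁺ S S⊆ ne) λ ne′ →
      lin 2 (λ p c → (p ≈ c ⊕ # 2) ∷ (p ≼ c) ∷ [] ⊢ absurd) _ _ e (cnt≤cut (S⁺ S S⊆ ne) (S⁺⊆W S S⊆ ne) (ne⁺ S S⊆ ne) ne′)

    cnt-one : ∀ {s P₀} → Pick (v , s) P P₀ → cnt ⁅ v ⁆ P₀ ≡ 0 → cnt ⁅ v ⁆ P ≡ 1
    cnt-one tip tipless = trans (sum-pick (at ⁅ v ⁆) tip) (cong₂ (λ a k → ⟨ a ⟩ + k) (∈⁅⁆ v) tipless)

    -- v has three edges, to x, y and z, and a tip edge, which is moved to x; y and z are joined.
    module One {x y z s F₀ P₀} (st : Star v (x ∷ y ∷ z ∷ []) F F₀) (tip : Pick (v , s) P P₀) (tipless : cnt ⁅ v ⁆ P₀ ≡ 0)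
      (clear-yz : y ≡ z → y ∈ W → x ≢ y → ⊥) (clear-x : x ∉ W → cnt W P ≡ cut W F + 2 → ⊥) where

      F′ : List (Edge n)
      F′ = (y , z) ∷ F₀

      -- The edge between v and x is directed so as to continue the tip edge through v: towards x if
      -- the tip edge is directed towards v. The tip edge thus reaches x with the same sign.
      ρ′ : List (Charge n)
      ρ′ = (v , q s) ∷ (x , q (not s)) ∷ ρ

      P′ : List (Tip n)
      P′ = (x , s) ∷ P₀

      v≢x : v ≢ x
      v≢x with proper st
      ... | ≢x ∷ _ = ≢x

      cnt-v : cnt ⁅ v ⁆ P ≡ 1
      cnt-v = cnt-one tip tipless

      reduced : Inst W⁻ F′ ρ′ P′
      reduced S S⊆ ne = by-case (S x) (S y) (S z) refl refl refl (star-cut S S⊆ ne st) (star-cut⁺ S S⊆ ne st) refl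
          (cong (⟨ S x ⟩ +_) (sym cnt-S))
        where
        T = S⁺ S S⊆ ne
        v∉ = v∉S S S⊆ ne
        cnt-S : cnt S P ≡ cnt S P₀
        cnt-S = trans (sum-pick (at S) tip) (cong (λ a → ⟨ a ⟩ + cnt S P₀) v∉)
        cnt-T : cnt T P ≡ 1 + cnt S P
        cnt-T = trans (cnt⁺ S S⊆ ne) (cong (_+ cnt S P) cnt-v)
        sgn-S : ∀ s′ → sgn s′ S P ≡ sgn s′ S P₀
        sgn-S s′ = trans (sum-pick (atSign s′ S) tip) (cong (λ a → ⟨ a ∧ same s′ s ⟩ + sgn s′ S P₀) v∉)
        sgn-mono′ : ∀ s′ → sgn s′ S P ≤ sgn s′ S P′
        sgn-mono′ s′ = ≤-trans (≤-reflexive (sgn-S s′)) (m≤n+m _ _)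
        b′ : bd S ρ′ P′ ≡ b S
        b′ = trans (cong (λ a → (a ⋆ q s +₃ (S x ⋆ q (not s) +₃ ev S ρ)) +₃ (S x ⋆ q s +₃ pulls S P₀)) v∉)
          (trans (table (S x) s (ev S ρ) (pulls S P₀)) (cong (ev S ρ +₃_) (sym (trans (sum₃-pick (pull S) tip) (trans (cong (λ a → a ⋆ q s +₃ pulls S P₀) v∉) (+₃-identityˡ _))))))
          where
          table : ∀ a s e p → (0₃ +₃ (a ⋆ q (not s) +₃ e)) +₃ (a ⋆ q s +₃ p) ≡ e +₃ p
          table = from-yes (∀Bool? λ a → ∀Bool? λ s → all? λ e → all? λ p → ((0₃ +₃ (a ⋆ q (not s) +₃ e)) +₃ (a ⋆ q s +₃ p)) ≟ (e +₃ p))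
        tame′ : 4 + τ (deg S F′ P′) (b S) ≤ deg S F′ P′ → Tame F′ ρ′ P′ S
        tame′ = subst (λ c → 4 + τ (deg S F′ P′) c ≤ deg S F′ P′) (sym b′)
        mixed-T : ∀ a → S x ≡ a → cnt T P ≡ cut T F + 2 → Mixed P′ S
        mixed-T true x∈ e s′ = subst (1 ≤_) (trans (sgn⁺ S S⊆ ne s′) (trans (cong₂ _+_ sgn-v (sgn-S s′)) (cong (λ a → ⟨ a ∧ same s′ s ⟩ + sgn s′ S P₀) (sym x∈)))) (mixed T (S⁺⊆W S S⊆ ne) (ne⁺ S S⊆ ne) e s′)
          where
          sgn-v : sgn s′ ⁅ v ⁆ P ≡ ⟨ same s′ s ⟩
          sgn-v = trans (sum-pick (atSign s′ ⁅ v ⁆) tip) (trans (cong₂ (λ a k → ⟨ a ∧ same s′ s ⟩ + k) (∈⁅⁆ v)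
            (n≤0⇒n≡0 (≤-trans (sgn≤cnt s′ ⁅ v ⁆ P₀) (≤-reflexive tipless)))) (+-identityʳ _))
        mixed-T false x∉ e = ⊥-elim (clear-x x∉W (trans (sym (cnt-cong T≗W P)) (trans e (cong (_+ 2) (cut-cong T≗W F)))))
          where
          T≗W : T ≗ W
          T≗W = ≗-⊆ T W (S⁺⊆W S S⊆ ne) (tight⁺ S S⊆ ne e)
          x∉W : x ∉ W
          x∉W = trans (sym (T≗W x)) (cong₂ _∨_ (∉⁅⁆ v x v≢x) x∉)
        tall-T : cnt S P′ + cut T F ≡ cnt T P + cut S F′ → Tall F′ P′ S
        tall-T gap = lin 4 (λ p c p' c' → (p' ⊕ c ≈ p ⊕ c') ∷ (p ≼ c ⊕ # 2) ∷ [] ⊢ (p' ≼ c' ⊕ # 2)) _ _ _ _ gap (tall T (S⁺⊆W S S⊆ ne) (ne⁺ S S⊆ ne)) ,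
          λ e → mixed-T (S x) refl (lin 4 (λ p c p' c' → (p' ⊕ c ≈ p ⊕ c') ∷ (p' ≈ c' ⊕ # 2) ∷ [] ⊢ (p ≈ c ⊕ # 2)) _ _ _ _ gap e)
        by-case : ∀ a c e → S x ≡ a → S y ≡ c → S z ≡ e →
          cut S F ≡ (⟨ a ⟩ + (⟨ c ⟩ + (⟨ e ⟩ + 0))) + cut S F₀ →
          cut T F ≡ (⟨ not a ⟩ + (⟨ not c ⟩ + (⟨ not e ⟩ + 0))) + cut S F₀ →
          cut S F′ ≡ ⟨ c xor e ⟩ + cut S F₀ → cnt S P′ ≡ ⟨ a ⟩ + cnt S P → Good F′ ρ′ P′ S
        by-case true true true _ _ _ cS cT c′ p′ = good
          (tame′ (merged-tame S S⊆ ne (deg S F′ P′) (cong₂ _+_ (trans c′ (sym cT)) (trans p′ (sym cnt-T)))))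
          (tall-T (lin 6 (λ p′ cT pT c′ p k → (cT ≈ k) ∷ (c′ ≈ k) ∷ (p′ ≈ # 1 ⊕ p) ∷ (pT ≈ # 1 ⊕ p) ∷ [] ⊢ (p′ ⊕ cT ≈ pT ⊕ c′)) _ _ _ _ _ _ cT c′ p′ cnt-T))
        by-case false true true x∉ y∈ z∈ cS cT c′ p′ = good
          (tame′ (lowered-tame S S⊆ ne (deg S F′ P′) (cong₂ _+_ (trans cS (cong (2 +_) (sym c′))) (sym p′)) roomy-S))
          (tall-T (lin 6 (λ p′ cT pT c′ p k → (cT ≈ # 1 ⊕ k) ∷ (c′ ≈ k) ∷ (p′ ≈ p) ∷ (pT ≈ # 1 ⊕ p) ∷ [] ⊢ (p′ ⊕ cT ≈ pT ⊕ c′)) _ _ _ _ _ _ cT c′ p′ cnt-T))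
          where
          roomy-S : 6 + t S ≤ d S
          roomy-S with y ≟ z
          ... | yes y≡z = ⊥-elim (clear-yz y≡z (S⊆W S S⊆ ne y y∈) λ e → true≢false (subst (_∈ S) (sym e) y∈) x∉)
          ... | no y≢z = roomy′ S (S⊆W S S⊆ ne) y∈ z∈ y≢z
        by-case true true false _ _ _ cS cT c′ p′ = good
          (tame′ (same-tame S S⊆ ne (deg S F′ P′) (lin 6 (λ cS c′ p′ p k z → (cS ≈ # 2 ⊕ k) ∷ (c′ ≈ # 1 ⊕ k) ∷ (p′ ≈ # 1 ⊕ p) ∷ [] ⊢ (c′ ⊕ p′ ≈ cS ⊕ p)) _ _ _ _ _ 0 cS c′ p′)))
          (tall-T (lin 6 (λ p′ cT pT c′ p k → (cT ≈ # 1 ⊕ k) ∷ (c′ ≈ # 1 ⊕ k) ∷ (p′ ≈ # 1 ⊕ p) ∷ (pT ≈ # 1 ⊕ p) ∷ [] ⊢ (p′ ⊕ cT ≈ pT ⊕ c′)) _ _ _ _ _ _ cT c′ p′ cnt-T))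
        by-case true false true _ _ _ cS cT c′ p′ = good
          (tame′ (same-tame S S⊆ ne (deg S F′ P′) (lin 6 (λ cS c′ p′ p k z → (cS ≈ # 2 ⊕ k) ∷ (c′ ≈ # 1 ⊕ k) ∷ (p′ ≈ # 1 ⊕ p) ∷ [] ⊢ (c′ ⊕ p′ ≈ cS ⊕ p)) _ _ _ _ _ 0 cS c′ p′)))
          (tall-T (lin 6 (λ p′ cT pT c′ p k → (cT ≈ # 1 ⊕ k) ∷ (c′ ≈ # 1 ⊕ k) ∷ (p′ ≈ # 1 ⊕ p) ∷ (pT ≈ # 1 ⊕ p) ∷ [] ⊢ (p′ ⊕ cT ≈ pT ⊕ c′)) _ _ _ _ _ _ cT c′ p′ cnt-T))
        by-case false true false _ _ _ cS cT c′ p′ = good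
          (tame′ (same-tame S S⊆ ne (deg S F′ P′) (cong₂ _+_ (trans c′ (sym cS)) p′)))
          (tall-T (lin 6 (λ p′ cT pT c′ p k → (cT ≈ # 2 ⊕ k) ∷ (c′ ≈ # 1 ⊕ k) ∷ (p′ ≈ p) ∷ (pT ≈ # 1 ⊕ p) ∷ [] ⊢ (p′ ⊕ cT ≈ pT ⊕ c′)) _ _ _ _ _ _ cT c′ p′ cnt-T))
        by-case false false true _ _ _ cS cT c′ p′ = good
          (tame′ (same-tame S S⊆ ne (deg S F′ P′) (cong₂ _+_ (trans c′ (sym cS)) p′)))
          (tall-T (lin 6 (λ p′ cT pT c′ p k → (cT ≈ # 2 ⊕ k) ∷ (c′ ≈ # 1 ⊕ k) ∷ (p′ ≈ p) ∷ (pT ≈ # 1 ⊕ p) ∷ [] ⊢ (p′ ⊕ cT ≈ pT ⊕ c′)) _ _ _ _ _ _ cT c′ p′ cnt-T))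
        by-case false false false _ _ _ cS cT c′ p′ = good
          (tame′ (same-tame S S⊆ ne (deg S F′ P′) (cong₂ _+_ (trans c′ (sym cS)) p′)))
          (strict-tall F′ P′ S (subst₂ (λ p c → p ≤ c + 1) (sym p′) (trans cS (sym c′)) (≤-trans (low S S⊆ ne) (m≤m+n _ 1))))
        -- S exchanges its edge to v for the tip edge, so its excess of tip edges grows by two and
        -- attains the bound only if it was 0 before.
        by-case true false false x∈ _ _ cS cT c′ p′ = good
          (tame′ (same-tame S S⊆ ne (deg S F′ P′) (lin 6 (λ cS c′ p′ p k z → (cS ≈ # 1 ⊕ k) ∷ (c′ ≈ k) ∷ (p′ ≈ # 1 ⊕ p) ∷ [] ⊢ (c′ ⊕ p′ ≈ cS ⊕ p)) _ _ _ _ _ 0 cS c′ p′)))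
          (lin 6 (λ cS c′ p′ p k z → (cS ≈ # 1 ⊕ k) ∷ (c′ ≈ k) ∷ (p′ ≈ # 1 ⊕ p) ∷ (p ≼ cS) ∷ [] ⊢ (p′ ≼ c′ ⊕ # 2)) _ _ _ _ _ 0 cS c′ p′ (low S S⊆ ne) ,
           λ eq → zero-gap-mixed S S⊆ ne s P′
             (lin 6 (λ cS c′ p′ p k z → (cS ≈ # 1 ⊕ k) ∷ (c′ ≈ k) ∷ (p′ ≈ # 1 ⊕ p) ∷ (p′ ≈ c′ ⊕ # 2) ∷ [] ⊢ (p ≈ cS)) _ _ _ _ _ 0 cS c′ p′ eq)
             (tip-sign {S = W ∖ S} tip (v∈W∖S S S⊆ ne)) (subst (λ a → 1 ≤ ⟨ a ∧ same s s ⟩ + sgn s S P₀) (sym x∈) (same-pos s)) sgn-mono′)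
  
      contradiction : ⊥
      contradiction = smaller W⁻ F′ ρ′ P′
        (lin 4 (λ f g p p₀ → (f ≈ # 3 ⊕ g) ∷ (p ≈ # 1 ⊕ p₀) ∷ [] ⊢ (# 1 ⊕ ((# 1 ⊕ g) ⊕ (# 1 ⊕ g) ⊕ (# 1 ⊕ p₀)) ≼ f ⊕ f ⊕ p)) (length F) (length F₀) (length P) (length P₀) (size-star st) (length-pick tip))
        reduced λ fl → noflow (Flow-⇛ sim (Flow-sign s (Flow-isolated v isolated balance-v fl)))
        where
        sim : F ⇛ (v , x) ∷ F′
        sim = ⇛-trans (simulates st) (⇛-cons (v , x) ⇛-lift)
        isolated : cut ⁅ v ⁆ F′ ≡ 0
        isolated with proper st
        ... | ≢x ∷ ≢y ∷ ≢z ∷ [] = cong₂ _+_ (off-⁅⁆ ≢y ≢z) (bare st)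
        balance-v : ev ⁅ v ⁆ ρ′ ≡ 0₃
        balance-v = trans (cong₂ (λ a c → a ⋆ q s +₃ (c ⋆ q (not s) +₃ ev ⁅ v ⁆ ρ)) (∈⁅⁆ v) (∉⁅⁆ v x v≢x)) (trans (table s (ev ⁅ v ⁆ ρ)) (trans (cong (ev ⁅ v ⁆ ρ +₃_) (sym pulls-v)) bv))
          where
          table : ∀ s e → q s +₃ (0₃ +₃ e) ≡ e +₃ (q s +₃ 0₃)
          table = from-yes (∀Bool? λ s → all? λ e → (q s +₃ (0₃ +₃ e)) ≟ (e +₃ (q s +₃ 0₃)))
          pulls-v : pulls ⁅ v ⁆ P ≡ q s +₃ 0₃
          pulls-v = trans (sum₃-pick (pull ⁅ v ⁆) tip) (cong₂ (λ a k → a ⋆ q s +₃ k) (∈⁅⁆ v) (pulls-0 P₀ tipless))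

    -- The receiver of the tip edge has to be chosen. The other two neighbours must not coincide in
    -- a vertex of W different from it, for a set containing only that vertex need not be roomy; and
    -- if W attains the bound of tallness, the tip edge must stay in W.
    one-tip : ∀ {x y z s F₀ P₀} → Star v (x ∷ y ∷ z ∷ []) F F₀ → Pick (v , s) P P₀ → cnt ⁅ v ⁆ P₀ ≡ 0 → ⊥
    one-tip {x} {y} {z} {s} {F₀} {P₀} st tip tipless = One.contradiction st tip tipless
      (λ { refl y∈ x≢y → One.contradiction (star-↭ (↭.swap x y ↭.refl) st) tip tipless
        (λ e _ _ → x≢y e) (λ y∉ _ → true≢false y∈ y∉) })
      (λ x∉ tight → One.contradiction (star-↭ (↭.swap x y ↭.refl) st) tip tipless
        (λ e x∈ _ → true≢false x∈ x∉)
        (λ y∉ _ → One.contradiction (star-↭ (↭.trans (++-comm (x ∷ y ∷ []) (z ∷ [])) ↭.refl) st) tip tipless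
          (λ e x∈ _ → true≢false x∈ x∉)
          (λ z∉ _ → all-outside x∉ y∉ z∉ tight)))
      where
      all-outside : x ∉ W → y ∉ W → z ∉ W → cnt W P ≡ cut W F + 2 → ⊥
      -- Removing v from W would remove three cut edges and only one tip edge, leaving an excess of
      -- four where none is allowed.
      all-outside x∉ y∉ z∉ tight = lin 6 (λ p p⁻ c c⁻ k u → (c ≈ # 3 ⊕ k) ∷ (c⁻ ≈ k) ∷ (p ≈ # 1 ⊕ p⁻) ∷ (p⁻ ≼ c⁻) ∷ (p ≈ c ⊕ # 2) ∷ [] ⊢ absurd)
          (cnt W P) (cnt W⁻ P) (cut W F) (cut W⁻ F) (cut W⁻ F₀) 0
          (trans (sym (cut-cong W⁺≗W F)) (trans (star-cut⁺ W⁻ ⊆-refl rest st) (cong₂ (λ a c → ⟨ not a ⟩ + c + cut W⁻ F₀) (out x x∉) (cong₂ (λ a c → ⟨ not a ⟩ + c) (out y y∉) (cong (λ a → ⟨ not a ⟩ + 0) (out z z∉))))))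
          (trans (star-cut W⁻ ⊆-refl rest st) (cong₂ (λ a c → ⟨ a ⟩ + c + cut W⁻ F₀) (out x x∉) (cong₂ (λ a c → ⟨ a ⟩ + c) (out y y∉) (cong (λ a → ⟨ a ⟩ + 0) (out z z∉)))))
          (trans (sym (cnt-cong W⁺≗W P)) (trans (cnt⁺ W⁻ ⊆-refl rest) (cong (_+ cnt W⁻ P) (cnt-one tip tipless))))
          (low W⁻ ⊆-refl rest) tight
        where
        ⊆-refl : W⁻ ⊆ W⁻
        ⊆-refl _ e = e
        out : ∀ u → u ∉ W → u ∉ W⁻
        out u h rewrite h = refl
        W⁺≗W : S⁺ W⁻ ⊆-refl rest ≗ W
        W⁺≗W u with v ≟ u
        ... | yes refl = sym v∈W
        ... | no _ with W u
        ...   | true = refl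
        ...   | false = refl

    -- Each tip edge moves along its own edge at v, so the degree of every remaining set stays the
    -- same and only tallness depends on which neighbours lie in S.
    module Two {x y s₁ s₂ F₀ P₁ P₀} (st : Star v (x ∷ y ∷ []) F F₀) (tip₁ : Pick (v , s₁) P P₁) (tip₂ : Pick (v , s₂) P₁ P₀)
      (tipless : cnt ⁅ v ⁆ P₀ ≡ 0) where

      ρ′ : List (Charge n)
      ρ′ = (v , q s₂) ∷ (y , q (not s₂)) ∷ (v , q s₁) ∷ (x , q (not s₁)) ∷ ρ

      P′ : List (Tip n)
      P′ = (x , s₁) ∷ (y , s₂) ∷ P₀

      v≢x : v ≢ x
      v≢x with proper st
      ... | ≢x ∷ _ = ≢x

      v≢y : v ≢ y
      v≢y with proper st
      ... | _ ∷ ≢y ∷ _ = ≢y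

      sum-tips : (f : Tip n → ℕ) → sum f P ≡ f (v , s₁) + (f (v , s₂) + sum f P₀)
      sum-tips f = trans (sum-pick f tip₁) (cong (f (v , s₁) +_) (sum-pick f tip₂))

      sum₃-tips : (f : Tip n → Z3) → sum₃ f P ≡ f (v , s₁) +₃ (f (v , s₂) +₃ sum₃ f P₀)
      sum₃-tips f = trans (sum₃-pick f tip₁) (cong (f (v , s₁) +₃_) (sum₃-pick f tip₂))

      cnt-v : cnt ⁅ v ⁆ P ≡ 2
      cnt-v = trans (sum-tips (at ⁅ v ⁆)) (cong₂ (λ a k → ⟨ a ⟩ + (⟨ a ⟩ + k)) (∈⁅⁆ v) tipless)

      reduced : Inst W⁻ F₀ ρ′ P′
      reduced S S⊆ ne = by-case (S x) (S y) refl refl (star-cut S S⊆ ne st) (star-cut⁺ S S⊆ ne st)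
          (cong (λ k → ⟨ S x ⟩ + (⟨ S y ⟩ + k)) (sym cnt-S))
        where
        T = S⁺ S S⊆ ne
        v∉ = v∉S S S⊆ ne
        cnt-S : cnt S P ≡ cnt S P₀
        cnt-S = trans (sum-tips (at S)) (cong (λ a → ⟨ a ⟩ + (⟨ a ⟩ + cnt S P₀)) v∉)
        cnt-T : cnt T P ≡ 2 + cnt S P
        cnt-T = trans (cnt⁺ S S⊆ ne) (cong (_+ cnt S P) cnt-v)
        sgn-S : ∀ s′ → sgn s′ S P ≡ sgn s′ S P₀
        sgn-S s′ = trans (sum-tips (atSign s′ S)) (cong (λ a → ⟨ a ∧ same s′ s₁ ⟩ + (⟨ a ∧ same s′ s₂ ⟩ + sgn s′ S P₀)) v∉)
        sgn-mono′ : ∀ s′ → sgn s′ S P ≤ sgn s′ S P′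
        sgn-mono′ s′ = ≤-trans (≤-reflexive (sgn-S s′)) (≤-trans (m≤n+m _ (atSign s′ S (y , s₂))) (m≤n+m _ (atSign s′ S (x , s₁))))
        b′ : bd S ρ′ P′ ≡ b S
        b′ = trans (cong (λ a → (a ⋆ q s₂ +₃ (S y ⋆ q (not s₂) +₃ (a ⋆ q s₁ +₃ (S x ⋆ q (not s₁) +₃ ev S ρ)))) +₃ pulls S P′) v∉)
          (trans (table₂ (S x) (S y) (ev S ρ) (pulls S P₀)) (cong (ev S ρ +₃_) (sym (trans (sum₃-tips (pull S)) (trans (cong (λ a → a ⋆ q s₁ +₃ (a ⋆ q s₂ +₃ pulls S P₀)) v∉)
            (trans (+₃-identityˡ _) (+₃-identityˡ _)))))))
          where
          table : ∀ a c s s′ e p → (0₃ +₃ (c ⋆ q (not s′) +₃ (0₃ +₃ (a ⋆ q (not s) +₃ e)))) +₃ (a ⋆ q s +₃ (c ⋆ q s′ +₃ p)) ≡ e +₃ p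
          table = from-yes (∀Bool? λ a → ∀Bool? λ c → ∀Bool? λ s → ∀Bool? λ s′ → all? λ e → all? λ p →
            ((0₃ +₃ (c ⋆ q (not s′) +₃ (0₃ +₃ (a ⋆ q (not s) +₃ e)))) +₃ (a ⋆ q s +₃ (c ⋆ q s′ +₃ p))) ≟ (e +₃ p))
          table₂ = λ a c e p → table a c s₁ s₂ e p
        tame′ : deg S F₀ P′ ≡ d S → Tame F₀ ρ′ P′ S
        tame′ e = subst (λ c → 4 + τ (deg S F₀ P′) c ≤ deg S F₀ P′) (sym b′) (same-tame S S⊆ ne (deg S F₀ P′) e)
        tall-T : cnt S P′ + cut T F ≡ cnt T P + cut S F₀ → (cnt S P′ ≡ cut S F₀ + 2 → Mixed P T → Mixed P′ S) → Tall F₀ P′ S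
        tall-T gap mix = lin 4 (λ p c p' c' → (p' ⊕ c ≈ p ⊕ c') ∷ (p ≼ c ⊕ # 2) ∷ [] ⊢ (p' ≼ c' ⊕ # 2)) _ _ _ _ gap (tall T (S⁺⊆W S S⊆ ne) (ne⁺ S S⊆ ne)) ,
          λ e → mix e (mixed T (S⁺⊆W S S⊆ ne) (ne⁺ S S⊆ ne) (lin 4 (λ p c p' c' → (p' ⊕ c ≈ p ⊕ c') ∷ (p' ≈ c' ⊕ # 2) ∷ [] ⊢ (p ≈ c ⊕ # 2)) _ _ _ _ gap e))
        by-case : ∀ a c → S x ≡ a → S y ≡ c →
          cut S F ≡ (⟨ a ⟩ + (⟨ c ⟩ + 0)) + cut S F₀ →
          cut T F ≡ (⟨ not a ⟩ + (⟨ not c ⟩ + 0)) + cut S F₀ →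
          cnt S P′ ≡ ⟨ a ⟩ + (⟨ c ⟩ + cnt S P) → Good F₀ ρ′ P′ S
        by-case true true x∈ y∈ cS cT p′ = good
          (tame′ (lin 4 (λ cS p′ p k → (cS ≈ # 2 ⊕ k) ∷ (p′ ≈ # 2 ⊕ p) ∷ [] ⊢ (k ⊕ p′ ≈ cS ⊕ p)) _ _ _ _ cS p′))
          (tall-T (lin 5 (λ p′ cT pT p k → (cT ≈ k) ∷ (p′ ≈ # 2 ⊕ p) ∷ (pT ≈ # 2 ⊕ p) ∷ [] ⊢ (p′ ⊕ cT ≈ pT ⊕ k)) _ _ _ _ _ cT p′ cnt-T)
            λ _ m s′ → subst (1 ≤_) (trans (sgn⁺ S S⊆ ne s′) (trans (cong₂ _+_ (sgn-v s′) (sgn-S s′)) (trans (rearrange s′)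
              (cong₂ (λ a c → ⟨ a ∧ same s′ s₁ ⟩ + (⟨ c ∧ same s′ s₂ ⟩ + sgn s′ S P₀)) (sym x∈) (sym y∈))))) (m s′))
          where
          sgn-v : ∀ s′ → sgn s′ ⁅ v ⁆ P ≡ ⟨ same s′ s₁ ⟩ + (⟨ same s′ s₂ ⟩ + 0)
          sgn-v s′ = trans (sum-tips (atSign s′ ⁅ v ⁆)) (cong₂ (λ a k → ⟨ a ∧ same s′ s₁ ⟩ + (⟨ a ∧ same s′ s₂ ⟩ + k)) (∈⁅⁆ v)
            (n≤0⇒n≡0 (≤-trans (sgn≤cnt s′ ⁅ v ⁆ P₀) (≤-reflexive tipless))))
          rearrange : ∀ s′ → (⟨ same s′ s₁ ⟩ + (⟨ same s′ s₂ ⟩ + 0)) + sgn s′ S P₀ ≡ ⟨ same s′ s₁ ⟩ + (⟨ same s′ s₂ ⟩ + sgn s′ S P₀)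
          rearrange s′ = lin 3 (λ a c k → [] ⊢ ((a ⊕ (c ⊕ # 0)) ⊕ k ≈ a ⊕ (c ⊕ k))) ⟨ same s′ s₁ ⟩ ⟨ same s′ s₂ ⟩ (sgn s′ S P₀)
        by-case true false x∈ y∉ cS cT p′ = good
          (tame′ (lin 4 (λ cS p′ p k → (cS ≈ # 1 ⊕ k) ∷ (p′ ≈ # 1 ⊕ p) ∷ [] ⊢ (k ⊕ p′ ≈ cS ⊕ p)) _ _ _ _ cS p′))
          (tall-T (lin 5 (λ p′ cT pT p k → (cT ≈ # 1 ⊕ k) ∷ (p′ ≈ # 1 ⊕ p) ∷ (pT ≈ # 2 ⊕ p) ∷ [] ⊢ (p′ ⊕ cT ≈ pT ⊕ k)) _ _ _ _ _ cT p′ cnt-T)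
            λ e _ → zero-gap-mixed S S⊆ ne s₁ P′ (lin 4 (λ cS p′ p k → (cS ≈ # 1 ⊕ k) ∷ (p′ ≈ # 1 ⊕ p) ∷ (p′ ≈ k ⊕ # 2) ∷ [] ⊢ (p ≈ cS)) _ _ _ _ cS p′ e)
              (tip-sign {S = W ∖ S} tip₁ (v∈W∖S S S⊆ ne)) (subst (λ a → 1 ≤ ⟨ a ∧ same s₁ s₁ ⟩ + (atSign s₁ S (y , s₂) + sgn s₁ S P₀)) (sym x∈) (same-pos s₁)) sgn-mono′)
        by-case false true x∉ y∈ cS cT p′ = good
          (tame′ (lin 4 (λ cS p′ p k → (cS ≈ # 1 ⊕ k) ∷ (p′ ≈ # 1 ⊕ p) ∷ [] ⊢ (k ⊕ p′ ≈ cS ⊕ p)) _ _ _ _ cS p′))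
          (tall-T (lin 5 (λ p′ cT pT p k → (cT ≈ # 1 ⊕ k) ∷ (p′ ≈ # 1 ⊕ p) ∷ (pT ≈ # 2 ⊕ p) ∷ [] ⊢ (p′ ⊕ cT ≈ pT ⊕ k)) _ _ _ _ _ cT p′ cnt-T)
            λ e _ → zero-gap-mixed S S⊆ ne s₂ P′ (lin 4 (λ cS p′ p k → (cS ≈ # 1 ⊕ k) ∷ (p′ ≈ # 1 ⊕ p) ∷ (p′ ≈ k ⊕ # 2) ∷ [] ⊢ (p ≈ cS)) _ _ _ _ cS p′ e)
              (≤-trans (tip-sign₂ (v∈W∖S S S⊆ ne)) ≤-refl) (≤-trans (subst (λ a → 1 ≤ ⟨ a ∧ same s₂ s₂ ⟩ + sgn s₂ S P₀) (sym y∈) (same-pos s₂)) (m≤n+m _ (atSign s₂ S (x , s₁)))) sgn-mono′)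
          where
          tip-sign₂ : v ∈ W ∖ S → 1 ≤ sgn s₂ (W ∖ S) P
          tip-sign₂ v∈ = ≤-trans (≤-trans (subst (λ a → 1 ≤ ⟨ a ∧ same s₂ s₂ ⟩ + sgn s₂ (W ∖ S) P₀) (sym v∈) (same-pos s₂)) (m≤n+m _ (atSign s₂ (W ∖ S) (v , s₁))))
            (≤-reflexive (sym (sum-tips (atSign s₂ (W ∖ S)))))
        by-case false false _ _ cS cT p′ = good
          (tame′ (cong₂ _+_ (sym cS) p′))
          (strict-tall F₀ P′ S (subst₂ (λ p c → p ≤ c + 1) (sym p′) cS (≤-trans (low S S⊆ ne) (m≤m+n _ 1))))

      contradiction : ⊥
      contradiction = smaller W⁻ F₀ ρ′ P′
        (lin 5 (λ f g p p₀ p₁ → (f ≈ # 2 ⊕ g) ∷ (p ≈ # 1 ⊕ p₁) ∷ (p₁ ≈ # 1 ⊕ p₀) ∷ [] ⊢ (# 1 ⊕ (g ⊕ g ⊕ (# 2 ⊕ p₀)) ≼ f ⊕ f ⊕ p))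
          (length F) (length F₀) (length P) (length P₀) (length P₁) (size-star st) (length-pick tip₁) (length-pick tip₂))
        reduced λ fl → noflow (Flow-⇛ (simulates st) (Flow-sign s₁ (Flow-sign s₂ (Flow-isolated v (bare st) balance-v fl))))
        where
        balance-v : ev ⁅ v ⁆ ρ′ ≡ 0₃
        balance-v = trans (eval (∈⁅⁆ v) (∉⁅⁆ v x v≢x) (∉⁅⁆ v y v≢y)) (trans (table s₁ s₂ (ev ⁅ v ⁆ ρ)) (trans (cong (ev ⁅ v ⁆ ρ +₃_) (sym pulls-v)) bv))
          where
          eval : ⁅ v ⁆ v ≡ true → ⁅ v ⁆ x ≡ false → ⁅ v ⁆ y ≡ false → ev ⁅ v ⁆ ρ′ ≡ q s₂ +₃ (0₃ +₃ (q s₁ +₃ (0₃ +₃ ev ⁅ v ⁆ ρ)))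
          eval ev ex ey rewrite ev | ex | ey = refl
          table : ∀ s s′ e → q s′ +₃ (0₃ +₃ (q s +₃ (0₃ +₃ e))) ≡ e +₃ (q s +₃ (q s′ +₃ 0₃))
          table = from-yes (∀Bool? λ s → ∀Bool? λ s′ → all? λ e → (q s′ +₃ (0₃ +₃ (q s +₃ (0₃ +₃ e)))) ≟ (e +₃ (q s +₃ (q s′ +₃ 0₃))))
          pulls-v : pulls ⁅ v ⁆ P ≡ q s₁ +₃ (q s₂ +₃ 0₃)
          pulls-v = trans (sum₃-tips (pull ⁅ v ⁆)) (cong₂ (λ a k → a ⋆ q s₁ +₃ (a ⋆ q s₂ +₃ k)) (∈⁅⁆ v) (pulls-0 P₀ tipless))

    split : ⊥
    split = by-count (cnt ⁅ v ⁆ P) refl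
      where
      few : cnt ⁅ v ⁆ P ≤ cut ⁅ v ⁆ F
      few = cnt≤cut ⁅ v ⁆ (⁅⁆⊆ W v∈W) (v , ∈⁅⁆ v) rest
      by-count : ∀ k → cnt ⁅ v ⁆ P ≡ k → ⊥
      by-count 0 e with star v 4 F (trans (sym (trans (cong (cut ⁅ v ⁆ F +_) e) (+-identityʳ _))) dv)
      ... | x ∷ y ∷ z ∷ w ∷ [] , F₀ , refl , st = no-tips st e
      by-count 1 e with star v 3 F (lin 2 (λ c p → (c ⊕ p ≈ # 4) ∷ (p ≈ # 1) ∷ [] ⊢ (c ≈ # 3)) (cut ⁅ v ⁆ F) (cnt ⁅ v ⁆ P) dv e) | tips-at v 0 P e
      ... | x ∷ y ∷ z ∷ [] , F₀ , refl , st | s , P₀ , tip , e₀ = one-tip st tip e₀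
      by-count 2 e with star v 2 F (lin 2 (λ c p → (c ⊕ p ≈ # 4) ∷ (p ≈ # 2) ∷ [] ⊢ (c ≈ # 2)) (cut ⁅ v ⁆ F) (cnt ⁅ v ⁆ P) dv e) | tips-at v 1 P e
      ... | x ∷ y ∷ [] , F₀ , refl , st | s₁ , P₁ , tip₁ , e₁ with tips-at v 0 P₁ e₁
      ...   | s₂ , P₀ , tip₂ , e₀ = Two.contradiction st tip₁ tip₂ e₀
      by-count (suc (suc (suc k))) e = lin 3 (λ c p k → (c ⊕ p ≈ # 4) ∷ (p ≈ # 3 ⊕ k) ∷ (p ≼ c) ∷ [] ⊢ absurd) (cut ⁅ v ⁆ F) (cnt ⁅ v ⁆ P) k dv e few

  -- Finding an edge to delete.

  spare-some : ∀ {v} → v ∈ W → Nonempty (W ∖ ⁅ v ⁆) → ∃[ s ] Spare-at s v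
  spare-some {v} v∈ rest with spare? true (d ⁅ v ⁆) (b ⁅ v ⁆) | spare? false (d ⁅ v ⁆) (b ⁅ v ⁆)
  ... | yes p | _ = true , p
  ... | no _ | yes p = false , p
  ... | no ¬p | no ¬p′ = ⊥-elim (stuck (tight-end (d ⁅ v ⁆) (b ⁅ v ⁆) (tame-⁅⁆ v v∈) ¬p ¬p′))
    where
    stuck : d ⁅ v ⁆ ≡ 4 × b ⁅ v ⁆ ≡ 0₃ → ⊥
    stuck (dv , bv) = Split.split v∈ dv bv rest

  inner-edge-deletion : ∀ {u w F′} s → PickE u w F F′ → u ∈ W → w ∈ W → Spare-at (not s) u → Spare-at s w → ⊥
  inner-edge-deletion {u} {w} s p u∈ w∈ spu spw = edge-deletion s p (λ _ → spu) (λ _ → spw) low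
    where
    low : ∀ S → S ⊆ W → Nonempty S → S u ≢ S w → cnt S P ≤ cut S F
    low S S⊆ ne ≢ with decide-∈ S u | decide-∈ S w
    ... | inj₁ eu | inj₁ ew = ⊥-elim (≢ (trans eu (sym ew)))
    ... | inj₂ eu | inj₂ ew = ⊥-elim (≢ (trans eu (sym ew)))
    ... | inj₁ eu | inj₂ ew = cnt≤cut S S⊆ ne (w , ∈∖ W S w w∈ ew)
    ... | inj₂ eu | inj₁ ew = cnt≤cut S S⊆ ne (u , ∈∖ W S u u∈ eu)

  -- Without an edge between X and its complement in W, both parts, having no more tip edges than
  -- cut edges each, would add up to the same for W.
  connected : cut W F < cnt W P → ∀ X → X ⊆ W → Nonempty X → Nonempty (W ∖ X) → ∃[ u ] ∃[ w ] ∃[ F′ ] PickE u w F F′ × u ∈ W ∩ X × w ∈ W ∖ X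
  connected lt X X⊆ ne (y , y∈) = joining-edge W X F (lin 8 (λ cX cY cW j pX pY pW z → (cX ⊕ cY ≈ cW ⊕ (j ⊕ j)) ∷ (pX ⊕ pY ≈ pW) ∷ (pX ≼ cX) ∷ (pY ≼ cY) ∷ (# 1 ⊕ cW ≼ pW) ∷ [] ⊢ (# 1 ≼ j))
      (cut (W ∩ X) F) (cut (W ∖ X) F) (cut W F) (joins W X F) (cnt (W ∩ X) P) (cnt (W ∖ X) P) (cnt W P) 0
      (cut-split W X F) (cnt-split W X P)
      (subst₂ _≤_ (sym (cnt-cong W∩X P)) (sym (cut-cong W∩X F)) (cnt≤cut X X⊆ ne (y , y∈)))
      (cnt≤cut (W ∖ X) (∖⊆ W X) (y , y∈) (proj₁ ne , ∈∖ W (W ∖ X) (proj₁ ne) (X⊆ _ (proj₂ ne)) (∉∖ W X (proj₁ ne) (proj₂ ne)))) lt)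
    where
    W∩X : (W ∩ X) ≗ X
    W∩X = ∩-⊆ W X X⊆

  root-edge : Nonempty W → (∀ {v} → v ∈ W → Nonempty (W ∖ ⁅ v ⁆)) → cnt W P ≤ cut W F → ⊥
  root-edge ne rest le with crossing-edge W F (lin 3 (λ c p t → (p ≼ c) ∷ (# 4 ⊕ t ≼ c ⊕ p) ∷ [] ⊢ (# 1 ≼ c)) (cut W F) (cnt W P) (t W) le (tame W (λ _ e → e) ne))
  ... | u , w , F′ , p , u∈ , w∉ = delete (spare-some u∈ (rest u∈))
    where
    low : ∀ S → S ⊆ W → Nonempty S → S u ≢ S w → cnt S P ≤ cut S F
    low S S⊆ neS _ with nonempty? (W ∖ S)
    ... | yes ne′ = cnt≤cut S S⊆ neS ne′
    ... | no none = subst₂ _≤_ (cnt-cong W≗S P) (cut-cong W≗S F) le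
      where
      W≗S : W ≗ S
      W≗S = ≗-∖-empty W S S⊆ none
    delete : ∃[ s ] Spare-at s u → ⊥
    delete (true , sp) = edge-deletion false p (λ _ → sp) (λ w∈ → ⊥-elim (true≢false w∈ w∉)) low
    delete (false , sp) = edge-deletion true p (λ _ → sp) (λ w∈ → ⊥-elim (true≢false w∈ w∉)) low

  -- All tip edges have sign s, and no vertex may lose an edge of sign s. Modulo 3, a tip edge of sign
  -- s acts like two tip edges of the opposite sign; after this replacement at v, an edge at v can be
  -- deleted.
  module Monochrome {v s P₀} (tip : Pick (v , s) P P₀) (v∈W : v ∈ W) (rest : Nonempty (W ∖ ⁅ v ⁆))
    (scarce : ∀ u → u ∈ W → ¬ Spare-at s u) (spare : ∀ u → u ∈ W → Spare-at (not s) u)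
    (pure : sgn (not s) W P ≡ 0) (lt : cut W F < cnt W P) where

    -- The excess of W is positive, and an excess of two would require both signs.
    cnt-W : cnt W P ≡ cut W F + 1
    cnt-W with cnt W P ℕ.≟ cut W F + 2
    ... | yes e = ⊥-elim (<⇒≱ (mixed W (λ _ e → e) (v , v∈W) e (not s)) (≤-reflexive pure))
    ... | no ≢ = ≤-antisym (≤-pred (≤-trans (≤∧≢⇒< (tall W (λ _ e → e) (v , v∈W)) ≢) (≤-reflexive (+-suc _ 1)))) (≤-trans (≤-reflexive (+-comm _ 1)) lt)

    -- Equality at a proper subset would force the excess of W to be two.
    proper-low : ∀ S → S ⊆ W → Nonempty S → Nonempty (W ∖ S) → cnt S P + 1 ≤ cut S F
    proper-low S S⊆ ne ne′ with cnt S P ℕ.≟ cut S F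
    ... | yes e = ⊥-elim (lin 2 (λ c p → (p ≈ c ⊕ # 2) ∷ (p ≈ c ⊕ # 1) ∷ [] ⊢ absurd) (cut W F) (cnt W P) (cnt≡cut⇒tight S⊆ ne ne′ e) cnt-W)
    ... | no ≢ = ≤-trans (≤-reflexive (+-comm _ 1)) (≤∧≢⇒< (cnt≤cut S S⊆ ne ne′) ≢)

    module _ {u F′} (p : PickE u v F F′) (u∈W : u ∈ W) (u≢v : u ≢ v) where

      ρ′ : List (Charge n)
      ρ′ = (u , q s) ∷ (v , q (not s)) ∷ ρ

      -- The exchange leaves the pull on v unchanged modulo 3 and raises its degree by one. That
      -- makes up for the degree lost with the deleted edge, whose sign s the vertex v could not
      -- spare by itself; altogether one edge of sign s is reversed at v, which `reversal` permits.
      P′ : List (Tip n)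
      P′ = (v , not s) ∷ (v , not s) ∷ P₀

      reduced : Inst W F′ ρ′ P′
      reduced S S⊆ ne = by-case (S u) (S v) refl refl (cut-pickE S p) (sum-pick (at S) tip) refl refl
          (cong (ev S ρ +₃_) (sum₃-pick (pull S) tip))
        where
        neither : ∀ e p → (0₃ +₃ (0₃ +₃ e)) +₃ (0₃ +₃ (0₃ +₃ p)) ≡ e +₃ (0₃ +₃ p)
        neither = from-yes (all? λ e → all? λ p → ((0₃ +₃ (0₃ +₃ e)) +₃ (0₃ +₃ (0₃ +₃ p))) ≟ (e +₃ (0₃ +₃ p)))
        only-u : ∀ s e p → e +₃ (0₃ +₃ p) ≡ q (not s) +₃ ((q s +₃ (0₃ +₃ e)) +₃ (0₃ +₃ (0₃ +₃ p)))
        only-u = from-yes (∀Bool? λ s → all? λ e → all? λ p → (e +₃ (0₃ +₃ p)) ≟ (q (not s) +₃ ((q s +₃ (0₃ +₃ e)) +₃ (0₃ +₃ (0₃ +₃ p)))))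
        only-v : ∀ s e p → (0₃ +₃ (q (not s) +₃ e)) +₃ (q (not s) +₃ (q (not s) +₃ p)) ≡ q (not s) +₃ (e +₃ (q s +₃ p))
        only-v = from-yes (∀Bool? λ s → all? λ e → all? λ p → ((0₃ +₃ (q (not s) +₃ e)) +₃ (q (not s) +₃ (q (not s) +₃ p))) ≟ (q (not s) +₃ (e +₃ (q s +₃ p))))
        W∖S : ∀ {x} → x ∈ W → x ∉ S → Nonempty (W ∖ S)
        W∖S {x} x∈ x∉ = x , ∈∖ W S x x∈ x∉
        tame-v : v ∈ S → 4 + τ (d S) (q (not s) +₃ b S) ≤ d S
        tame-v v∈ with loneOr S S⊆ v∈
        ... | inj₁ roomy = lin 3 (λ d t t′ → (# 6 ⊕ t ≼ d) ∷ (t′ ≼ # 2 ⊕ t) ∷ [] ⊢ (# 4 ⊕ t′ ≼ d)) (d S) (t S) (τ (d S) (q (not s) +₃ b S)) roomy (τ≤2+τ (d S) (b S) _)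
        ... | inj₂ eq = subst₂ (λ k c → 4 + τ k (q (not s) +₃ c) ≤ k) (deg-cong eq F P) (bd-cong eq ρ P)
          (reversal s (d ⁅ v ⁆) (b ⁅ v ⁆) (tame-⁅⁆ v v∈W) (scarce v v∈W) (spare v v∈W))
        by-case : ∀ a c → S u ≡ a → S v ≡ c → cut S F ≡ ⟨ a xor c ⟩ + cut S F′ → cnt S P ≡ ⟨ c ⟩ + cnt S P₀ →
          cnt S P′ ≡ ⟨ c ⟩ + (⟨ c ⟩ + cnt S P₀) →
          bd S ρ′ P′ ≡ (a ⋆ q s +₃ (c ⋆ q (not s) +₃ ev S ρ)) +₃ (c ⋆ q (not s) +₃ (c ⋆ q (not s) +₃ pulls S P₀)) →
          b S ≡ ev S ρ +₃ (c ⋆ q s +₃ pulls S P₀) → Good F′ ρ′ P′ S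
        by-case false false eu ev′ cF cP cP′ b′ b₀ = Good-transport F F′ ρ ρ′ P P′ S S (sym cF) (trans cP′ (sym cP)) sgns
            (trans b′ (trans (neither (ev S ρ) (pulls S P₀)) (sym b₀))) (inst S S⊆ ne)
          where
          sgns : ∀ s′ → sgn s′ S P′ ≡ sgn s′ S P
          sgns s′ = trans (cong (λ a → ⟨ a ∧ same s′ (not s) ⟩ + (⟨ a ∧ same s′ (not s) ⟩ + sgn s′ S P₀)) ev′)
            (sym (trans (sum-pick (atSign s′ S) tip) (cong (λ a → ⟨ a ∧ same s′ s ⟩ + sgn s′ S P₀) ev′)))
        by-case true false eu ev′ cF cP cP′ b′ b₀ = good
          (deletion-tame u (not s) S F′ ρ′ P′ S⊆ eu (spare u u∈W) (cong₂ _+_ cF (trans cP (sym cP′)))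
            (trans b₀ (trans (only-u s (ev S ρ) (pulls S P₀)) (cong (q (not s) +₃_) (sym b′)))))
          (strict-tall F′ P′ S (lin 5 (λ c c′ p p′ p₀ → (c ≈ # 1 ⊕ c′) ∷ (p ≈ p₀) ∷ (p′ ≈ p₀) ∷ (p ⊕ # 1 ≼ c) ∷ [] ⊢ (p′ ≼ c′ ⊕ # 1))
            (cut S F) (cut S F′) (cnt S P) (cnt S P′) (cnt S P₀) cF cP cP′ (proper-low S S⊆ ne (W∖S v∈W ev′))))
        by-case false true eu ev′ cF cP cP′ b′ b₀ = good
          (subst₂ (λ k c → 4 + τ k c ≤ k)
            (lin 5 (λ c c′ p p′ p₀ → (c ≈ # 1 ⊕ c′) ∷ (p ≈ # 1 ⊕ p₀) ∷ (p′ ≈ # 2 ⊕ p₀) ∷ [] ⊢ (c ⊕ p ≈ c′ ⊕ p′)) (cut S F) (cut S F′) (cnt S P) (cnt S P′) (cnt S P₀) cF cP cP′)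
            (sym (trans b′ (trans (only-v s (ev S ρ) (pulls S P₀)) (cong (q (not s) +₃_) (sym b₀))))) (tame-v ev′))
          (strict-tall F′ P′ S (lin 5 (λ c c′ p p′ p₀ → (c ≈ # 1 ⊕ c′) ∷ (p ≈ # 1 ⊕ p₀) ∷ (p′ ≈ # 2 ⊕ p₀) ∷ (p ⊕ # 1 ≼ c) ∷ [] ⊢ (p′ ≼ c′ ⊕ # 1))
            (cut S F) (cut S F′) (cnt S P) (cnt S P′) (cnt S P₀) cF cP cP′ (proper-low S S⊆ ne (W∖S u∈W eu))))
        by-case true true eu ev′ cF cP cP′ b′ b₀ = good
            (lin 6 (λ d t d′ t′ x y → (# 6 ⊕ t ≼ d) ∷ (d′ ≈ # 1 ⊕ d) ∷ (t′ ≼ # 3) ∷ [] ⊢ (# 4 ⊕ t′ ≼ d′)) (d S) (t S) (deg S F′ P′) (τ (deg S F′ P′) (bd S ρ′ P′)) 0 0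
              (roomy′ S S⊆ eu ev′ u≢v) deg-up (τ≤3 (deg S F′ P′) (bd S ρ′ P′)))
            tall′
          where
          cut-same : cut S F ≡ cut S F′
          cut-same = cF
          cnt-P : cnt S P ≡ 1 + cnt S P₀
          cnt-P = cP
          cnt-P′ : cnt S P′ ≡ 1 + cnt S P
          cnt-P′ = trans cP′ (cong suc (sym cnt-P))
          deg-up : deg S F′ P′ ≡ 1 + d S
          deg-up = trans (cong₂ _+_ (sym cut-same) cnt-P′) (+-suc _ _)
          tall′ : Tall F′ P′ S
          tall′ with nonempty? (W ∖ S)
          ... | yes ne′ = strict-tall F′ P′ S (lin 4 (λ c c′ p p′ → (c ≈ c′) ∷ (p′ ≈ # 1 ⊕ p) ∷ (p ⊕ # 1 ≼ c) ∷ [] ⊢ (p′ ≼ c′ ⊕ # 1)) (cut S F) (cut S F′) (cnt S P) (cnt S P′) cut-same cnt-P′ (proper-low S S⊆ ne ne′))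
          ... | no none = ≤-reflexive (lin 4 (λ c c′ p p′ → (c ≈ c′) ∷ (p′ ≈ # 1 ⊕ p) ∷ (p ≈ c ⊕ # 1) ∷ [] ⊢ (p′ ≈ c′ ⊕ # 2)) (cut S F) (cut S F′) (cnt S P) (cnt S P′) cut-same cnt-P′ cnt-S) ,
              λ _ → both s pos-s pos-not-s
            where
            W≗S : W ≗ S
            W≗S = ≗-∖-empty W S S⊆ none
            cnt-S : cnt S P ≡ cut S F + 1
            cnt-S = trans (sym (cnt-cong W≗S P)) (trans cnt-W (cong (_+ 1) (cut-cong W≗S F)))
            total : ∀ s → sgn s S P + sgn (not s) S P ≡ cnt S P
            total true = cnt-sgn S P
            total false = trans (+-comm (sgn false S P) _) (cnt-sgn S P)
            sgn-tip : sgn s S P ≡ 1 + sgn s S P₀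
            sgn-tip = trans (sum-pick (atSign s S) tip) (trans (cong (λ a → ⟨ a ∧ same s s ⟩ + sgn s S P₀) ev′) (same-1 s))
              where
              same-1 : ∀ s {k} → ⟨ same s s ⟩ + k ≡ 1 + k
              same-1 true = refl
              same-1 false = refl
            -- W has one more tip edge than cut edges and degree at least 4, hence at least three
            -- tip edges. All have sign s, and only one was exchanged.
            pos-s : 1 ≤ sgn s S P′
            pos-s = ≤-trans (lin 7 (λ c p t a a₀ z x → (# 4 ⊕ t ≼ c ⊕ p) ∷ (p ≈ c ⊕ # 1) ∷ (a ≈ # 1 ⊕ a₀) ∷ (a ⊕ z ≈ p) ∷ (z ≈ # 0) ∷ [] ⊢ (# 1 ≼ a₀))
                (cut S F) (cnt S P) (t S) (sgn s S P) (sgn s S P₀) (sgn (not s) S P) 0 (tame S S⊆ ne) cnt-S sgn-tip (total s)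
                (trans (sym (sgn-cong (not s) W≗S P)) pure))
              (≤-trans (m≤n+m _ (atSign s S (v , not s))) (m≤n+m _ (atSign s S (v , not s))))
            pos-not-s : 1 ≤ sgn (not s) S P′
            pos-not-s = subst (λ a → 1 ≤ ⟨ a ∧ same (not s) (not s) ⟩ + (atSign (not s) S (v , not s) + sgn (not s) S P₀)) (sym ev′) (same-pos (not s))
  
      replaced : ⊥
      replaced = smaller W F′ ρ′ P′
        (lin 5 (λ f f′ p p₀ z → (f ≈ # 1 ⊕ f′) ∷ (p ≈ # 1 ⊕ p₀) ∷ [] ⊢ (# 1 ⊕ (f′ ⊕ f′ ⊕ (# 2 ⊕ p₀)) ≼ f ⊕ f ⊕ p)) (length F) (length F′) (length P) (length P₀) 0 (length-pickE p) (length-pick tip))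
        reduced λ fl → noflow (Flow-⇛ (⇛-pick p) (Flow-sign s fl))

    contradiction : ⊥
    contradiction with connected lt ⁅ v ⁆ (⁅⁆⊆ W v∈W) (v , ∈⁅⁆ v) rest
    ... | u , w , F′ , p , u∈ , w∈ with ∈⁅⁆⇒≡ v u (∩⊆ʳ W ⁅ v ⁆ u u∈)
    ...   | refl = replaced (PickE-sym p) (∖⊆ W ⁅ v ⁆ w w∈) λ { refl → true≢false (∈⁅⁆ v) (∖∉ W ⁅ v ⁆ v w∈) }

  module Classified (ne : Nonempty W) (rest : ∀ {v} → v ∈ W → Nonempty (W ∖ ⁅ v ⁆)) (sp : Bool → Fin n → Bool)
    (sp-true : ∀ s v → sp s v ≡ true → Spare-at s v) (true-sp : ∀ s v → Spare-at s v → sp s v ≡ true) where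

    v₀ : Fin n
    v₀ = proj₁ ne

    agree : Bool → Bool → Bool
    agree true c = c
    agree false c = not c

    agree⇒≡ : ∀ a c → agree a c ≡ true → a ≡ c
    agree⇒≡ true true e = refl
    agree⇒≡ false false e = refl

    -- The vertices of W that can spare the same signs as `v₀`. As W is connected once the tip edges
    -- outnumber the cut, either an edge leaves this class or the class is all of W.
    X : VSet n
    X w = W w ∧ (agree (sp true w) (sp true v₀) ∧ agree (sp false w) (sp false v₀))

    X⊆W : X ⊆ W
    X⊆W w = ∩⊆ˡ W (λ w → agree (sp true w) (sp true v₀) ∧ agree (sp false w) (sp false v₀)) w

    X-class : ∀ w → w ∈ X → ∀ s → sp s w ≡ sp s v₀
    X-class w w∈ true = agree⇒≡ _ _ (∩⊆ˡ (λ w → agree (sp true w) (sp true v₀)) (λ w → agree (sp false w) (sp false v₀)) w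
      (∩⊆ʳ W (λ w → agree (sp true w) (sp true v₀) ∧ agree (sp false w) (sp false v₀)) w w∈))
    X-class w w∈ false = agree⇒≡ _ _ (∩⊆ʳ (λ w → agree (sp true w) (sp true v₀)) (λ w → agree (sp false w) (sp false v₀)) w
      (∩⊆ʳ W (λ w → agree (sp true w) (sp true v₀) ∧ agree (sp false w) (sp false v₀)) w w∈))

    v₀∈X : v₀ ∈ X
    v₀∈X = cong₂ _∧_ (proj₂ ne) (cong₂ _∧_ (agree-refl (sp true v₀)) (agree-refl (sp false v₀)))
      where
      agree-refl : ∀ a → agree a a ≡ true
      agree-refl true = refl
      agree-refl false = refl

    spare-sp : ∀ {v} → v ∈ W → ∃[ s ] sp s v ≡ true
    spare-sp {v} v∈ with spare-some v∈ (rest v∈)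
    ... | s , p = s , true-sp s v p

    -- An edge has opposite signs at its two ends, and each end can spare some sign. It can be
    -- deleted unless both ends spare just one sign, the same one; but then they are in one class.
    class-edge : ∀ {u w F′} → PickE u w F F′ → u ∈ X → w ∈ W ∖ X → ⊥
    class-edge {u} {w} p u∈ w∈ = choose (sp true u) (sp false u) (sp true w) (sp false w) refl refl refl refl
      where
      w∈W = ∖⊆ W X w w∈
      u∈W = X⊆W u u∈
      delete : ∀ s → sp (not s) u ≡ true → sp s w ≡ true → ⊥
      delete s e e′ = inner-edge-deletion s p u∈W w∈W (sp-true (not s) u e) (sp-true s w e′)
      differ : sp true w ≡ sp true u → sp false w ≡ sp false u → ⊥
      differ e e′ = true≢false (cong₂ _∧_ w∈W (cong₂ _∧_ (same-agree (trans e (X-class u u∈ true))) (same-agree (trans e′ (X-class u u∈ false))))) (∖∉ W X w w∈)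
        where
        same-agree : ∀ {a c} → a ≡ c → agree a c ≡ true
        same-agree {true} refl = refl
        same-agree {false} refl = refl
      none : ∀ {v} → v ∈ W → sp true v ≡ false → sp false v ≡ false → ⊥
      none {v} v∈ e e′ with spare-sp v∈
      ... | true , h = true≢false h e
      ... | false , h = true≢false h e′
      choose : ∀ a c e f → sp true u ≡ a → sp false u ≡ c → sp true w ≡ e → sp false w ≡ f → ⊥
      choose true c e true pu _ _ pw = delete false pu pw
      choose a true true f _ pu pw _ = delete true pu pw
      choose true false true false p q r s = differ (trans r (sym p)) (trans s (sym q))
      choose false true false true p q r s = differ (trans r (sym p)) (trans s (sym q))
      choose false false e f p q _ _ = none u∈W p q
      choose a c false false _ _ r s = none w∈W r s

    contradiction : ⊥
    contradiction with cnt W P ≤? cut W F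
    ... | yes le = root-edge ne rest le
    ... | no ¬le = uniform (nonempty? (W ∖ X))
      where
      lt : cut W F < cnt W P
      lt = ≰⇒> ¬le
      no-such-tip : ∀ {v s P′} → Pick (v , s) P P′ → v ∈ W → sp s v ≡ false
      no-such-tip {v} {s} p v∈ with sp s v in e
      ... | false = refl
      ... | true = ⊥-elim (tip-deletion p (sp-true s v e))
      uniform : Dec (Nonempty (W ∖ X)) → ⊥
      uniform (yes ne′) with connected lt X X⊆W (v₀ , v₀∈X) ne′
      ... | u , w , F′ , p , u∈ , w∈ = class-edge p (∩⊆ʳ W X u u∈) w∈
      uniform (no none) with sum-positive (at W) P (≤-trans (s≤s z≤n) lt)
      -- A tip edge of a sign that its end can spare would be deleted. So no vertex of the class
      -- spares the sign s found here, every vertex spares the other one, and no tip edge of that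
      -- other sign exists.
      ... | (v , s) , P₀ , tip , pos = Monochrome.contradiction tip v∈ (rest v∈) scarce spare pure lt
        where
        v∈ : v ∈ W
        v∈ = positive-∈ (W v) pos
          where
          positive-∈ : ∀ b → 1 ≤ ⟨ b ⟩ → b ≡ true
          positive-∈ true _ = refl
        W⊆X : W ⊆ X
        W⊆X = ∖-empty W X none
        class : ∀ {u w} s′ → u ∈ W → w ∈ W → sp s′ u ≡ sp s′ w
        class {u} {w} s′ u∈ w∈ = trans (X-class u (W⊆X u u∈) s′) (sym (X-class w (W⊆X w w∈) s′))
        scarce : ∀ u → u ∈ W → ¬ Spare-at s u
        scarce u u∈ p = true≢false (true-sp s u p) (trans (class s u∈ v∈) (no-such-tip tip v∈))
        spare : ∀ u → u ∈ W → Spare-at (not s) u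
        spare u u∈ with spare-some u∈ (rest u∈)
        ... | s′ , p = pick s s′ p (scarce u u∈)
          where
          pick : ∀ s s′ → Spare-at s′ u → ¬ Spare-at s u → Spare-at (not s) u
          pick true false p _ = p
          pick false true p _ = p
          pick true true p ¬p = ⊥-elim (¬p p)
          pick false false p ¬p = ⊥-elim (¬p p)
        pure : sgn (not s) W P ≡ 0
        pure with 1 ≤? sgn (not s) W P
        ... | no ¬h = n≤0⇒n≡0 (≤-pred (≰⇒> ¬h))
        ... | yes h with sum-positive (atSign (not s) W) P h
        ...   | (v′ , s′) , P₁ , tip′ , pos′ = ⊥-elim (other tip′ (decode s s′ (W v′) pos′))
          where
          decode : ∀ s s′ b → 1 ≤ ⟨ b ∧ same (not s) s′ ⟩ → b ≡ true × s′ ≡ not s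
          decode true false true _ = refl , refl
          decode false true true _ = refl , refl
          other : ∀ {v′ s′ P₁} → Pick (v′ , s′) P P₁ → W v′ ≡ true × s′ ≡ not s → ⊥
          other {v′} tip′ (v′∈ , refl) = true≢false (true-sp (not s) v′ (spare v′ v′∈)) (no-such-tip tip′ v′∈)

  large : Nonempty W → (∀ {v} → v ∈ W → Nonempty (W ∖ ⁅ v ⁆)) → ⊥
  large ne rest = Classified.contradiction ne rest (λ s v → does (spare? s (d ⁅ v ⁆) (b ⁅ v ⁆)))
    (λ s v → witness (spare? s (d ⁅ v ⁆) (b ⁅ v ⁆))) (λ s v → dec-true (spare? s (d ⁅ v ⁆) (b ⁅ v ⁆)))

-- Base cases and the induction.

module _ {n : ℕ} where

  net-empty : ∀ (S : VSet n) D → (∀ v → v ∉ S) → net S D ≡ 0₃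
  net-empty S D h = trans (net-cong h D) (sum₃-0 (λ _ → refl) D)

  Balanced-empty : ∀ (S : VSet n) D ρ → (∀ v → v ∉ S) → Balanced S D ρ
  Balanced-empty S D ρ h = balanced (cong₂ _+₃_ (net-empty S D h) (trans (ev-cong h ρ) (sum₃-0 (λ _ → refl) ρ)))

  ⊳-refl : ∀ (F : List (Edge n)) → F ⊳ F
  ⊳-refl [] = []
  ⊳-refl ((u , w) ∷ F) = keep (⊳-refl F)

  empty-∉ : ∀ (S : VSet n) → ¬ Nonempty S → ∀ v → v ∉ S
  empty-∉ S none v with decide-∈ S v
  ... | inj₁ e = ⊥-elim (none (v , e))
  ... | inj₂ e = e

  -- With one free edge the outflow may be any nonzero element of Z3, with more edges it is arbitrary.
  Reachable : ℕ → Z3 → Set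
  Reachable k r = (k ≡ 0 → r ≡ 0₃) × (k ≡ 1 → r ≢ 0₃)

  reachable-step : ∀ k r → Reachable (suc k) r → ∃[ s ] Reachable k (q s +₃ r)
  reachable-step 0 0₃ (_ , h) = ⊥-elim (h refl refl)
  reachable-step 0 1₃ _ = true , (λ _ → refl) , λ ()
  reachable-step 0 2₃ _ = false , (λ _ → refl) , λ ()
  reachable-step 1 0₃ _ = true , (λ ()) , λ _ ()
  reachable-step 1 1₃ _ = false , (λ ()) , λ _ ()
  reachable-step 1 2₃ _ = true , (λ ()) , λ _ ()
  reachable-step (suc (suc k)) r _ = true , (λ ()) , λ ()

  reach : ∀ S (F : List (Edge n)) r → Reachable (cut S F) r → ∃[ D ] F ⊳ D × net S D +₃ r ≡ 0₃
  reach S [] r (h , _) = [] , [] , trans (+₃-identityˡ r) (h refl)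
  reach S ((u , w) ∷ F) r h = by-case (S u) (S w) refl refl h
    where
    extend : ∀ D′ a D → arc S a ≡ D → net S D′ +₃ (D +₃ r) ≡ 0₃ → net S (a ∷ D′) +₃ r ≡ 0₃
    extend D′ a c refl e = trans (cong (_+₃ r) (+₃-comm (arc S a) (net S D′))) (trans (+₃-assoc (net S D′) (arc S a) r) e)
    by-case : ∀ a c → S u ≡ a → S w ≡ c → Reachable (⟨ a xor c ⟩ + cut S F) r → ∃[ D ] (u , w) ∷ F ⊳ D × net S D +₃ r ≡ 0₃
    by-case true true eu ew h with reach S F r h
    ... | D , o , e = _ , keep o , extend D (u , w) 0₃ (cong₂ (λ a c → a ⋆ 2₃ +₃ c ⋆ 1₃) eu ew) (trans (cong (net S D +₃_) (+₃-identityˡ r)) e)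
    by-case false false eu ew h with reach S F r h
    ... | D , o , e = _ , keep o , extend D (u , w) 0₃ (cong₂ (λ a c → a ⋆ 2₃ +₃ c ⋆ 1₃) eu ew) (trans (cong (net S D +₃_) (+₃-identityˡ r)) e)
    by-case true false eu ew h with reachable-step (cut S F) r h
    ... | true , h′ with reach S F (2₃ +₃ r) h′
    ...   | D , o , e = _ , keep o , extend D (u , w) 2₃ (cong₂ (λ a c → a ⋆ 2₃ +₃ c ⋆ 1₃) eu ew) e
    by-case true false eu ew h | false , h′ with reach S F (1₃ +₃ r) h′
    ...   | D , o , e = _ , flip o , extend D (w , u) 1₃ (cong₂ (λ a c → c ⋆ 2₃ +₃ a ⋆ 1₃) eu ew) e
    by-case false true eu ew h with reachable-step (cut S F) r h
    ... | true , h′ with reach S F (2₃ +₃ r) h′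
    ...   | D , o , e = _ , flip o , extend D (w , u) 2₃ (cong₂ (λ a c → c ⋆ 2₃ +₃ a ⋆ 1₃) eu ew) e
    by-case false true eu ew h | false , h′ with reach S F (1₃ +₃ r) h′
    ...   | D , o , e = _ , keep o , extend D (u , w) 1₃ (cong₂ (λ a c → a ⋆ 2₃ +₃ c ⋆ 1₃) eu ew) e

  mixed-pulls-≢0 : ∀ i o → 1 ≤ i → 1 ≤ o → i + o ≡ 3 → m₃ o +₃ (m₃ i +₃ m₃ i) ≢ 0₃
  mixed-pulls-≢0 1 2 _ _ _ ()
  mixed-pulls-≢0 2 1 _ _ _ ()
  mixed-pulls-≢0 (suc (suc (suc i))) (suc o) _ _ e = ⊥-elim (1+n≢0 (trans (sym (+-suc i o)) (suc-injective (suc-injective (suc-injective e)))))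
  mixed-pulls-≢0 1 (suc (suc (suc o))) _ _ ()
  mixed-pulls-≢0 2 (suc (suc o)) _ _ ()

  -- A tall and tame vertex has a cut edge. If it has only one, then it has exactly three tip edges,
  -- of both signs, and boundary 0; the pull of such tip edges is not 0, so neither is the charge,
  -- and one edge can carry it.
  single-flow : ∀ {W : VSet n} {F ρ P v} → Inst W F ρ P → v ∈ W → ¬ Nonempty (W ∖ ⁅ v ⁆) → Flow W F ρ
  single-flow {W} {F} {ρ} {P} {v} inst v∈ none = use (reach ⁅ v ⁆ F (ev ⁅ v ⁆ ρ) (zero-edges , one-edge))
    where
    g : Good F ρ P ⁅ v ⁆
    g = inst ⁅ v ⁆ (⁅⁆⊆ W v∈) (v , ∈⁅⁆ v)
    c = cut ⁅ v ⁆ F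
    p = cnt ⁅ v ⁆ P
    t = τ (deg ⁅ v ⁆ F P) (bd ⁅ v ⁆ ρ P)
    zero-edges : c ≡ 0 → ev ⁅ v ⁆ ρ ≡ 0₃
    zero-edges e = ⊥-elim (lin 3 (λ c p t → (c ≈ # 0) ∷ (p ≼ c ⊕ # 2) ∷ (# 4 ⊕ t ≼ c ⊕ p) ∷ [] ⊢ absurd) c p t e (proj₁ (isTall g)) (isTame g))
    one-edge : c ≡ 1 → ev ⁅ v ⁆ ρ ≢ 0₃
    one-edge e ev≡0 = mixed-pulls-≢0 (sgn true ⁅ v ⁆ P) (sgn false ⁅ v ⁆ P) (mix true) (mix false) (trans (cnt-sgn ⁅ v ⁆ P) p≡3)
        (trans (sym (pulls-sgn ⁅ v ⁆ P)) (trans (sym (+₃-identityˡ (pulls ⁅ v ⁆ P))) (trans (cong (_+₃ pulls ⁅ v ⁆ P) (sym ev≡0)) (τ-zero (bd ⁅ v ⁆ ρ P) t-zero))))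
      where
      p≡3 : p ≡ 3
      p≡3 = lin 3 (λ c p t → (c ≈ # 1) ∷ (p ≼ c ⊕ # 2) ∷ (# 4 ⊕ t ≼ c ⊕ p) ∷ [] ⊢ (p ≈ # 3)) c p t e (proj₁ (isTall g)) (isTame g)
      mix : Mixed P ⁅ v ⁆
      mix = proj₂ (isTall g) (trans p≡3 (cong (_+ 2) (sym e)))
      t-zero : τ 4 (bd ⁅ v ⁆ ρ P) ≡ 0
      t-zero = trans (cong (λ k → τ k (bd ⁅ v ⁆ ρ P)) (sym (cong₂ _+_ e p≡3)))
        (lin 3 (λ c p t → (c ≈ # 1) ∷ (p ≼ c ⊕ # 2) ∷ (# 4 ⊕ t ≼ c ⊕ p) ∷ [] ⊢ (t ≈ # 0)) c p t e (proj₁ (isTall g)) (isTame g))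
      τ-zero : ∀ b → τ 4 b ≡ 0 → b ≡ 0₃
      τ-zero 0₃ _ = refl
      τ-zero (suc _) ()
    use : ∃[ D ] F ⊳ D × net ⁅ v ⁆ D +₃ ev ⁅ v ⁆ ρ ≡ 0₃ → Flow W F ρ
    use (D , o , e) = D , o , bal
      where
      bal : ∀ S → S ⊆ W → Balanced S D ρ
      bal S S⊆ with nonempty? S
      ... | no empty = Balanced-empty S D ρ (empty-∉ S empty)
      ... | yes (w , w∈) = Balanced-cong (≗-⊆ ⁅ v ⁆ S (⁅⁆⊆ S v∈S) (λ u u∈ → trans (alone W v∈ none u) (S⊆ u u∈))) (balanced e)
        where
        v∈S : v ∈ S
        v∈S = subst (_∈ S) (sym (∈⁅⁆⇒≡ v w (trans (alone W v∈ none w) (S⊆ w w∈)))) w∈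

  two-vertices : ∀ (W : VSet n) v w → v ∈ W → w ∈ W ∖ ⁅ v ⁆ → ∀ u → u ∈ W → Nonempty (W ∖ ⁅ u ⁆)
  two-vertices W v w v∈ w∈ u u∈ with u ≟ v
  ... | yes refl = w , w∈
  ... | no u≢v = v , ∈∖ W ⁅ u ⁆ v v∈ (∉⁅⁆ u v u≢v)

  flow-exists : ∀ m W F ρ P → size F P < m → Inst W F ρ P → ¬ ¬ Flow W F ρ
  flow-exists (suc m) W F ρ P lt inst noflow with nonempty? W
  ... | no empty = noflow (F , ⊳-refl F , λ S S⊆ → Balanced-empty S F ρ (λ v → ⊆-false S⊆ v (empty-∉ W empty v)))
  ... | yes (v , v∈) with nonempty? (W ∖ ⁅ v ⁆)
  ...   | no none = noflow (single-flow inst v∈ none)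
  ...   | yes (w , w∈) = Step.large m (flow-exists m) W F ρ P lt inst noflow (v , v∈) λ {u} → two-vertices W v w v∈ w∈ u

-- From single vertices and W to all vertex sets, by criticality.

small-degree : ∀ d b → d < 4 + τ d b → d ≤ 5
small-degree d b lt with d ≤? 5
... | yes h = h
-- Since τ is at most 3, the degree would have to be 6, where parity leaves τ at most 2.
... | no ¬h = ⊥-elim (not-six b (subst (λ k → k < 4 + τ k b) (≤-antisym (≤-pred (≤-trans lt (+-monoʳ-≤ 4 (τ≤3 d b)))) (≰⇒> ¬h)) lt))
  where
  not-six : ∀ b → 6 < 4 + τ 6 b → ⊥
  not-six 0₃ (s≤s (s≤s (s≤s (s≤s ()))))
  not-six (suc _) (s≤s (s≤s (s≤s (s≤s (s≤s (s≤s ()))))))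

module Critical {n : ℕ} (W : VSet n) (F : List (Edge n)) (ρ : List (Charge n)) (P : List (Tip n)) (noflow : ¬ Flow W F ρ)
  (vertex-tame : ∀ v → v ∈ W → Tame F ρ P ⁅ v ⁆)
  (whole-tall : Tall F P W)
  (contract-in : ∀ B → B ⊆ W → ∀ u v → u ∈ B → v ∈ B → u ≢ v →
    ∃[ D ] outer B F ⊳ D × (∀ S → S ⊆ W → B ⊆ S ⊎ (∀ v → v ∈ S → v ∉ B) → Balanced S D ρ))
  (contract-out : ∀ B → B ⊆ W → Nonempty B → Nonempty (W ∖ B) →
    ∃[ D ] outer (∁ B) F ⊳ D × (∀ S → S ⊆ B → Balanced S D ρ)) where

  no-inst : ∀ (W′ : VSet n) F′ ρ′ P′ → Inst W′ F′ ρ′ P′ → ¬ ¬ Flow W′ F′ ρ′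
  no-inst W′ F′ ρ′ P′ = flow-exists (suc (size F′ P′)) W′ F′ ρ′ P′ ≤-refl

  -- A minimal set S that is not tame has degree at most 5, while every proper part has degree at
  -- least 4. This difference of at most one lets any vertex of S serve as the root when the
  -- contracted flow is extended into S.
  set-tame : ∀ k S → ∣ S ∣ < k → S ⊆ W → Nonempty S → Tame F ρ P S
  set-tame (suc k) S lt S⊆ (u , u∈) with nonempty? (S ∖ ⁅ u ⁆)
  ... | no none = Tame-cong (alone S u∈ none) F ρ P (vertex-tame u (S⊆ u u∈))
  ... | yes (v , v∈) with 4 + τ (deg S F P) (bd S ρ P) ≤? deg S F P
  ...   | yes h = h
  ...   | no ¬h = ⊥-elim (extend (contract-in S S⊆ u v u∈ (∖⊆ S ⁅ u ⁆ v v∈) λ { refl → true≢false (∈⁅⁆ u) (∖∉ S ⁅ u ⁆ u v∈) }))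
    where
    smaller-tame : ∀ R → R ⊆ S → ∀ w → w ∈ S → w ∉ R → Nonempty R → Tame F ρ P R
    smaller-tame R R⊆ w w∈ w∉ ne = set-tame k R (≤-trans (∣∣-strict R⊆ w∈ w∉) (≤-pred lt)) (λ a a∈ → S⊆ a (R⊆ a a∈)) ne
    extend : ∃[ D ] outer S F ⊳ D × (∀ R → R ⊆ W → S ⊆ R ⊎ (∀ v → v ∈ R → v ∉ S) → Balanced R D ρ) → ⊥
    extend (D , o , bal) = no-inst (S ∖ ⁅ u ⁆) I.F′ I.ρ′ I.P′
        (inside-inst F ρ P o u∈ (λ R R⊆ u∉ ne → smaller-tame R R⊆ u u∈ u∉ ne) loose)
        (λ fl → noflow (flow-in S⊆ u∈ o bal fl))
      where
      module I = Interior S F ρ P o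
      loose : ∀ R → R ⊆ S → u ∉ R → Nonempty R → Loose F ρ P o R
      loose R R⊆ u∉ (w , w∈) = inj₁ (lin 3 (λ d d′ t → (d ≼ # 5) ∷ (# 4 ⊕ t ≼ d′) ∷ [] ⊢ (d ≼ d′ ⊕ # 1))
        (deg S F P) (deg (S ∖ R) F P) (τ (deg (S ∖ R) F P) (bd (S ∖ R) ρ P)) (small-degree (deg S F P) (bd S ρ P) (≰⇒> ¬h))
        (smaller-tame (S ∖ R) (∖⊆ S R) w (R⊆ w w∈) (∉∖ S R w w∈) (u , ∈∖ S R u u∈ u∉)))

  tame-all : ∀ S → S ⊆ W → Nonempty S → Tame F ρ P S
  tame-all S = set-tame (suc ∣ S ∣) S ≤-refl

  whole-tall′ : ∀ S → S ⊆ W → ¬ Nonempty (W ∖ S) → Tall F P S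
  whole-tall′ S S⊆ none = subst₂ (λ p c → p ≤ c + 2) (cnt-cong W≗S P) (cut-cong W≗S F) (proj₁ whole-tall) ,
      λ e → Mixed-cong W≗S P (proj₂ whole-tall (trans (cnt-cong W≗S P) (trans e (cong (_+ 2) (sym (cut-cong W≗S F))))))
    where
    W≗S : W ≗ S
    W≗S = ≗-∖-empty W S S⊆ none

  -- The recursion goes from large sets to small ones: deleting S asks for tallness of unions of S
  -- with further vertices, which are W or larger proper sets. As S is assumed to have strictly more
  -- tip edges than cut edges, no demand for both signs arises.
  set-low : ∀ k S → ∣ W ∖ S ∣ < k → S ⊆ W → Nonempty S → Nonempty (W ∖ S) → cnt S P ≤ cut S F
  set-low (suc k) S lt S⊆ ne@(s , s∈) ne′ with cnt S P ≤? cut S F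
  ... | yes h = h
  ... | no ¬h = ⊥-elim (extend (contract-out S S⊆ ne ne′))
    where
    bigger : ∀ R → R ⊆ W ∖ S → Nonempty R → cnt (R ∪ S) P ≤ cut (R ∪ S) F + 2
    bigger R R⊆ (r , r∈) = go (nonempty? (W ∖ (R ∪ S)))
      where
      sub : R ∪ S ⊆ W
      sub = ∪-⊆ R S W (λ v e → ∖⊆ W S v (R⊆ v e)) S⊆
      down : W ∖ (R ∪ S) ⊆ W ∖ S
      down v v∈ = ∈∖ W S v (∖⊆ W (R ∪ S) v v∈) (⊆-false (∈∪ʳ R S) v (∖∉ W (R ∪ S) v v∈))
      go : Dec (Nonempty (W ∖ (R ∪ S))) → cnt (R ∪ S) P ≤ cut (R ∪ S) F + 2
      go (no none) = proj₁ (whole-tall′ (R ∪ S) sub none)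
      go (yes ne″) = ≤-trans (set-low k (R ∪ S) (≤-trans (∣∣-strict down (R⊆ r r∈) (∉∖ W (R ∪ S) r (∈∪ˡ R S r r∈))) (≤-pred lt)) sub (s , ∈∪ʳ R S s s∈) ne″) (m≤m+n _ 2)
    extend : ∃[ D ] outer (∁ S) F ⊳ D × (∀ R → R ⊆ S → Balanced R D ρ) → ⊥
    extend (D , o , bal) = no-inst (W ∖ S) I.F′ I.ρ′ I.P′
        (outside-inst F ρ P o (λ R R⊆ → tame-all R (λ v e → ∖⊆ W S v (R⊆ v e))) (<⇒≤ (≰⇒> ¬h)) bigger
          (λ R R⊆ _ e → ⊥-elim (¬h (≤-reflexive e))))
        (λ fl → noflow (flow-out o bal fl))
      where
      module I = Interior (∁ S) F ρ P o

  inst : Inst W F ρ P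
  inst S S⊆ ne with nonempty? (W ∖ S)
  ... | no none = good (tame-all S S⊆ ne) (whole-tall′ S S⊆ none)
  ... | yes ne′ = good (tame-all S S⊆ ne)
      (≤-trans low (m≤m+n _ 2) , λ e → ⊥-elim (lin 2 (λ c p → (p ≼ c) ∷ (p ≈ c ⊕ # 2) ∷ [] ⊢ absurd) (cut S F) (cnt S P) low e))
    where
    low = set-low (suc ∣ W ∖ S ∣) S ≤-refl S⊆ ne ne′

  contradiction : ⊥
  contradiction = no-inst W F ρ P inst noflow

-- Translation between flows of multigraphs and balanced edge lists.

times : Z3 → ℕ → Z3
times c zero = 0₃
times c (suc k) = c +₃ times c k

times-2 : ∀ k → times 2₃ k ≡ times 1₃ k +₃ times 1₃ k
times-2 zero = refl
times-2 (suc k) = trans (cong (2₃ +₃_) (times-2 k)) (table (times 1₃ k))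
  where
  table : ∀ x → 2₃ +₃ (x +₃ x) ≡ (1₃ +₃ x) +₃ (1₃ +₃ x)
  table = from-yes (all? λ x → (2₃ +₃ (x +₃ x)) ≟ ((1₃ +₃ x) +₃ (1₃ +₃ x)))

ℤ-difference : ∀ a b → ((ℤ.+ a) ℤ.- (ℤ.+ b)) %ℕ 3 ≡ toℕ (times 1₃ a +₃ times 2₃ b)
ℤ-difference a zero = trans (cong (_% 3) (+-identityʳ a)) (trans (mod a) (cong toℕ (sym (+₃-identityʳ (times 1₃ a)))))
  where
  thrice : ∀ x → 1₃ +₃ (1₃ +₃ (1₃ +₃ x)) ≡ x
  thrice = from-yes (all? λ x → (1₃ +₃ (1₃ +₃ (1₃ +₃ x))) ≟ x)
  mod : ∀ a → a % 3 ≡ toℕ (times 1₃ a)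
  mod 0 = refl
  mod 1 = refl
  mod 2 = refl
  mod (suc (suc (suc a))) = trans (mod a) (cong toℕ (sym (thrice (times 1₃ a))))
ℤ-difference zero (suc b) = trans (mod b) (cong toℕ (sym (+₃-identityˡ (times 2₃ (suc b)))))
  where
  thrice : ∀ x → 2₃ +₃ (2₃ +₃ (2₃ +₃ x)) ≡ x
  thrice = from-yes (all? λ x → (2₃ +₃ (2₃ +₃ (2₃ +₃ x))) ≟ x)
  mod : ∀ b → ℤ.-[1+ b ] %ℕ 3 ≡ toℕ (times 2₃ (suc b))
  mod 0 = refl
  mod 1 = refl
  mod 2 = refl
  mod (suc (suc (suc b))) = trans (mod b) (cong toℕ (sym (thrice (times 2₃ (suc b)))))
ℤ-difference (suc a) (suc b) = trans (cong (_%ℕ 3) (trans (ℤₚ.[1+m]⊖[1+n]≡m⊖n a b) (sym (ℤₚ.m-n≡m⊖n a b))))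
  (trans (ℤ-difference a b) (cong toℕ (table (times 1₃ a) (times 2₃ b))))
  where
  table : ∀ x y → x +₃ y ≡ (1₃ +₃ x) +₃ (2₃ +₃ y)
  table = from-yes (all? λ x → all? λ y → (x +₃ y) ≟ ((1₃ +₃ x) +₃ (2₃ +₃ y)))

⁅⁆-sym : ∀ {n} (v w : Fin n) → ⁅ v ⁆ w ≡ ⁅ w ⁆ v
⁅⁆-sym v w with v ≟ w | w ≟ v
... | yes _ | yes _ = refl
... | no _ | no _ = refl
... | yes e | no ≢ = ⊥-elim (≢ (sym e))
... | no ≢ | yes e = ⊥-elim (≢ (sym e))

sum₃-partition : ∀ {A : Set} (f : A → Z3) p l → sum₃ f (filterᵇ p l) +₃ sum₃ f (filterᵇ (not ∘ p) l) ≡ sum₃ f l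
sum₃-partition f p [] = refl
sum₃-partition f p (a ∷ l) with p a
... | true = trans (+₃-assoc (f a) _ _) (cong (f a +₃_) (sum₃-partition f p l))
... | false = trans (+₃-swap (sum₃ f (filterᵇ p l)) (f a) (sum₃ f (filterᵇ (not ∘ p) l))) (cong (f a +₃_) (sum₃-partition f p l))

sum₃-filter-cong : ∀ {A : Set} {f g : A → Z3} p → (∀ a → p a ≡ true → f a ≡ g a) → ∀ l → sum₃ f (filterᵇ p l) ≡ sum₃ g (filterᵇ p l)
sum₃-filter-cong p h [] = refl
sum₃-filter-cong p h (a ∷ l) with p a in eq
... | true = cong₂ _+₃_ (h a eq) (sum₃-filter-cong p h l)
... | false = sum₃-filter-cong p h l

module _ {A : Set} where

  sum₃-filter? : ∀ {P : A → Set} (P? : ∀ a → Dec (P a)) (f : A → Z3) l → (∀ a → ¬ P a → f a ≡ 0₃) → sum₃ f (filter P? l) ≡ sum₃ f l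
  sum₃-filter? P? f [] h = refl
  sum₃-filter? P? f (a ∷ l) h with P? a
  ... | yes _ = cong (f a +₃_) (sum₃-filter? P? f l h)
  ... | no ¬p = trans (sum₃-filter? P? f l h) (trans (sym (+₃-identityˡ _)) (cong (_+₃ sum₃ f l) (sym (h a ¬p))))

  sum₃-count : ∀ {n} (f : A → Fin n) v c l → sum₃ (λ a → ⁅ v ⁆ (f a) ⋆ c) l ≡ times c (length (filter (λ a → f a ≟ v) l))
  sum₃-count f v c [] = refl
  sum₃-count f v c (a ∷ l) with f a ≟ v
  ... | yes refl rewrite ∈⁅⁆ (f a) = cong (c +₃_) (sum₃-count f v c l)
  ... | no ≢ rewrite ∉⁅⁆ v (f a) (λ e → ≢ (sym e)) = trans (+₃-identityˡ _) (sum₃-count f v c l)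

  sum-count : ∀ {n} (f : A → Fin n) v l → sum (λ a → ⟨ ⁅ v ⁆ (f a) ⟩) l ≡ length (filter (λ a → f a ≟ v) l)
  sum-count f v [] = refl
  sum-count f v (a ∷ l) with f a ≟ v
  ... | yes refl rewrite ∈⁅⁆ (f a) = cong suc (sum-count f v l)
  ... | no ≢ rewrite ∉⁅⁆ v (f a) (λ e → ≢ (sym e)) = sum-count f v l

  foldr-filter : ∀ {P : A → Set} (P? : ∀ a → Dec (P a)) (β : A → Z3) l → Defs.sum₃ (map β (filter P? l)) ≡ sum₃ (λ a → does (P? a) ⋆ β a) l
  foldr-filter P? β [] = refl
  foldr-filter P? β (a ∷ l) with P? a
  ... | yes _ = cong (β a +₃_) (foldr-filter P? β l)
  ... | no _ = trans (foldr-filter P? β l) (sym (+₃-identityˡ _))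

  sum-∈ : ∀ (f : A → ℕ) {a l} → a L.∈ l → f a ≤ sum f l
  sum-∈ f {l = b ∷ l} (Any.here refl) = m≤m+n (f b) _
  sum-∈ f {l = b ∷ l} (Any.there h) = ≤-trans (sum-∈ f h) (m≤n+m _ (f b))

  ∈-filterᵇ : ∀ p {a} {l : List A} → a L.∈ l → p a ≡ true → a L.∈ filterᵇ p l
  ∈-filterᵇ p {a} (Any.here refl) e rewrite e = Any.here refl
  ∈-filterᵇ p {a} {b ∷ l} (Any.there h) e with p b
  ... | true = Any.there (∈-filterᵇ p h e)
  ... | false = ∈-filterᵇ p h e

sum₃-single : ∀ {n} (c : Fin n → Z3) {v l} → Unique l → v L.∈ l → sum₃ (λ w → ⁅ v ⁆ w ⋆ c w) l ≡ c v
sum₃-single c {v} {_ ∷ l} (fresh ∷ u) (Any.here refl) rewrite ∈⁅⁆ v = trans (cong (c v +₃_) (away l fresh)) (+₃-identityʳ (c v))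
  where
  away : ∀ l → All (v ≢_) l → sum₃ (λ w → ⁅ v ⁆ w ⋆ c w) l ≡ 0₃
  away [] [] = refl
  away (w ∷ l) (≢ ∷ fresh) rewrite ∉⁅⁆ v w ≢ = trans (+₃-identityˡ _) (away l fresh)
sum₃-single c {v} {w ∷ l} (fresh ∷ u) (Any.there h) rewrite ∉⁅⁆ v w (λ e → All.lookup fresh h (sym e)) =
  trans (+₃-identityˡ _) (sum₃-single c u h)

-- Contractions are described by a map to representatives, whereas a partition is a surjection onto
-- an initial segment; here the fibres are renumbered.
quotient : ∀ m {l} (f : Fin m → Fin l) → ∃[ k ] Σ[ p ∈ (Fin m → Fin k) ]
  (∀ i → ∃[ a ] p a ≡ i) × (∀ a b → p a ≡ p b → f a ≡ f b) × (∀ a b → f a ≡ f b → p a ≡ p b)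
quotient zero f = 0 , (λ ()) , (λ ()) , (λ ()) , λ ()
quotient (suc m) {l} f with quotient m (f ∘ suc) | any? (λ a → f (suc a) ≟ f zero)
... | k , p , surj , sound , complete | yes (a₀ , e₀) = k , p′ , (λ i → suc (proj₁ (surj i)) , proj₂ (surj i)) , sound′ , complete′
  where
  p′ : Fin (suc m) → Fin k
  p′ zero = p a₀
  p′ (suc a) = p a
  sound′ : ∀ a b → p′ a ≡ p′ b → f a ≡ f b
  sound′ zero zero e = refl
  sound′ zero (suc b) e = trans (sym e₀) (sound a₀ b e)
  sound′ (suc a) zero e = trans (sound a a₀ e) e₀
  sound′ (suc a) (suc b) e = sound a b e
  complete′ : ∀ a b → f a ≡ f b → p′ a ≡ p′ b
  complete′ zero zero e = refl
  complete′ zero (suc b) e = complete a₀ b (trans e₀ e)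
  complete′ (suc a) zero e = complete a a₀ (trans e (sym e₀))
  complete′ (suc a) (suc b) e = complete a b e
... | k , p , surj , sound , complete | no new = suc k , p′ , surj′ , sound′ , complete′
  where
  p′ : Fin (suc m) → Fin (suc k)
  p′ zero = zero
  p′ (suc a) = suc (p a)
  surj′ : ∀ i → ∃[ a ] p′ a ≡ i
  surj′ zero = zero , refl
  surj′ (suc i) = suc (proj₁ (surj i)) , cong suc (proj₂ (surj i))
  sound′ : ∀ a b → p′ a ≡ p′ b → f a ≡ f b
  sound′ zero zero e = refl
  sound′ (suc a) (suc b) e = sound a b (Data.Fin.Properties.suc-injective e)
  complete′ : ∀ a b → f a ≡ f b → p′ a ≡ p′ b
  complete′ zero zero e = refl
  complete′ zero (suc b) e = ⊥-elim (new (b , sym e))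
  complete′ (suc a) zero e = ⊥-elim (new (a , e))
  complete′ (suc a) (suc b) e = cong suc (complete a b e)

-- The edges of a contraction are positions in a list of edges. Edges missing from the list, which
-- will be the deleted loops, get an arbitrary direction.
extend-lookup : ∀ {m} {l : List (Fin m)} → Unique l → (f : Fin (length l) → Bool) → Σ[ o ∈ (Fin m → Bool) ] (∀ j → o (lookup l j) ≡ f j)
extend-lookup {l = []} _ f = (λ _ → true) , λ ()
extend-lookup {m} {e ∷ l} (fresh ∷ u) f with extend-lookup u (f ∘ suc)
... | o , h = o′ , eq
  where
  o′ : Fin m → Bool
  o′ a = if ⁅ e ⁆ a then f zero else o a
  eq : ∀ j → o′ (lookup (e ∷ l) j) ≡ f j
  eq zero rewrite ∈⁅⁆ e = refl
  eq (suc j) rewrite ∉⁅⁆ e (lookup l j) (All.lookup fresh (∈-lookup j)) = h j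

charges : ∀ {n} → (Fin n → Z3) → List (Charge n)
charges β = map (λ v → v , β v) (allFin _)

ev-charges : ∀ {n} (β : Fin n → Z3) S → ev S (charges β) ≡ sum₃ (λ v → S v ⋆ β v) (allFin n)
ev-charges β S = sum₃-map (weigh S) (λ v → v , β v) (allFin _)

ev-charges-⁅⁆ : ∀ {n} (β : Fin n → Z3) v → ev ⁅ v ⁆ (charges β) ≡ β v
ev-charges-⁅⁆ {n} β v = trans (ev-charges β ⁅ v ⁆) (sum₃-single β (allFin⁺ n) (∈-allFin v))

sum₃-lookup : ∀ {A : Set} (g : A → Z3) (l : List A) → sum₃ (λ j → g (lookup l j)) (allFin (length l)) ≡ sum₃ g l
sum₃-lookup g l = trans (sym (sum₃-map g (lookup l) (allFin (length l))))
  (cong (sum₃ g) (trans (map-tabulate (λ j → j) (lookup l)) (tabulate-lookup l)))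

-- A flow of a contraction is balanced on each fibre, and S is a disjoint union of fibres, which are
-- split off one by one.
balanced-fibres : ∀ {n k} (p : Fin n → Fin k) {D ρ} m (S : VSet n) → ∣ S ∣ < m → (∀ u w → p u ≡ p w → S u ≡ S w) →
  (∀ v → v ∈ S → Balanced (⁅ p v ⁆ ∘ p) D ρ) → Balanced S D ρ
balanced-fibres p {D} {ρ} (suc m) S lt sat fibres with nonempty? S
... | no empty = Balanced-empty S D ρ (empty-∉ S empty)
... | yes (v , v∈) = Balanced-split S C D ρ (Balanced-cong (λ w → sym (∩-⊆ S C C⊆S w)) (fibres v v∈))
    (balanced-fibres p m (S ∖ C) (≤-trans (∣∣-strict (∖⊆ S C) v∈ v∉) (≤-pred lt)) sat′ (λ w w∈ → fibres w (∖⊆ S C w w∈)))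
  where
  C = ⁅ p v ⁆ ∘ p
  C⊆S : C ⊆ S
  C⊆S w w∈ = trans (sym (sat v w (∈⁅⁆⇒≡ (p v) (p w) w∈))) v∈
  v∉ : v ∉ S ∖ C
  v∉ rewrite v∈ | ∈⁅⁆ (p v) = refl
  sat′ : ∀ u w → p u ≡ p w → (S ∖ C) u ≡ (S ∖ C) w
  sat′ u w e = cong₂ (λ a c → a ∧ not c) (sat u w e) (cong ⁅ p v ⁆ e)

module Oriented (G : Multigraph) where

  dir : Orientation G → Defs.Edge G → Edge (nV G)
  dir o e = tail G o e , head G o e

  arcs : Orientation G → List (Edge (nV G))
  arcs o = map (dir o) (allFin (nE G))

  net-arcs : ∀ S o → net S (arcs o) ≡ sum₃ (λ e → arc S (dir o e)) (allFin (nE G))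
  net-arcs S o = sum₃-map (arc S) (dir o) (allFin (nE G))

  net-⁅⁆ : ∀ o v → net ⁅ v ⁆ (arcs o) ≡ times 2₃ (outdeg G o v) +₃ times 1₃ (indeg G o v)
  net-⁅⁆ o v = trans (net-arcs ⁅ v ⁆ o) (trans (sum₃-+ (λ e → ⁅ v ⁆ (tail G o e) ⋆ 2₃) (λ e → ⁅ v ⁆ (head G o e) ⋆ 1₃) (allFin (nE G)))
    (cong₂ _+₃_ (sum₃-count (tail G o) v 2₃ (allFin (nE G))) (sum₃-count (head G o) v 1₃ (allFin (nE G)))))

  flow⇒balance : ∀ β o v → FlowAt G β o v → net ⁅ v ⁆ (arcs o) +₃ β v ≡ 0₃
  flow⇒balance β o v h = trans (cong (_+₃ β v) (trans (net-⁅⁆ o v) (cong (_+₃ times 1₃ (indeg G o v)) (times-2 (outdeg G o v)))))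
    (table (times 1₃ (outdeg G o v)) (times 1₃ (indeg G o v)) (β v)
      (trans (cong (times 1₃ (outdeg G o v) +₃_) (sym (times-2 (indeg G o v)))) (toℕ-injective (trans (sym (ℤ-difference (outdeg G o v) (indeg G o v))) h))))
    where
    table : ∀ a b c → a +₃ (b +₃ b) ≡ c → ((a +₃ a) +₃ b) +₃ c ≡ 0₃
    table = from-yes (all? λ a → all? λ b → all? λ c → ((a +₃ (b +₃ b)) ≟ c) →-dec ((((a +₃ a) +₃ b) +₃ c) ≟ 0₃))

  balance⇒flow : ∀ β o v → net ⁅ v ⁆ (arcs o) +₃ β v ≡ 0₃ → FlowAt G β o v
  balance⇒flow β o v h = trans (ℤ-difference (outdeg G o v) (indeg G o v)) (cong toℕ (trans (cong (times 1₃ (outdeg G o v) +₃_) (times-2 (indeg G o v)))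
    (table (times 1₃ (outdeg G o v)) (times 1₃ (indeg G o v)) (β v)
      (trans (cong (_+₃ β v) (sym (trans (net-⁅⁆ o v) (cong (_+₃ times 1₃ (indeg G o v)) (times-2 (outdeg G o v)))))) h))))
    where
    table : ∀ a b c → ((a +₃ a) +₃ b) +₃ c ≡ 0₃ → a +₃ (b +₃ b) ≡ c
    table = from-yes (all? λ a → all? λ b → all? λ c → ((((a +₃ a) +₃ b) +₃ c) ≟ 0₃) →-dec ((a +₃ (b +₃ b)) ≟ c))

  flow⇒balanced : ∀ β o v → FlowAt G β o v → Balanced ⁅ v ⁆ (arcs o) (charges β)
  flow⇒balanced β o v h = balanced (trans (cong (net ⁅ v ⁆ (arcs o) +₃_) (ev-charges-⁅⁆ β v)) (flow⇒balance β o v h))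

  balanced⇒flow : ∀ β o v → Balanced ⁅ v ⁆ (arcs o) (charges β) → FlowAt G β o v
  balanced⇒flow β o v (balanced e) = balance⇒flow β o v (trans (cong (net ⁅ v ⁆ (arcs o) +₃_) (sym (ev-charges-⁅⁆ β v))) e)

module Contracted (G : Multigraph) (β : Vtx G → Z3) {k : ℕ} (p : Vtx G → Fin k) (o′ : Orientation (contract G p)) where

  kept : List (Defs.Edge G)
  kept = keptEdges G p

  private
    lifted = extend-lookup (filter⁺ (λ e → ¬? (p (src G e) ≟ p (tgt G e))) (allFin⁺ (nE G))) o′

  o : Orientation G
  o = proj₁ lifted

  o-kept : ∀ j → o (lookup kept j) ≡ o′ j
  o-kept = proj₂ lifted

  net-pull : ∀ T → net (T ∘ p) (Oriented.arcs G o) ≡ net T (Oriented.arcs (contract G p) o′)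
  net-pull T = trans (Oriented.net-arcs G (T ∘ p) o) (trans (sym (sum₃-filter? (λ e → ¬? (p (src G e) ≟ p (tgt G e))) (λ e → arc (T ∘ p) (Oriented.dir G o e)) (allFin (nE G)) loop))
    (trans (sym (sum₃-lookup (λ e → arc (T ∘ p) (Oriented.dir G o e)) kept)) (trans (sum₃-cong same-arc (allFin (length kept))) (sym (Oriented.net-arcs (contract G p) T o′)))))
    where
    cancel : ∀ a → a ⋆ 2₃ +₃ a ⋆ 1₃ ≡ 0₃
    cancel true = refl
    cancel false = refl
    loop : ∀ e → ¬ (p (src G e) ≢ p (tgt G e)) → arc (T ∘ p) (Oriented.dir G o e) ≡ 0₃
    loop e ¬≢ with p (src G e) ≟ p (tgt G e)
    ... | no ≢ = ⊥-elim (¬≢ ≢)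
    ... | yes eq with o e
    ...   | true = trans (cong (λ a → T a ⋆ 2₃ +₃ T (p (tgt G e)) ⋆ 1₃) eq) (cancel (T (p (tgt G e))))
    ...   | false = trans (cong (λ a → T (p (tgt G e)) ⋆ 2₃ +₃ T a ⋆ 1₃) eq) (cancel (T (p (tgt G e))))
    same-arc : ∀ j → arc (T ∘ p) (Oriented.dir G o (lookup kept j)) ≡ arc T (Oriented.dir (contract G p) o′ j)
    same-arc j rewrite o-kept j with o′ j
    ... | true = refl
    ... | false = refl

  ev-pull : ∀ i → ev (⁅ i ⁆ ∘ p) (charges β) ≡ contractβ G p β i
  ev-pull i = trans (ev-charges β (⁅ i ⁆ ∘ p)) (trans (sum₃-cong (λ v → cong (_⋆ β v) (⁅⁆-sym i (p v))) (allFin (nV G)))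
    (sym (foldr-filter (λ v → p v ≟ i) β (allFin (nV G)))))

  fibre-balanced : IsNZFlow (contract G p) (contractβ G p β) o′ → ∀ v → Balanced (⁅ p v ⁆ ∘ p) (Oriented.arcs G o) (charges β)
  fibre-balanced flow v = balanced (trans (cong₂ _+₃_ (net-pull ⁅ p v ⁆) (ev-pull (p v)))
    (Oriented.flow⇒balance (contract G p) (contractβ G p β) o′ (p v) (flow (p v))))

-- The form in which criticality is used: the flow of the contraction, lifted to an orientation of
-- G, is balanced on every set that respects the fibres of f. Tip edges survive the contraction
-- because z is alone in its fibre and G is loopless, so the lift agrees with ψ on them.
critical-orientation : ∀ G → Loopless G → ∀ β z ψ → IsCritical G β z ψ → (f : Vtx G → Vtx G) →
  ∃[ u ] ∃[ v ] (u ≢ v × f u ≡ f v) → (∀ v → f v ≡ f z → v ≡ z) →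
  ∃[ o ] ((∀ e → Incident G e z → o e ≡ ψ e) × (∀ S → (∀ v → S (f v) ≡ S v) → Balanced S (Oriented.arcs G o) (charges β)))
critical-orientation G loopless β z ψ (_ , crit) f (u , v , u≢v , e) tip with quotient (nV G) f
... | k , p , surj , sound , complete with crit k p surj (u , v , u≢v , complete u v e) (λ w h → tip w (sound w z h))
...   | o′ , agrees , flow = C.o , tips , λ S sat → balanced-fibres p (suc ∣ S ∣) S ≤-refl
          (λ a b h → trans (sym (sat a)) (trans (cong S (sound a b h)) (sat b))) (λ w _ → C.fibre-balanced flow w)
  where
  module C = Contracted G β p o′
  tips : ∀ e → Incident G e z → C.o e ≡ ψ e
  tips e inc = trans (cong C.o e≡) (trans (C.o-kept j) (trans (agrees j (at-z inc)) (cong ψ (sym e≡))))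
    where
    distinct : Incident G e z → p (src G e) ≢ p (tgt G e)
    distinct (inj₁ refl) h = loopless e (sym (tip (tgt G e) (sound _ _ (sym h))))
    distinct (inj₂ refl) h = loopless e (tip (src G e) (sound _ _ h))
    e∈ : e L.∈ C.kept
    e∈ = ∈-filter⁺ (λ e → ¬? (p (src G e) ≟ p (tgt G e))) (∈-allFin e) (distinct inc)
    j = Any.index e∈
    e≡ : e ≡ lookup C.kept j
    e≡ = lookup-index e∈
    at-z : Incident G e z → Incident (contract G p) j (p z)
    at-z (inj₁ h) = inj₁ (trans (cong (λ e → p (src G e)) (sym e≡)) (cong p h))
    at-z (inj₂ h) = inj₂ (trans (cong (λ e → p (tgt G e)) (sym e≡)) (cong p h))

tauAbs-τ : ∀ G β v → tauAbs G β v ≡ τ (Defs.deg G v) (β v)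
tauAbs-τ G β v = go (Defs.deg G v) (β v) refl
  where
  parity-% : ∀ d → (odd d ≡ false × d % 2 ≡ 0) ⊎ (odd d ≡ true × d % 2 ≡ 1)
  parity-% 0 = inj₁ (refl , refl)
  parity-% 1 = inj₂ (refl , refl)
  parity-% (suc (suc d)) with parity-% d
  ... | inj₁ (e , h) = inj₁ (trans (odd-suc² d) e , h)
  ... | inj₂ (e , h) = inj₂ (trans (odd-suc² d) e , h)
  go : ∀ d b → β v ≡ b → tauAbs G β v ≡ τ (Defs.deg G v) b
  go d b e with parity-% (Defs.deg G v)
  go d 0₃ e | inj₁ (o , h) rewrite o | h | e = refl
  go d (suc _) e | inj₁ (o , h) rewrite o | h | e = refl
  go d 0₃ e | inj₂ (o , h) rewrite o | h | e = refl
  go d (suc _) e | inj₂ (o , h) rewrite o | h | e = refl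

filter-⊳ : ∀ {n} {A : Set} (q : Edge n → Bool) (f g : A → Edge n) → (∀ a → g a ≡ f a ⊎ g a ≡ (proj₂ (f a) , proj₁ (f a))) → ∀ l →
  filterᵇ q (map f l) ⊳ map g (filterᵇ (q ∘ f) l)
filter-⊳ q f g h [] = []
filter-⊳ q f g h (a ∷ l) with q (f a)
... | false = filter-⊳ q f g h l
... | true with h a
...   | inj₁ e rewrite e = keep (filter-⊳ q f g h l)
...   | inj₂ e rewrite e = flip (filter-⊳ q f g h l)

-- The instance of a critical easel.

module Easel (G : Multigraph) (loopless : Loopless G) (β : Vtx G → Z3) (boundary : IsZ3Boundary G β)
  (z x : Vtx G) (x≢z : x ≢ z) (ψ : Orientation G) (preflow : IsTipPreflow G β z ψ)
  (tame : IsTame G β z x) (tall : IsTall G z x ψ) (critical : IsCritical G β z ψ) where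

  open Oriented G

  private
    n = nV G
    es = allFin (nE G)

  edge : Defs.Edge G → Edge n
  edge e = src G e , tgt G e

  isTip : Defs.Edge G → Bool
  isTip e = ⁅ z ⁆ (src G e) ∨ ⁅ z ⁆ (tgt G e)

  toTip : Defs.Edge G → Tip n
  toTip e = if ⁅ z ⁆ (src G e) then (tgt G e , ψ e) else (src G e , not (ψ e))

  W : VSet n
  W v = not (⁅ z ⁆ v) ∧ not (⁅ x ⁆ v)

  free : List (Defs.Edge G)
  free = filterᵇ (not ∘ isTip) es

  F : List (Edge n)
  F = map edge free

  P : List (Tip n)
  P = map toTip (filterᵇ isTip es)

  unpull : Tip n → Charge n
  unpull (v , s) = v , q (not s)

  ρ : List (Charge n)
  ρ = charges β ++ map unpull P

  ev-ρ : ∀ S → ev S ρ ≡ ev S (charges β) +₃ ev S (map unpull P)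
  ev-ρ S = sum₃-++ (weigh S) (charges β) (map unpull P)

  bd-ρ : ∀ S → bd S ρ P ≡ ev S (charges β)
  bd-ρ S = trans (cong (_+₃ pulls S P) (ev-ρ S)) (trans (+₃-assoc (ev S (charges β)) _ _) (trans (cong (ev S (charges β) +₃_) cancel) (+₃-identityʳ _)))
    where
    table : ∀ a s → a ⋆ q (not s) +₃ a ⋆ q s ≡ 0₃
    table = from-yes (∀Bool? λ a → ∀Bool? λ s → (a ⋆ q (not s) +₃ a ⋆ q s) ≟ 0₃)
    cancel : ev S (map unpull P) +₃ pulls S P ≡ 0₃
    cancel = trans (cong (_+₃ pulls S P) (sum₃-map (weigh S) unpull P)) (trans (sym (sum₃-+ (weigh S ∘ unpull) (pull S) P)) (sum₃-0 (λ (v , s) → table (S v) s) P))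

  z∉W : z ∉ W
  z∉W rewrite ∈⁅⁆ z = refl

  x∉W : x ∉ W
  x∉W rewrite ∈⁅⁆ x = ∧-false _
    where
    ∧-false : ∀ a → a ∧ false ≡ false
    ∧-false true = refl
    ∧-false false = refl

  ∈W : ∀ v → v ≢ z → v ≢ x → v ∈ W
  ∈W v ≢z ≢x rewrite ∉⁅⁆ z v (λ e → ≢z (sym e)) | ∉⁅⁆ x v (λ e → ≢x (sym e)) = refl

  W≢z : ∀ v → v ∈ W → v ≢ z
  W≢z v h refl = true≢false h z∉W

  W≢x : ∀ v → v ∈ W → v ≢ x
  W≢x v h refl = true≢false h x∉W

  tip-arc : ∀ S o e → z ∉ S → isTip e ≡ true → o e ≡ ψ e → arc S (dir o e) ≡ weigh S (unpull (toTip e))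
  tip-arc S o e z∉ h agree with z ≟ src G e
  tip-arc S o e z∉ h agree | yes refl rewrite agree with ψ e
  ... | true rewrite z∉ = +₃-identityˡ _
  ... | false rewrite z∉ = +₃-identityʳ _
  tip-arc S o e z∉ h agree | no _ with z ≟ tgt G e
  ... | yes refl rewrite agree with ψ e
  ...   | true rewrite z∉ = +₃-identityʳ _
  ...   | false rewrite z∉ = +₃-identityˡ _

  incident⇒tip : ∀ e → Incident G e z → isTip e ≡ true
  incident⇒tip e (inj₁ refl) rewrite ∈⁅⁆ z = refl
  incident⇒tip e (inj₂ refl) rewrite ∈⁅⁆ z with ⁅ z ⁆ (src G e)
  ... | true = refl
  ... | false = refl

  tip⇒incident : ∀ e → isTip e ≡ true → Incident G e z
  tip⇒incident e h with ∪-elim (λ _ → ⁅ z ⁆ (src G e)) (λ _ → ⁅ z ⁆ (tgt G e)) z h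
  ... | inj₁ k = inj₁ (sym (∈⁅⁆⇒≡ z (src G e) k))
  ... | inj₂ k = inj₂ (sym (∈⁅⁆⇒≡ z (tgt G e) k))

  free-ends : ∀ e → not (isTip e) ≡ true → src G e ≢ z × tgt G e ≢ z
  free-ends e h = (λ k → clash (incident⇒tip e (inj₁ k))) , (λ k → clash (incident⇒tip e (inj₂ k)))
    where
    clash : isTip e ≡ true → ⊥
    clash k = true≢false h (cong not k)

  net-total : ∀ S o → z ∉ S → (∀ e → Incident G e z → o e ≡ ψ e) → net S (arcs o) ≡ net S (map (dir o) free) +₃ ev S (map unpull P)
  net-total S o z∉ agree = trans (net-arcs S o) (trans (sym (sum₃-partition (λ e → arc S (dir o e)) isTip es)) (trans (+₃-comm (sum₃ (λ e → arc S (dir o e)) (filterᵇ isTip es)) _)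
    (cong₂ _+₃_ (sym (sum₃-map (arc S) (dir o) free))
      (trans (sum₃-filter-cong isTip (λ e h → tip-arc S o e z∉ h (agree e (tip⇒incident e h))) es)
        (sym (trans (sum₃-map (weigh S) unpull P) (sum₃-map (weigh S ∘ unpull) toTip (filterᵇ isTip es))))))))

  free-balance : ∀ S o → z ∉ S → (∀ e → Incident G e z → o e ≡ ψ e) →
    net S (map (dir o) free) +₃ ev S ρ ≡ net S (arcs o) +₃ ev S (charges β)
  free-balance S o z∉ agree = trans (cong (net S (map (dir o) free) +₃_) (trans (ev-ρ S) (+₃-comm (ev S (charges β)) _)))
    (trans (sym (+₃-assoc (net S (map (dir o) free)) _ _)) (cong (_+₃ ev S (charges β)) (sym (net-total S o z∉ agree))))

  ends-at : Vtx G → Defs.Edge G → ℕ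
  ends-at v e = ⟨ ⁅ v ⁆ (src G e) ⟩ + ⟨ ⁅ v ⁆ (tgt G e) ⟩

  sum-ends : ∀ v → sum (ends-at v) es ≡ Defs.deg G v
  sum-ends v = trans (sum-+ (λ e → ⟨ ⁅ v ⁆ (src G e) ⟩) (λ e → ⟨ ⁅ v ⁆ (tgt G e) ⟩) es) (cong₂ _+_ (sum-count (src G) v es) (sum-count (tgt G) v es))

  deg-⁅⁆ : ∀ v → v ≢ z → deg ⁅ v ⁆ F P ≡ Defs.deg G v
  deg-⁅⁆ v v≢z = trans (cong₂ _+_ (sum-map (crossing ⁅ v ⁆) edge free) (sum-map (at ⁅ v ⁆) toTip (filterᵇ isTip es)))
    (trans (cong₂ _+_ (sum-cong free-end free) (sum-filter-cong isTip tip-end es))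
      (trans (+-comm (sum (ends-at v) free) _) (trans (sum-partition (ends-at v) isTip es) (sum-ends v))))
    where
    free-end : ∀ e → crossing ⁅ v ⁆ (edge e) ≡ ends-at v e
    free-end e with v ≟ src G e | v ≟ tgt G e
    ... | yes p | yes p′ = ⊥-elim (loopless e (trans (sym p) p′))
    ... | yes _ | no _ = refl
    ... | no _ | yes _ = refl
    ... | no _ | no _ = refl
    tip-end : ∀ e → isTip e ≡ true → at ⁅ v ⁆ (toTip e) ≡ ends-at v e
    tip-end e h with z ≟ src G e
    ... | yes refl rewrite ∉⁅⁆ v z v≢z = refl
    ... | no _ with z ≟ tgt G e
    ...   | yes refl rewrite ∉⁅⁆ v z v≢z = sym (+-identityʳ _)

  deg-z : Defs.deg G z ≡ length P
  deg-z = trans (sym (sum-ends z)) (trans (sym (sum-filter (ends-at z) isTip es none)) (trans (sum-filter-cong isTip one es)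
      (trans (sum-1 (filterᵇ isTip es)) (sym (length-map toTip (filterᵇ isTip es))))))
    where
    none : ∀ e → isTip e ≡ false → ends-at z e ≡ 0
    none e h with z ≟ src G e | z ≟ tgt G e
    ... | no _ | no _ = refl
    one : ∀ e → isTip e ≡ true → ends-at z e ≡ 1
    one e h with z ≟ src G e | z ≟ tgt G e
    ... | yes p | yes p′ = ⊥-elim (loopless e (trans (sym p) p′))
    ... | yes _ | no _ = refl
    ... | no _ | yes _ = refl

  toTip-≢z : ∀ e → isTip e ≡ true → proj₁ (toTip e) ≢ z
  toTip-≢z e h k with z ≟ src G e
  ... | yes refl = loopless e (sym k)
  ... | no ≢ = ≢ (sym k)

  cnt-W : cnt W P + cnt ⁅ x ⁆ P ≡ length P
  cnt-W = trans (cong₂ _+_ (sum-map (at W) toTip tips) (sum-map (at ⁅ x ⁆) toTip tips)) (trans (sym (sum-+ (at W ∘ toTip) (at ⁅ x ⁆ ∘ toTip) tips))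
    (trans (sum-filter-cong isTip (λ e h → one (proj₁ (toTip e)) (toTip-≢z e h)) es) (trans (sum-1 tips) (sym (length-map toTip tips)))))
    where
    tips = filterᵇ isTip es
    one : ∀ v → v ≢ z → ⟨ W v ⟩ + ⟨ ⁅ x ⁆ v ⟩ ≡ 1
    one v v≢z rewrite ∉⁅⁆ z v (λ e → v≢z (sym e)) with ⁅ x ⁆ v
    ... | true = refl
    ... | false = refl

  cut-W : cut W F ≡ cut ⁅ x ⁆ F
  cut-W = trans (sum-map (crossing W) edge free) (trans (sum-filter-cong (not ∘ isTip) (λ e h → flipped e (free-ends e h)) es) (sym (sum-map (crossing ⁅ x ⁆) edge free)))
    where
    flipped : ∀ e → src G e ≢ z × tgt G e ≢ z → crossing W (edge e) ≡ crossing ⁅ x ⁆ (edge e)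
    flipped e (≢s , ≢t) rewrite ∉⁅⁆ z (src G e) (λ k → ≢s (sym k)) | ∉⁅⁆ z (tgt G e) (λ k → ≢t (sym k)) with ⁅ x ⁆ (src G e) | ⁅ x ⁆ (tgt G e)
    ... | true | true = refl
    ... | true | false = refl
    ... | false | true = refl
    ... | false | false = refl

  vertex-tame : ∀ v → v ∈ W → Tame F ρ P ⁅ v ⁆
  vertex-tame v v∈ = subst₂ (λ d b → 4 + τ d b ≤ d) (sym (deg-⁅⁆ v (W≢z v v∈))) (sym (trans (bd-ρ ⁅ v ⁆) (ev-charges-⁅⁆ β v)))
    (subst (λ t → 4 + t ≤ Defs.deg G v) (tauAbs-τ G β v) (tame v (W≢x v v∈) (W≢z v v∈)))

  -- Edges between z and x count in both degrees and cancel, which turns tallness of the easel into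
  -- tallness of W.
  whole-tall : Tall F P W
  whole-tall = lin 6 (λ p px c cx dz dx → (p ⊕ px ≈ dz) ∷ (c ≈ cx) ∷ (cx ⊕ px ≈ dx) ∷ (dz ≼ dx ⊕ # 2) ∷ [] ⊢ (p ≼ c ⊕ # 2)) (cnt W P) (cnt ⁅ x ⁆ P) (cut W F) (cut ⁅ x ⁆ F) (Defs.deg G z) (Defs.deg G x)
      (trans cnt-W (sym deg-z)) cut-W (deg-⁅⁆ x x≢z) (proj₁ tall) ,
    λ e → mixed (proj₂ tall (lin 6 (λ p px c cx dz dx → (p ⊕ px ≈ dz) ∷ (c ≈ cx) ∷ (cx ⊕ px ≈ dx) ∷ (p ≈ c ⊕ # 2) ∷ [] ⊢ (dz ≈ dx ⊕ # 2)) (cnt W P) (cnt ⁅ x ⁆ P) (cut W F) (cut ⁅ x ⁆ F) (Defs.deg G z) (Defs.deg G x)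
      (trans cnt-W (sym deg-z)) cut-W (deg-⁅⁆ x x≢z) e))
    where
    present : ∀ s e → Incident G e z → 1 ≤ atSign s W (toTip e) → 1 ≤ sgn s W P
    present s e inc h = ≤-trans h (sum-∈ (atSign s W) (∈-map⁺ toTip (∈-filterᵇ isTip (∈-allFin e) (incident⇒tip e inc))))
    sign-false : ∀ e → ¬ Incident G e x → head G ψ e ≡ z → 1 ≤ atSign false W (toTip e)
    sign-false e ¬x h with z ≟ src G e
    sign-false e ¬x h | yes p rewrite ∈W (tgt G e) (λ k → loopless e (trans (sym p) (sym k))) (λ k → ¬x (inj₂ k)) with ψ e
    ... | true = ⊥-elim (loopless e (trans (sym p) (sym h)))
    ... | false = ≤-refl
    sign-false e ¬x h | no ≢ rewrite ∈W (src G e) (λ k → ≢ (sym k)) (λ k → ¬x (inj₁ k)) with ψ e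
    ... | true = ≤-refl
    ... | false = ⊥-elim (≢ (sym h))
    sign-true : ∀ e → ¬ Incident G e x → tail G ψ e ≡ z → 1 ≤ atSign true W (toTip e)
    sign-true e ¬x h with z ≟ src G e
    sign-true e ¬x h | yes p rewrite ∈W (tgt G e) (λ k → loopless e (trans (sym p) (sym k))) (λ k → ¬x (inj₂ k)) with ψ e
    ... | true = ≤-refl
    ... | false = ⊥-elim (loopless e (trans (sym p) (sym h)))
    sign-true e ¬x h | no ≢ rewrite ∈W (src G e) (λ k → ≢ (sym k)) (λ k → ¬x (inj₁ k)) with ψ e
    ... | true = ⊥-elim (≢ (sym h))
    ... | false = ≤-refl
    mixed : (∃[ e ] (Incident G e z × ¬ Incident G e x × head G ψ e ≡ z)) × (∃[ e ] (Incident G e z × ¬ Incident G e x × tail G ψ e ≡ z)) → Mixed P W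
    mixed ((e , inc , ¬x , h) , (e′ , inc′ , ¬x′ , h′)) true = present true e′ inc′ (sign-true e′ ¬x′ h′)
    mixed ((e , inc , ¬x , h) , (e′ , inc′ , ¬x′ , h′)) false = present false e inc (sign-false e ¬x h)

  orient-outer : ∀ K o → outer K F ⊳ map (dir o) (filterᵇ (not ∘ inside K ∘ edge) free)
  orient-outer K o = filter-⊳ (not ∘ inside K) edge (dir o) either free
    where
    either : ∀ e → dir o e ≡ edge e ⊎ dir o e ≡ (tgt G e , src G e)
    either e with o e
    ... | true = inj₁ refl
    ... | false = inj₂ refl

  outer-balanced : ∀ K S o → z ∉ S → (∀ u w → u ∈ K → w ∈ K → S u ≡ S w) → (∀ e → Incident G e z → o e ≡ ψ e) →
    Balanced S (arcs o) (charges β) → Balanced S (map (dir o) (filterᵇ (not ∘ inside K ∘ edge) free)) ρ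
  outer-balanced K S o z∉ undivided agree (balanced eq) = balanced (trans (cong (_+₃ ev S ρ) all-free) (trans (free-balance S o z∉ agree) eq))
    where
    cancel : ∀ a → a ⋆ 2₃ +₃ a ⋆ 1₃ ≡ 0₃
    cancel true = refl
    cancel false = refl
    inner-arc : ∀ e → not (inside K (edge e)) ≡ false → arc S (dir o e) ≡ 0₃
    inner-arc e h = both-ends (o e) refl
      where
      in-K : inside K (edge e) ≡ true
      in-K with inside K (edge e)
      ... | true = refl
      eq′ : S (src G e) ≡ S (tgt G e)
      eq′ = undivided (src G e) (tgt G e) (∩⊆ˡ (λ _ → K (src G e)) (λ _ → K (tgt G e)) z in-K) (∩⊆ʳ (λ _ → K (src G e)) (λ _ → K (tgt G e)) z in-K)
      both-ends : ∀ b → o e ≡ b → arc S (dir o e) ≡ 0₃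
      both-ends true h rewrite h | eq′ = cancel (S (tgt G e))
      both-ends false h rewrite h | eq′ = cancel (S (tgt G e))
    all-free : net S (map (dir o) (filterᵇ (not ∘ inside K ∘ edge) free)) ≡ net S (map (dir o) free)
    all-free = trans (sum₃-map (arc S) (dir o) (filterᵇ (not ∘ inside K ∘ edge) free)) (trans (sum₃-filter (arc S ∘ dir o) (not ∘ inside K ∘ edge) free inner-arc) (sym (sum₃-map (arc S) (dir o) free)))

  contract-in : ∀ B → B ⊆ W → ∀ u v → u ∈ B → v ∈ B → u ≢ v →
    ∃[ D ] outer B F ⊳ D × (∀ S → S ⊆ W → B ⊆ S ⊎ (∀ v → v ∈ S → v ∉ B) → Balanced S D ρ)
  contract-in B B⊆W u v u∈ v∈ u≢v = conclude (critical-orientation G loopless β z ψ critical f (u , v , u≢v , trans (f-in u u∈) (sym (f-in v v∈))) tip)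
    where
    f : Fin n → Fin n
    f w = if B w then u else w
    f-in : ∀ w → w ∈ B → f w ≡ u
    f-in w h rewrite h = refl
    f-out : ∀ w → w ∉ B → f w ≡ w
    f-out w h rewrite h = refl
    z∉B : z ∉ B
    z∉B = ⊆-false B⊆W z z∉W
    tip : ∀ w → f w ≡ f z → w ≡ z
    tip w h with decide-∈ B w
    ... | inj₁ w∈ = ⊥-elim (W≢z u (B⊆W u u∈) (trans (sym (f-in w w∈)) (trans h (f-out z z∉B))))
    ... | inj₂ w∉ = trans (sym (f-out w w∉)) (trans h (f-out z z∉B))
    conclude : ∃[ o ] ((∀ e → Incident G e z → o e ≡ ψ e) × (∀ S → (∀ v → S (f v) ≡ S v) → Balanced S (arcs o) (charges β))) →
      ∃[ D ] outer B F ⊳ D × (∀ S → S ⊆ W → B ⊆ S ⊎ (∀ v → v ∈ S → v ∉ B) → Balanced S D ρ)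
    conclude (o , agree , bal) = _ , orient-outer B o , λ S S⊆ und →
        outer-balanced B S o (⊆-false S⊆ z z∉W) (λ a c a∈ c∈ → trans (const S und a a∈) (sym (const S und c c∈))) agree (bal S (saturated S und))
      where
      const : ∀ S → B ⊆ S ⊎ (∀ v → v ∈ S → v ∉ B) → ∀ a → a ∈ B → S a ≡ S u
      const S (inj₁ h) a a∈ = trans (h a a∈) (sym (h u u∈))
      const S (inj₂ h) a a∈ = trans (off a a∈) (sym (off u u∈))
        where
        off : ∀ a → a ∈ B → a ∉ S
        off a a∈ with decide-∈ S a
        ... | inj₁ e = ⊥-elim (true≢false a∈ (h a e))
        ... | inj₂ e = e
      saturated : ∀ S → B ⊆ S ⊎ (∀ v → v ∈ S → v ∉ B) → ∀ a → S (f a) ≡ S a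
      saturated S und a with decide-∈ B a
      ... | inj₁ a∈ = trans (cong S (f-in a a∈)) (sym (const S und a a∈))
      ... | inj₂ a∉ = cong S (f-out a a∉)

  module Rest (B : VSet n) (B⊆W : B ⊆ W) (ne : Nonempty (W ∖ B)) where

    f : Fin n → Fin n
    f w = if ⁅ z ⁆ w then z else if B w then w else x

    f-z : f z ≡ z
    f-z rewrite ∈⁅⁆ z = refl

    f-in : ∀ w → w ∈ B → f w ≡ w
    f-in w h rewrite ∉⁅⁆ z w (λ e → W≢z w (B⊆W w h) (sym e)) | h = refl

    f-out : ∀ w → w ≢ z → w ∉ B → f w ≡ x
    f-out w w≢z h rewrite ∉⁅⁆ z w (λ e → w≢z (sym e)) | h = refl

    x∉B : x ∉ B
    x∉B = ⊆-false B⊆W x x∉W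

    tip : ∀ w → f w ≡ f z → w ≡ z
    tip w h with w ≟ z
    ... | yes e = e
    ... | no w≢z with decide-∈ B w
    ...   | inj₁ w∈ = ⊥-elim (w≢z (trans (sym (f-in w w∈)) (trans h f-z)))
    ...   | inj₂ w∉ = ⊥-elim (x≢z (trans (sym (f-out w w≢z w∉)) (trans h f-z)))

    orientation : ∃[ o ] ((∀ e → Incident G e z → o e ≡ ψ e) × (∀ S → (∀ v → S (f v) ≡ S v) → Balanced S (arcs o) (charges β)))
    orientation = critical-orientation G loopless β z ψ critical f
      (x , proj₁ ne , (λ e → W≢x (proj₁ ne) (∖⊆ W B (proj₁ ne) (proj₂ ne)) (sym e)) ,
        trans (f-out x x≢z x∉B) (sym (f-out (proj₁ ne) (W≢z (proj₁ ne) (∖⊆ W B (proj₁ ne) (proj₂ ne))) (∖∉ W B (proj₁ ne) (proj₂ ne)))))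
      tip

  contract-out : ∀ B → B ⊆ W → Nonempty B → Nonempty (W ∖ B) →
    ∃[ D ] outer (∁ B) F ⊳ D × (∀ S → S ⊆ B → Balanced S D ρ)
  contract-out B B⊆W _ ne = conclude R.orientation
    where
    module R = Rest B B⊆W ne
    conclude : ∃[ o ] ((∀ e → Incident G e z → o e ≡ ψ e) × (∀ S → (∀ v → S (R.f v) ≡ S v) → Balanced S (arcs o) (charges β))) →
      ∃[ D ] outer (∁ B) F ⊳ D × (∀ S → S ⊆ B → Balanced S D ρ)
    conclude (o , agree , bal) = _ , orient-outer (∁ B) o , λ S S⊆ →
        outer-balanced (∁ B) S o (⊆-false S⊆ z (⊆-false B⊆W z z∉W))
          (λ a c a∉ c∉ → trans (⊆-false S⊆ a (∁-∉ a a∉)) (sym (⊆-false S⊆ c (∁-∉ c c∉)))) agree (bal S (saturated S S⊆))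
      where
      ∁-∉ : ∀ a → a ∈ ∁ B → a ∉ B
      ∁-∉ a h with B a
      ... | false = refl
      saturated : ∀ S → S ⊆ B → ∀ a → S (R.f a) ≡ S a
      saturated S S⊆ a with decide-∈ B a
      ... | inj₁ a∈ = cong S (R.f-in a a∈)
      ... | inj₂ a∉ with a ≟ z
      ...   | yes refl = cong S R.f-z
      ...   | no a≢z = trans (cong S (R.f-out a a≢z a∉)) (trans (⊆-false S⊆ x R.x∉B) (sym (⊆-false S⊆ a a∉)))

  full : VSet n
  full _ = true

  net-full : ∀ o → net full (arcs o) ≡ 0₃
  net-full o = trans (net-arcs full o) (sum₃-0 (λ _ → refl) es)

  ev-sumOver : ∀ C → ev C (charges β) ≡ sumOver G C β
  ev-sumOver C = trans (ev-charges β C) (trans (sum₃-cong (λ v → cong (_⋆ β v) (does-≟ (C v))) (allFin n)) (sym (foldr-filter (λ v → C v 𝔹.≟ true) β (allFin n))))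
    where
    does-≟ : ∀ b → b ≡ does (b 𝔹.≟ true)
    does-≟ true = refl
    does-≟ false = refl

  -- A boundary is defined by its components. Instead of enumerating them, the flow that criticality
  -- provides after merging all vertices but the tip shows that the total is 0. If x and z are the
  -- only vertices, there is nothing to merge, but then the components are evident.
  total : ev full (charges β) ≡ 0₃
  total with nonempty? W
  ... | yes ne = by-criticality (R.orientation)
    where
    module R = Rest (λ _ → false) (λ _ ()) (proj₁ ne , ∈∖ W (λ _ → false) (proj₁ ne) (proj₂ ne) refl)
    by-criticality : ∃[ o ] ((∀ e → Incident G e z → o e ≡ ψ e) × (∀ S → (∀ v → S (R.f v) ≡ S v) → Balanced S (arcs o) (charges β))) → ev full (charges β) ≡ 0₃
    by-criticality (o , _ , bal) = trans (sym (+₃-identityˡ _)) (trans (cong (_+₃ ev full (charges β)) (sym (net-full o))) (balance (bal full (λ _ → refl))))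
  ... | no empty with any? {P = λ (_ : Defs.Edge G) → ⊤} (λ _ → yes tt)
  ...   | yes (e , _) = trans (ev-sumOver full) (boundary (src G e) full (λ w → mk⇔ (λ _ → reachable w) (λ _ → refl)))
    where
    x-or-z : ∀ w → w ≡ z ⊎ w ≡ x
    x-or-z w with w ≟ z | w ≟ x
    ... | yes p | _ = inj₁ p
    ... | no _ | yes p = inj₂ p
    ... | no p | no p′ = ⊥-elim (empty (w , ∈W w p p′))
    reachable : ∀ w → Connected G (src G e) w
    reachable w with x-or-z (src G e) | x-or-z (tgt G e) | x-or-z w
    ... | inj₁ s | inj₁ t | _ = ⊥-elim (loopless e (trans s (sym t)))
    ... | inj₂ s | inj₂ t | _ = ⊥-elim (loopless e (trans s (sym t)))
    ... | inj₁ s | inj₂ t | inj₁ k = subst (Connected G (src G e)) (trans s (sym k)) Connected.here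
    ... | inj₁ s | inj₂ t | inj₂ k = subst (Connected G (src G e)) (trans t (sym k)) (Connected.step e (inj₁ (refl , refl)) Connected.here)
    ... | inj₂ s | inj₁ t | inj₁ k = subst (Connected G (src G e)) (trans t (sym k)) (Connected.step e (inj₁ (refl , refl)) Connected.here)
    ... | inj₂ s | inj₁ t | inj₂ k = subst (Connected G (src G e)) (trans s (sym k)) Connected.here
  ...   | no edgeless = trans (sym (ev-split full ⁅ x ⁆ (charges β)))
      (cong₂ _+₃_ (isolated x) (trans (ev-cong rest (charges β)) (isolated z)))
    where
    isolated : ∀ v → ev ⁅ v ⁆ (charges β) ≡ 0₃
    isolated v = trans (ev-sumOver ⁅ v ⁆) (boundary v ⁅ v ⁆ (λ w → mk⇔ (λ h → subst (Connected G v) (∈⁅⁆⇒≡ v w h) Connected.here) alone-here))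
      where
      alone-here : ∀ {w} → Connected G v w → w ∈ ⁅ v ⁆
      alone-here Connected.here = ∈⁅⁆ v
      alone-here (Connected.step e _ _) = ⊥-elim (edgeless (e , tt))
    rest : (full ∖ ⁅ x ⁆) ≗ ⁅ z ⁆
    rest w with x ≟ w | z ≟ w
    ... | yes refl | yes refl = ⊥-elim (x≢z refl)
    ... | yes _ | no _ = refl
    ... | no _ | yes _ = refl
    ... | no p | no p′ = ⊥-elim (empty (w , ∈W w (λ k → p′ (sym k)) (λ k → p (sym k))))

  orientation-of : ∀ {l D} → Unique l → map edge l ⊳ D → ∃[ o ] map (dir o) l ≡ D
  orientation-of {[]} _ [] = (λ _ → true) , refl
  orientation-of {e ∷ l} (fresh ∷ u) o = cons o
    where
    cons : ∀ {D} → edge e ∷ map edge l ⊳ D → ∃[ o ] map (dir o) (e ∷ l) ≡ D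
    cons (keep o) with orientation-of u o
    ... | o′ , refl = o″ , cong₂ _∷_ head-eq (map-cong-local (All.map (λ {a} ≢ → cong (λ b → (if b then src G a else tgt G a) , (if b then tgt G a else src G a)) (other a ≢)) fresh))
      where
      o″ : Orientation G
      o″ a = if ⁅ e ⁆ a then true else o′ a
      other : ∀ a → e ≢ a → o″ a ≡ o′ a
      other a ≢ rewrite ∉⁅⁆ e a ≢ = refl
      head-eq : dir o″ e ≡ edge e
      head-eq rewrite ∈⁅⁆ e = refl
    cons (flip o) with orientation-of u o
    ... | o′ , refl = o″ , cong₂ _∷_ head-eq (map-cong-local (All.map (λ {a} ≢ → cong (λ b → (if b then src G a else tgt G a) , (if b then tgt G a else src G a)) (other a ≢)) fresh))
      where
      o″ : Orientation G
      o″ a = if ⁅ e ⁆ a then false else o′ a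
      other : ∀ a → e ≢ a → o″ a ≡ o′ a
      other a ≢ rewrite ∉⁅⁆ e a ≢ = refl
      head-eq : dir o″ e ≡ (tgt G e , src G e)
      head-eq rewrite ∈⁅⁆ e = refl

  -- A flow of the instance is silent about z and x. The balance at z is the preflow condition, and
  -- the balance at x follows from that of all other vertices, since the charges add up to 0.
  no-flow : ¬ Flow W F ρ
  no-flow (D , o , bal) with orientation-of (filter⁺ (λ e → 𝔹.T? (not (isTip e))) (allFin⁺ (nE G))) o
  ... | o′ , refl = proj₁ critical (o″ , agree , flow)
    where
    o″ : Orientation G
    o″ e = if isTip e then ψ e else o′ e
    agree : ∀ e → Incident G e z → o″ e ≡ ψ e
    agree e inc rewrite incident⇒tip e inc = refl
    same-free : ∀ S → net S (map (dir o″) free) ≡ net S (map (dir o′) free)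
    same-free S = trans (sum₃-map (arc S) (dir o″) free) (trans (sum₃-filter-cong (not ∘ isTip) (λ e h → cong (λ b → arc S ((if b then src G e else tgt G e) , (if b then tgt G e else src G e))) (free-value e h)) es)
      (sym (sum₃-map (arc S) (dir o′) free)))
      where
      free-value : ∀ e → not (isTip e) ≡ true → o″ e ≡ o′ e
      free-value e h with isTip e
      ... | false = refl
    on-W : ∀ S → S ⊆ W → Balanced S (arcs o″) (charges β)
    on-W S S⊆ = balanced (trans (sym (free-balance S o″ (⊆-false S⊆ z z∉W) agree)) (trans (cong (_+₃ ev S ρ) (same-free S)) (balance (bal S S⊆))))
    on-z : Balanced ⁅ z ⁆ (arcs o″) (charges β)
    on-z = balanced (trans (cong (_+₃ ev ⁅ z ⁆ (charges β)) same-net) (balance (flow⇒balanced β ψ z preflow)))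
      where
      same-arc : ∀ e → arc ⁅ z ⁆ (dir o″ e) ≡ arc ⁅ z ⁆ (dir ψ e)
      same-arc e with isTip e in h
      ... | true = refl
      ... | false = trans (off (o′ e)) (sym (off (ψ e)))
        where
        off : ∀ b → arc ⁅ z ⁆ ((if b then src G e else tgt G e) , (if b then tgt G e else src G e)) ≡ 0₃
        off b with z ≟ src G e | z ≟ tgt G e | b
        ... | no p | no p′ | true rewrite ∉⁅⁆ z (src G e) p | ∉⁅⁆ z (tgt G e) p′ = refl
        ... | no p | no p′ | false rewrite ∉⁅⁆ z (src G e) p | ∉⁅⁆ z (tgt G e) p′ = refl
      same-net : net ⁅ z ⁆ (arcs o″) ≡ net ⁅ z ⁆ (arcs ψ)
      same-net = trans (net-arcs ⁅ z ⁆ o″) (trans (sum₃-cong same-arc es) (sym (net-arcs ⁅ z ⁆ ψ)))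
    on-full : Balanced full (arcs o″) (charges β)
    on-full = balanced (trans (cong (_+₃ ev full (charges β)) (net-full o″)) (trans (+₃-identityˡ _) total))
    off-x : Balanced (full ∖ ⁅ x ⁆) (arcs o″) (charges β)
    off-x = Balanced-split (full ∖ ⁅ x ⁆) ⁅ z ⁆ (arcs o″) (charges β)
      (Balanced-cong (λ w → sym (∩-⊆ (full ∖ ⁅ x ⁆) ⁅ z ⁆ (⁅⁆⊆ (full ∖ ⁅ x ⁆) (cong not (∉⁅⁆ x z x≢z))) w)) on-z)
      (on-W ((full ∖ ⁅ x ⁆) ∖ ⁅ z ⁆) (λ v v∈ → ∈W v (λ { refl → true≢false (∈⁅⁆ z) (∖∉ (full ∖ ⁅ x ⁆) ⁅ z ⁆ z v∈) })
        (λ { refl → true≢false (∈⁅⁆ x) (∖∉ full ⁅ x ⁆ x (∖⊆ (full ∖ ⁅ x ⁆) ⁅ z ⁆ x v∈)) })))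
    on-x : Balanced ⁅ x ⁆ (arcs o″) (charges β)
    on-x = Balanced-cong (∩-⊆ full ⁅ x ⁆ (λ _ _ → refl)) (Balanced-∩ full ⁅ x ⁆ (arcs o″) (charges β) on-full off-x)
    flow : IsNZFlow G β o″
    flow v with v ≟ z | v ≟ x
    ... | yes refl | _ = balanced⇒flow β o″ z on-z
    ... | no _ | yes refl = balanced⇒flow β o″ x on-x
    ... | no p | no p′ = balanced⇒flow β o″ v (on-W ⁅ v ⁆ (⁅⁆⊆ W (∈W v p p′)))

  contradiction : ⊥
  contradiction = Critical.contradiction W F ρ P no-flow vertex-tame whole-tall contract-in contract-out

mainTheorem4 : (G : Multigraph) → Loopless G
    → (β : Vtx G → Z3) → IsZ3Boundary G β
    → (z x : Vtx G) → x ≢ z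
    → (ψ : Orientation G) → IsTipPreflow G β z ψ
    → IsTame G β z x → IsTall G z x ψ
    → ¬ IsCritical G β z ψ
mainTheorem4 G loopless β boundary z x x≢z ψ preflow tame tall critical =
  Easel.contradiction G loopless β boundary z x x≢z ψ preflow tame tall critical
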